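{- Let $p\in\{3,5,7\}$, let $\omega_p$ be the Teichmüller character modulo $p$ (a Dirichlet character modulo $p$ with values in $\mathbb{Z}_p$, with $\omega_p(m)\equiv m \pmod p$ for $p\nmid m$ and $\omega_p(m)=0$ if $p\mid m$; $\omega_p^0$ denotes the trivial character). For integers $k\ge 2$ and $0\le a,b\le p-1$ with $a\ge 1$ and $n\ge 1$ put $$c_{k,a,b,n}=\sum_{d\mid n}\omega_p^a(n/d)\,\omega_p^b(d)\,d^{k-1}\in\mathbb{Z}_p .$$ Then for all integers $n\ge 1$: (i) if $p\in\{3,5\}$, then $\tau(n)\equiv c_{k,a,b,n}\pmod p$ whenever either $a=1$ and $b+k\equiv 3\pmod{p-1}$, or $a=2$ and $b+k\equiv 2 \pmod{p-1}$; (ii) if $p=7$, then $\tau(n)\equiv c_{k,a,b,n}\pmod 7$ whenever either $a=1$ and $b+k\equiv 5\pmod 6$, or $a=4$ and $b+k\equiv 2\pmod 6$. (Moreover the constant terms agree: both $\Delta$ and the Eisenstein series $E_{k,\omega_p^a,\omega_p^b}=\sum_{n\ge1}c_{k,a,b,n}q^n$ have constant term $0$, so the $q$-expansions of $\Delta$ and $E_{k,\omega_p^a,\omega_p^b}$ are congruent modulo $p$.)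
   Context: $\tau:\mathbb{N}\to\mathbb{Z}$ is Ramanujan's tau function, defined by $\sum_{n\ge1}\tau(n)q^n=q\prod_{n\ge1}(1-q^n)^{24}$, and $\Delta=\sum_{n\ge 1}\tau(n)q^n$ is the weight-12 level-1 normalized cusp form. For Dirichlet characters $\psi,\chi$, $E_{k,\psi,\chi}$ denotes the Eisenstein series whose $n$-th Fourier coefficient ($n\ge1$) is $\sum_{d\mid n}\psi(n/d)\chi(d)d^{k-1}$ and whose constant term is $0$ when $\psi$ is nontrivial. -}

module Defs where

open import Algebra.Bundles using (CommutativeRing; RawRing)
import Algebra.Definitions.RawSemiring as RawSemiringDefs
open import Data.Integer using (ℤ; +_; 0ℤ; 1ℤ) renaming (_+_ to _+ᶻ_; _*_ to _*ᶻ_; -_ to -ᶻ_; _-_ to _-ᶻ_)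
import Data.Integer.Properties as ℤ-Properties
open import Data.Integer.Divisibility.Signed using (divides; ∣m∣n⇒∣m+n; ∣m⇒∣-m; ∣n⇒∣m*n) renaming (_∣_ to _∣ᶻ_)
open import Data.Integer.Solver using (module +-*-Solver)
open import Data.List using (filter; foldr; map; upTo)
open import Data.Nat using (ℕ; zero; suc; _+_; _*_; _∸_; _^_; _≤_; _≡ᵇ_; _/_)
open import Data.Nat.Coprimality using (Coprime)
open import Data.Nat.Divisibility using (_∣?_) renaming (_∣_ to _∣ⁿ_)
open import Data.Bool using (if_then_else_)
open import Data.Product using (_,_)
open import Level using (0ℓ)
open import Relation.Binary.PropositionalEquality using (_≡_; refl; subst)
open import Relation.Nullary using (¬_)

infix 4 _≡_[mod_]

_≡_[mod_] : ℤ → ℤ → ℕ → Set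
x ≡ y [mod m ] = + m ∣ᶻ (x -ᶻ y)

module _ {m : ℕ} where
  open +-*-Solver

  mod-reflexive : ∀ {x y} → x ≡ y → x ≡ y [mod m ]
  mod-reflexive {x} refl = divides 0ℤ (ℤ-Properties.+-inverseʳ x)

  mod-sym : ∀ {x y} → x ≡ y [mod m ] → y ≡ x [mod m ]
  mod-sym {x} {y} h = subst (+ m ∣ᶻ_)
    (solve 2 (λ a b → :- (a :- b) := b :- a) refl x y) (∣m⇒∣-m h)

  mod-trans : ∀ {x y z} → x ≡ y [mod m ] → y ≡ z [mod m ] → x ≡ z [mod m ]
  mod-trans {x} {y} {z} h k = subst (+ m ∣ᶻ_)
    (solve 3 (λ a b c → (a :- b) :+ (b :- c) := a :- c) refl x y z) (∣m∣n⇒∣m+n h k)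

  mod-+ : ∀ {x x′ y y′} → x ≡ x′ [mod m ] → y ≡ y′ [mod m ] → x +ᶻ y ≡ x′ +ᶻ y′ [mod m ]
  mod-+ {x} {x′} {y} {y′} h k = subst (+ m ∣ᶻ_)
    (solve 4 (λ a a′ b b′ → (a :- a′) :+ (b :- b′) := (a :+ b) :- (a′ :+ b′)) refl x x′ y y′)
    (∣m∣n⇒∣m+n h k)

  mod-* : ∀ {x x′ y y′} → x ≡ x′ [mod m ] → y ≡ y′ [mod m ] → x *ᶻ y ≡ x′ *ᶻ y′ [mod m ]
  mod-* {x} {x′} {y} {y′} h k = subst (+ m ∣ᶻ_)
    (solve 4 (λ a a′ b b′ → b :* (a :- a′) :+ a′ :* (b :- b′) := (a :* b) :- (a′ :* b′)) refl x x′ y y′)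
    (∣m∣n⇒∣m+n (∣n⇒∣m*n y h) (∣n⇒∣m*n x′ k))

  mod-neg : ∀ {x y} → x ≡ y [mod m ] → -ᶻ x ≡ -ᶻ y [mod m ]
  mod-neg {x} {y} h = subst (+ m ∣ᶻ_)
    (solve 2 (λ a b → :- (a :- b) := :- a :- (:- b)) refl x y) (∣m⇒∣-m h)

PowerSeries : Set → Set
PowerSeries A = ℕ → A

module FormalProduct where

  infixl 7 _⊛_
  infixr 8 _⊛^_

  _⊛_ : PowerSeries ℤ → PowerSeries ℤ → PowerSeries ℤ
  (f ⊛ g) n = foldr _+ᶻ_ 0ℤ (map (λ i → f i *ᶻ g (n ∸ i)) (upTo (suc n)))

  q^ : ℕ → PowerSeries ℤ
  q^ m n = if n ≡ᵇ m then 1ℤ else 0ℤ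

  1-q^ : ℕ → PowerSeries ℤ
  1-q^ m n = q^ 0 n -ᶻ q^ m n

  _⊛^_ : PowerSeries ℤ → ℕ → PowerSeries ℤ
  f ⊛^ zero  = q^ 0
  f ⊛^ suc r = f ⊛ (f ⊛^ r)

  -- ∏_{1 ≤ m ≤ N} (1 - q^m)²⁴
  partialProduct : ℕ → PowerSeries ℤ
  partialProduct zero    = q^ 0
  partialProduct (suc N) = partialProduct N ⊛ (1-q^ (suc N) ⊛^ 24)

open FormalProduct

-- The factors with m > n are ≡ 1 modulo qⁿ⁺¹, so the coefficient of qⁿ in the
-- infinite product q ∏_{m ≥ 1} (1 - q^m)²⁴ is already that of the partial
-- product up to m = n.
τ : ℕ → ℤ
τ n = (q^ 1 ⊛ partialProduct n) n

Δ : PowerSeries ℤ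
Δ zero    = 0ℤ
Δ (suc n) = τ (suc n)

module PAdic (p : ℕ) where

  -- ℤₚ as the inverse limit of the rings ℤ/pⁿ: approx n is a representative
  -- of the class modulo pⁿ, and equality is equality of all these classes.
  record PAdicInteger : Set where
    field
      approx   : ℕ → ℤ
      coherent : ∀ n → approx (suc n) ≡ approx n [mod p ^ n ]

  open PAdicInteger public

  infix  4 _≈_
  infixl 6 _+ₚ_ _-ₚ_
  infixl 7 _*ₚ_

  _≈_ : PAdicInteger → PAdicInteger → Set
  x ≈ y = ∀ n → approx x n ≡ approx y n [mod p ^ n ]

  _+ₚ_ _*ₚ_ _-ₚ_ : PAdicInteger → PAdicInteger → PAdicInteger
  x +ₚ y = record
    { approx   = λ n → approx x n +ᶻ approx y n
    ; coherent = λ n → mod-+ {x = approx x (suc n)} {approx x n} {approx y (suc n)} {approx y n}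
                             (coherent x n) (coherent y n) }
  x *ₚ y = record
    { approx   = λ n → approx x n *ᶻ approx y n
    ; coherent = λ n → mod-* {x = approx x (suc n)} {approx x n} {approx y (suc n)} {approx y n}
                             (coherent x n) (coherent y n) }

  negₚ : PAdicInteger → PAdicInteger
  negₚ x = record
    { approx   = λ n → -ᶻ approx x n
    ; coherent = λ n → mod-neg {x = approx x (suc n)} {approx x n} (coherent x n) }

  x -ₚ y = x +ₚ negₚ y

  ι : ℤ → PAdicInteger
  ι z = record { approx = λ _ → z ; coherent = λ _ → mod-reflexive {x = z} refl }

  0# 1# : PAdicInteger
  0# = ι 0ℤ
  1# = ι 1ℤ

  ℤₚ : CommutativeRing 0ℓ 0ℓ
  ℤₚ = record
    { Carrier = PAdicInteger
    ; _≈_ = _≈_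
    ; _+_ = _+ₚ_
    ; _*_ = _*ₚ_
    ; -_ = negₚ
    ; 0# = 0#
    ; 1# = 1#
    ; isCommutativeRing = record
      { isRing = record
        { +-isAbelianGroup = record
          { isGroup = record
            { isMonoid = record
              { isSemigroup = record
                { isMagma = record
                  { isEquivalence = record
                    { refl  = λ {x} n → mod-reflexive {x = approx x n} refl
                    ; sym   = λ {x} {y} h n → mod-sym {x = approx x n} {y = approx y n} (h n)
                    ; trans = λ {x} {y} {z} h k n →
                        mod-trans {x = approx x n} {y = approx y n} {z = approx z n} (h n) (k n) }
                  ; ∙-cong = λ {x} {x′} {y} {y′} h k n →
                        mod-+ {x = approx x n} {approx x′ n} {approx y n} {approx y′ n} (h n) (k n) }
                ; assoc = λ x y z n → mod-reflexive (ℤ-Properties.+-assoc (approx x n) (approx y n) (approx z n)) }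
              ; identity = (λ x n → mod-reflexive (ℤ-Properties.+-identityˡ (approx x n)))
                         , (λ x n → mod-reflexive (ℤ-Properties.+-identityʳ (approx x n))) }
            ; inverse = (λ x n → mod-reflexive (ℤ-Properties.+-inverseˡ (approx x n)))
                      , (λ x n → mod-reflexive (ℤ-Properties.+-inverseʳ (approx x n)))
            ; ⁻¹-cong = λ {x} {y} h n → mod-neg {x = approx x n} {approx y n} (h n) }
          ; comm = λ x y n → mod-reflexive (ℤ-Properties.+-comm (approx x n) (approx y n)) }
        ; *-cong = λ {x} {x′} {y} {y′} h k n →
                        mod-* {x = approx x n} {approx x′ n} {approx y n} {approx y′ n} (h n) (k n)
        ; *-assoc = λ x y z n → mod-reflexive (ℤ-Properties.*-assoc (approx x n) (approx y n) (approx z n))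
        ; *-identity = (λ x n → mod-reflexive (ℤ-Properties.*-identityˡ (approx x n)))
                     , (λ x n → mod-reflexive (ℤ-Properties.*-identityʳ (approx x n)))
        ; distrib = (λ x y z n → mod-reflexive (ℤ-Properties.*-distribˡ-+ (approx x n) (approx y n) (approx z n)))
                  , (λ x y z n → mod-reflexive (ℤ-Properties.*-distribʳ-+ (approx x n) (approx y n) (approx z n)))
        }
      ; *-comm = λ x y n → mod-reflexive (ℤ-Properties.*-comm (approx x n) (approx y n))
      }
    }

  open RawSemiringDefs (RawRing.rawSemiring (CommutativeRing.rawRing ℤₚ)) public
    using () renaming (_∣_ to _∣ₚ_; _^_ to _^ₚ_)

  infix 4 _≡ₚ_

  -- Congruence modulo the ideal p ℤₚ.
  _≡ₚ_ : PAdicInteger → PAdicInteger → Set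
  x ≡ₚ y = ι (+ p) ∣ₚ (x -ₚ y)

  record IsDirichletCharacter (N : ℕ) (χ : ℕ → PAdicInteger) : Set where
    field
      one            : χ 1 ≈ 1#
      multiplicative : ∀ m n → χ (m * n) ≈ χ m *ₚ χ n
      periodic       : ∀ m → χ (m + N) ≈ χ m
      vanishing      : ∀ m → ¬ Coprime m N → χ m ≈ 0#

  record IsTeichmüller (ω : ℕ → PAdicInteger) : Set where
    field
      isDirichletCharacter : IsDirichletCharacter p ω
      reduction            : ∀ m → ¬ (p ∣ⁿ m) → ω m ≡ₚ ι (+ m)
      zero-at-multiples    : ∀ m → p ∣ⁿ m → ω m ≈ 0#

  -- Since x ^ₚ 0 = 1# for every x, the zeroth power is the trivial character,
  -- equal to 1 everywhere (also at multiples of p), whereas for a ≥ 1 the a-th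
  -- power vanishes at the multiples of p.  In particular the power p - 1 of
  -- the Teichmüller character is not the trivial character.
  power : (ℕ → PAdicInteger) → ℕ → (ℕ → PAdicInteger)
  power χ a m = χ m ^ₚ a

  Nontrivial : (ℕ → PAdicInteger) → Set
  Nontrivial ψ = ¬ (∀ m → ψ m ≈ 1#)

  -- ∑_{d ∣ n} ψ(n/d) χ(d) d^(k-1), where d = suc i.
  eisensteinCoeff : ℕ → (ψ χ : ℕ → PAdicInteger) → ℕ → PAdicInteger
  eisensteinCoeff k ψ χ n =
    foldr _+ₚ_ 0#
      (map (λ i → ψ (n / suc i) *ₚ χ (suc i) *ₚ ι (+ (suc i ^ (k ∸ 1))))
           (filter (λ i → suc i ∣? n) (upTo n)))

  -- E is the q-expansion of E_{k,ψ,χ}.  The constant term is prescribed only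
  -- for nontrivial ψ; for trivial ψ it is an L-value that need not lie in ℤₚ.
  record IsEisensteinSeries (k : ℕ) (ψ χ : ℕ → PAdicInteger) (E : PowerSeries PAdicInteger) : Set where
    field
      constantTerm : Nontrivial ψ → E 0 ≈ 0#
      coefficient  : ∀ n → 1 ≤ n → E n ≈ eisensteinCoeff k ψ χ n

{-# OPTIONS --safe #-}
module Submission where

-- Write P, Q, R for the Eisenstein series E₂, E₄, E₆ and θ for q d/dq.  The
-- Lambert series L_a = ∑_{x ≥ 1} q^(a x) satisfy
--   L_a L_b = L_{a+b} (1 + L_a + L_b),
-- and summing polynomial multiples of this over all a, b (Skoruppa's method)
-- evaluates the convolutions of the σ_j; this gives Ramanujan's equations
--   3 θQ = P Q - R,   2 θR = P R - Q²,
-- hence θ(Q³ - R²) = P (Q³ - R²).  The logarithmic derivative of the product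
-- shows that Δ solves the same recurrence, so 1728 Δ = Q³ - R².
-- Modulo 5, R ≡ P and Q ≡ 1; modulo 7, R ≡ 1 and Q² ≡ P; so Δ reduces to θP
-- resp. θQ.  Modulo 3 one divides by 144 first, and uses that θ kills cubes
-- and that θΔ ≡ Δ.  The result is τ(n) ≡ n σ₁(n) modulo 3 and 5 and
-- τ(n) ≡ n σ₃(n) modulo 7, and the Eisenstein coefficients reduce to the same
-- sums by Fermat's little theorem, since ω(m) ≡ m for every m.

-- The convolution step must avoid σ with even index. Put S = x² + y², p = xy. The weight N^m gives
-- h(x+y,y) - h(x,y) = (S + p)^m - (S - p)^m, which is odd in p and even in S, so every monomial has
-- odd exponents in x and y. Degree 6 needs a second weight, T², because N³ mixes σ₁σ₅ with σ₃σ₃.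
-- The prime 3 is the obstacle. Since 1728 = 144 · 12, dividing Q³ - R² by 144 leaves 12 Δ, and 12
-- is a unit modulo 5 and 7 but not modulo 3. One therefore needs a congruence modulo 9 for the
-- linear part. What is left over is a multiple of B³, removed by θ at the price of a factor n: only
-- n(Δ(n) - σ₁(n)) ≡ 0 follows. The factor is repaired by (n - 1) Δ(n) ≡ 0, which holds because the
-- product has exponent 24, a multiple of 3. The two families of exponents in the theorem are the
-- two ways to write n σ_r(n), namely ∑ (n/d) d^(r+1) and, after d ↦ n/d, ∑ (n/d)^(r+1) d, with r =
-- 1 for p = 3, 5 and r = 3 for p = 7.

open import Defs
open FormalProduct using (q^; 1-q^; _⊛^_; partialProduct)
open import Algebra.Bundles using (CommutativeRing)
open import Algebra.Definitions.RawMagma using (_,_)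
import Algebra.Properties.Semiring.Sum as SemiringSum
import Algebra.Solver.Ring as RingSolver
open import Algebra.Solver.Ring.AlmostCommutativeRing using (fromCommutativeRing; _-Raw-AlmostCommutative⟶_)
open import Data.Bool using (Bool; if_then_else_)
open import Data.Fin.Base using (toℕ; fromℕ<)
open import Data.Fin.Patterns using (0F; 1F)
open import Data.Fin.Properties using (all?; toℕ-fromℕ<; toℕ-inject₁; toℕ-fromℕ)
open import Data.Integer using (ℤ; +_; -[1+_]; 0ℤ; 1ℤ)
  renaming (_+_ to _+ᶻ_; _*_ to _*ᶻ_; -_ to -ᶻ_; _-_ to _-ᶻ_; _^_ to _^ᶻ_)
open import Data.Integer.Divisibility.Signed using (divides; quotient; ∣m∣n⇒∣m+n; ∣n⇒∣m*n; ∣m⇒∣m*n; ∣m⇒∣-m)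
  renaming (_∣_ to _∣ᶻ_; _∣?_ to _∣ᶻ?_)
import Data.Integer.Divisibility.Signed as ∣ᶻ
import Data.Integer.Properties as ℤ
open import Data.Integer.Solver using (module +-*-Solver)
open import Data.List using (List; []; _∷_; foldr; map; filter; upTo; applyUpTo)
open import Data.List.Properties using (map-upTo; filter-accept; filter-reject)
import Data.Maybe.Base as Maybe
open Maybe using (Maybe)
open import Data.Nat using (ℕ; zero; suc; _+_; _*_; _∸_; _^_; _/_; _%_; _≤_; _<_; z≤n; s≤s; NonZero)
open import Data.Nat.Divisibility using (_∣?_) renaming (_∣_ to _∣ⁿ_; divides to dividesⁿ)
import Data.Nat.Divisibility as ℕ∣
open import Data.Nat.DivMod using (m≡m%n+[m/n]*n; m%n<n; m*n/n≡m; m/n*n≡m)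
open import Data.Nat.Induction using (<-rec)
import Data.Nat.Properties as ℕ
open import Data.Product using (_×_; _,_)
open import Data.Sum using (_⊎_; inj₁; inj₂)
open import Data.Vec.Base using (_∷_; [])
open import Function using (_∘_; id; _$_; mk⇔)
open import Level using (0ℓ)
open import Relation.Binary.PropositionalEquality
open import Relation.Nullary using (¬_; yes; no; contradiction)
open import Relation.Nullary.Decidable using (does; True; toWitness; dec⇒maybe; dec-true; dec-false; does-⇔)

open +-*-Solver using (solve; _:=_; _:+_; _:*_; _:-_; :-_; _:^_; con; var; Polynomial; ⟦_⟧)

-- Power series

open SemiringSum (CommutativeRing.semiring ℤ.+-*-commutativeRing)
  using (sum; sum-cong-≗; ∑-distrib-+; ∑-comm; *-distribˡ-sum; *-distribʳ-sum; sum-init-last; sum-replicate-zero)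

opaque
  -- Sealed, so that sums stay symbolic during type checking; the equations of this block are its
  -- interface.
  ∑< : ℕ → (ℕ → ℤ) → ℤ
  ∑< n f = sum {n} (f ∘ toℕ)

  ∑-nil : ∀ f → ∑< 0 f ≡ 0ℤ
  ∑-nil f = refl

  ∑-head : ∀ n f → ∑< (suc n) f ≡ f 0 +ᶻ ∑< n (f ∘ suc)
  ∑-head n f = refl

  ∑-cong : ∀ n {f g : ℕ → ℤ} → (∀ i → f i ≡ g i) → ∑< n f ≡ ∑< n g
  ∑-cong n eq = sum-cong-≗ {n} (eq ∘ toℕ)

  ∑-zero : ∀ n → ∑< n (λ _ → 0ℤ) ≡ 0ℤ
  ∑-zero n = sum-replicate-zero n

  ∑-cong< : ∀ n {f g : ℕ → ℤ} → (∀ i → i < n → f i ≡ g i) → ∑< n f ≡ ∑< n g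
  ∑-cong< zero    eq = refl
  ∑-cong< (suc n) eq = cong₂ _+ᶻ_ (eq 0 (s≤s z≤n)) (∑-cong< n (λ i i<n → eq (suc i) (s≤s i<n)))

  ∑-+ : ∀ n (f g : ℕ → ℤ) → ∑< n (λ i → f i +ᶻ g i) ≡ ∑< n f +ᶻ ∑< n g
  ∑-+ n f g = ∑-distrib-+ {n} (f ∘ toℕ) (g ∘ toℕ)

  ∑-*ˡ : ∀ n c (f : ℕ → ℤ) → c *ᶻ ∑< n f ≡ ∑< n (λ i → c *ᶻ f i)
  ∑-*ˡ n c f = *-distribˡ-sum {n} c (f ∘ toℕ)

  ∑-*ʳ : ∀ n c (f : ℕ → ℤ) → ∑< n f *ᶻ c ≡ ∑< n (λ i → f i *ᶻ c)
  ∑-*ʳ n c f = *-distribʳ-sum {n} c (f ∘ toℕ)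

  ∑-swap : ∀ m n (f : ℕ → ℕ → ℤ) → ∑< m (λ i → ∑< n (f i)) ≡ ∑< n (λ j → ∑< m (λ i → f i j))
  ∑-swap m n f = ∑-comm {m} {n} (λ i j → f (toℕ i) (toℕ j))

  ∑-last : ∀ n (f : ℕ → ℤ) → ∑< (suc n) f ≡ ∑< n f +ᶻ f n
  ∑-last n f = trans (sum-init-last {n} (f ∘ toℕ))
    (cong₂ _+ᶻ_ (sum-cong-≗ {n} (λ i → cong f (toℕ-inject₁ i))) (cong f (toℕ-fromℕ n)))

  foldr-applyUpTo : ∀ n (f : ℕ → ℤ) → foldr _+ᶻ_ 0ℤ (applyUpTo f n) ≡ ∑< n f
  foldr-applyUpTo zero    f = refl
  foldr-applyUpTo (suc n) f = cong (f 0 +ᶻ_) (foldr-applyUpTo n (f ∘ suc))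

∑-vanish : ∀ n {f : ℕ → ℤ} → (∀ i → i < n → f i ≡ 0ℤ) → ∑< n f ≡ 0ℤ
∑-vanish n eq = trans (∑-cong< n eq) (∑-zero n)

Series : Set
Series = PowerSeries ℤ

infixl 7 _·_
infixl 6 _⊕_
infix  8 ⊖_
infix  9 θ_

_⊕_ : Series → Series → Series
(f ⊕ g) n = f n +ᶻ g n

⊖_ : Series → Series
(⊖ f) n = -ᶻ f n

const : ℤ → Series
const z zero    = z
const z (suc _) = 0ℤ

tail : Series → Series
tail f = f ∘ suc

-- q d/dq
θ_ : Series → Series
(θ f) n = + n *ᶻ f n

opaque
  _·_ : Series → Series → Series
  _·_ = FormalProduct._⊛_

  ⊛^-suc : ∀ f r → f ⊛^ suc r ≡ f · (f ⊛^ r)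
  ⊛^-suc f r = refl

  partialProduct-suc : ∀ N → partialProduct (suc N) ≡ partialProduct N · (1-q^ (suc N) ⊛^ 24)
  partialProduct-suc N = refl

  τ-· : ∀ n → τ n ≡ (q^ 1 · partialProduct n) n
  τ-· n = refl

  ·-sum : ∀ f g n → (f · g) n ≡ ∑< (suc n) (λ i → f i *ᶻ g (n ∸ i))
  ·-sum f g n = trans (cong (foldr _+ᶻ_ 0ℤ) (map-upTo h (suc n))) (foldr-applyUpTo (suc n) h)
    where
    h : ℕ → ℤ
    h i = f i *ᶻ g (n ∸ i)

·-zero : ∀ f g → (f · g) 0 ≡ f 0 *ᶻ g 0
·-zero f g = trans (·-sum f g 0) (trans (∑-head 0 _) (trans (cong (f 0 *ᶻ g 0 +ᶻ_) (∑-nil _)) (ℤ.+-identityʳ (f 0 *ᶻ g 0))))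

·-suc : ∀ f g n → (f · g) (suc n) ≡ f 0 *ᶻ g (suc n) +ᶻ (tail f · g) n
·-suc f g n = trans (·-sum f g (suc n))
  (trans (∑-head (suc n) (λ i → f i *ᶻ g (suc n ∸ i))) (cong (f 0 *ᶻ g (suc n) +ᶻ_) (sym (·-sum (tail f) g n))))

·-cong≤ : ∀ n {f f′ g g′ : Series} → (∀ i → i ≤ n → f i ≡ f′ i) → (∀ i → i ≤ n → g i ≡ g′ i) →
          (f · g) n ≡ (f′ · g′) n
·-cong≤ n {f} {f′} {g} {g′} p q = begin
  (f · g) n   ≡⟨ ·-sum f g n ⟩
  _           ≡⟨ ∑-cong< (suc n) (λ { i (s≤s i≤n) → cong₂ _*ᶻ_ (p i i≤n) (q (n ∸ i) (ℕ.m∸n≤m n i)) }) ⟩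
  _           ≡⟨ ·-sum f′ g′ n ⟨
  (f′ · g′) n ∎
  where open ≡-Reasoning

·-cong : ∀ {f f′ g g′ : Series} → f ≗ f′ → g ≗ g′ → f · g ≗ f′ · g′
·-cong p q n = ·-cong≤ n (λ i _ → p i) (λ i _ → q i)

·-congˡ : ∀ f {g g′ : Series} → g ≗ g′ → f · g ≗ f · g′
·-congˡ f q = ·-cong {f} (λ _ → refl) q

·-congʳ : ∀ g {f f′ : Series} → f ≗ f′ → f · g ≗ f′ · g
·-congʳ g p = ·-cong {g = g} p (λ _ → refl)

·-distribʳ : ∀ h f g → (f ⊕ g) · h ≗ (f · h) ⊕ (g · h)
·-distribʳ h f g n = begin
  _ ≡⟨ ·-sum (f ⊕ g) h n ⟩
  _ ≡⟨ ∑-cong (suc n) (λ i → ℤ.*-distribʳ-+ (h (n ∸ i)) (f i) (g i)) ⟩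
  _ ≡⟨ ∑-+ (suc n) (λ i → f i *ᶻ h (n ∸ i)) (λ i → g i *ᶻ h (n ∸ i)) ⟩
  _ ≡⟨ cong₂ _+ᶻ_ (·-sum f h n) (·-sum g h n) ⟨
  _ ∎
  where open ≡-Reasoning

·-scaleˡ : ∀ c f g n → ((λ i → c *ᶻ f i) · g) n ≡ c *ᶻ (f · g) n
·-scaleˡ c f g n = begin
  _ ≡⟨ ·-sum (λ i → c *ᶻ f i) g n ⟩
  _ ≡⟨ ∑-cong (suc n) (λ i → ℤ.*-assoc c (f i) (g (n ∸ i))) ⟩
  _ ≡⟨ ∑-*ˡ (suc n) c (λ i → f i *ᶻ g (n ∸ i)) ⟨
  _ ≡⟨ cong (c *ᶻ_) (·-sum f g n) ⟨
  _ ∎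
  where open ≡-Reasoning

·-const : ∀ z g n → (const z · g) n ≡ z *ᶻ g n
·-const z g zero    = ·-zero (const z) g
·-const z g (suc n) = begin
  _                                          ≡⟨ ·-suc (const z) g n ⟩
  z *ᶻ g (suc n) +ᶻ ((λ _ → 0ℤ) · g) n        ≡⟨ cong (z *ᶻ g (suc n) +ᶻ_) (·-sum (λ _ → 0ℤ) g n) ⟩
  _                                          ≡⟨ cong (z *ᶻ g (suc n) +ᶻ_) (∑-zero (suc n)) ⟩
  _                                          ≡⟨ ℤ.+-identityʳ _ ⟩
  _                                          ∎
  where open ≡-Reasoning

-- Mirror image of `·-suc`: it peels off the other end of the convolution, and commutativity follows
-- by comparing the two.
·-suc′ : ∀ f g n → (f · g) (suc n) ≡ f (suc n) *ᶻ g 0 +ᶻ (f · tail g) n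
·-suc′ f g zero    = begin
  _ ≡⟨ ·-suc f g 0 ⟩
  _ ≡⟨ cong (f 0 *ᶻ g 1 +ᶻ_) (·-zero (tail f) g) ⟩
  _ ≡⟨ ℤ.+-comm (f 0 *ᶻ g 1) (f 1 *ᶻ g 0) ⟩
  _ ≡⟨ cong (f 1 *ᶻ g 0 +ᶻ_) (·-zero f (tail g)) ⟨
  _ ∎
  where open ≡-Reasoning
·-suc′ f g (suc n) = begin
  _ ≡⟨ ·-suc f g (suc n) ⟩
  _ ≡⟨ cong (f 0 *ᶻ g (suc (suc n)) +ᶻ_) (·-suc′ (tail f) g n) ⟩
  _ ≡⟨ solve 3 (λ a b c → a :+ (b :+ c) := b :+ (a :+ c)) refl
         (f 0 *ᶻ g (suc (suc n))) (f (suc (suc n)) *ᶻ g 0) ((tail f · tail g) n) ⟩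
  _ ≡⟨ cong (f (suc (suc n)) *ᶻ g 0 +ᶻ_) (·-suc f (tail g) n) ⟨
  _ ∎
  where open ≡-Reasoning

·-comm : ∀ f g → f · g ≗ g · f
·-comm f g zero    = begin
  _ ≡⟨ ·-zero f g ⟩ _ ≡⟨ ℤ.*-comm (f 0) (g 0) ⟩ _ ≡⟨ ·-zero g f ⟨ _ ∎
  where open ≡-Reasoning
·-comm f g (suc n) = begin
  _ ≡⟨ ·-suc f g n ⟩
  _ ≡⟨ cong₂ _+ᶻ_ (ℤ.*-comm (f 0) (g (suc n))) (·-comm (tail f) g n) ⟩
  _ ≡⟨ ·-suc′ g f n ⟨
  _ ∎
  where open ≡-Reasoning

·-assoc : ∀ f g h → (f · g) · h ≗ f · (g · h)
·-assoc f g h zero    = begin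
  _ ≡⟨ ·-zero (f · g) h ⟩
  _ ≡⟨ cong (_*ᶻ h 0) (·-zero f g) ⟩
  _ ≡⟨ ℤ.*-assoc (f 0) (g 0) (h 0) ⟩
  _ ≡⟨ cong (f 0 *ᶻ_) (·-zero g h) ⟨
  _ ≡⟨ ·-zero f (g · h) ⟨
  _ ∎
  where open ≡-Reasoning
·-assoc f g h (suc n) = begin
  _ ≡⟨ ·-suc (f · g) h n ⟩
  _ ≡⟨ cong₂ _+ᶻ_ (cong (_*ᶻ h (suc n)) (·-zero f g)) (·-congʳ h (·-suc f g) n) ⟩
  _ ≡⟨ cong (f 0 *ᶻ g 0 *ᶻ h (suc n) +ᶻ_) (·-distribʳ h (λ i → f 0 *ᶻ tail g i) (tail f · g) n) ⟩
  _ ≡⟨ cong (f 0 *ᶻ g 0 *ᶻ h (suc n) +ᶻ_)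
         (cong₂ _+ᶻ_ (·-scaleˡ (f 0) (tail g) h n) (·-assoc (tail f) g h n)) ⟩
  _ ≡⟨ solve 5 (λ a b c d e → a :* b :* c :+ (a :* d :+ e) := a :* (b :* c :+ d) :+ e) refl
         (f 0) (g 0) (h (suc n)) ((tail g · h) n) ((tail f · (g · h)) n) ⟩
  _ ≡⟨ cong (λ z → f 0 *ᶻ z +ᶻ (tail f · (g · h)) n) (·-suc g h n) ⟨
  _ ≡⟨ ·-suc f (g · h) n ⟨
  _ ∎
  where open ≡-Reasoning

·-identityˡ : ∀ f → const 1ℤ · f ≗ f
·-identityˡ f n = trans (·-const 1ℤ f n) (ℤ.*-identityˡ (f n))

ℤ⟦q⟧ : CommutativeRing 0ℓ 0ℓ
ℤ⟦q⟧ = record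
  { Carrier = Series
  ; _≈_ = _≗_
  ; _+_ = _⊕_
  ; _*_ = _·_
  ; -_  = ⊖_
  ; 0#  = const 0ℤ
  ; 1#  = const 1ℤ
  ; isCommutativeRing = record
    { isRing = record
      { +-isAbelianGroup = record
        { isGroup = record
          { isMonoid = record
            { isSemigroup = record
              { isMagma = record
                { isEquivalence = record
                  { refl  = λ _ → refl
                  ; sym   = λ p n → sym (p n)
                  ; trans = λ p q n → trans (p n) (q n) }
                ; ∙-cong = λ p q n → cong₂ _+ᶻ_ (p n) (q n) }
              ; assoc = λ f g h n → ℤ.+-assoc (f n) (g n) (h n) }
            ; identity = (λ { f zero → ℤ.+-identityˡ (f 0) ; f (suc n) → ℤ.+-identityˡ (f (suc n)) })
                       , (λ { f zero → ℤ.+-identityʳ (f 0) ; f (suc n) → ℤ.+-identityʳ (f (suc n)) }) }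
          ; inverse = (λ { f zero → ℤ.+-inverseˡ (f 0) ; f (suc n) → ℤ.+-inverseˡ (f (suc n)) })
                    , (λ { f zero → ℤ.+-inverseʳ (f 0) ; f (suc n) → ℤ.+-inverseʳ (f (suc n)) })
          ; ⁻¹-cong = λ p n → cong -ᶻ_ (p n) }
        ; comm = λ f g n → ℤ.+-comm (f n) (g n) }
      ; *-cong = ·-cong
      ; *-assoc = ·-assoc
      ; *-identity = ·-identityˡ
                   , (λ f n → trans (·-comm f (const 1ℤ) n) (·-identityˡ f n))
      ; distrib = (λ f g h n → trans (·-comm f (g ⊕ h) n)
                                 (trans (·-distribʳ f g h n) (cong₂ _+ᶻ_ (·-comm g f n) (·-comm h f n))))
                , ·-distribʳ }
    ; *-comm = ·-comm } }

-- With coefficients in ℤ the ring solver can compute with the numerical constants in identities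
-- between series.
const-morphism : CommutativeRing.rawRing ℤ.+-*-commutativeRing -Raw-AlmostCommutative⟶ fromCommutativeRing ℤ⟦q⟧
const-morphism = record
  { ⟦_⟧    = const
  ; +-homo = λ { x y zero → refl ; x y (suc n) → refl }
  ; *-homo = λ { x y zero → sym (·-const x (const y) 0)
               ; x y (suc n) → sym (trans (·-const x (const y) (suc n)) (ℤ.*-zeroʳ x)) }
  ; -‿homo = λ { x zero → refl ; x (suc n) → refl }
  ; 0-homo = λ _ → refl
  ; 1-homo = λ _ → refl }

const-≟ : ∀ x y → Maybe (const x ≗ const y)
const-≟ x y = Maybe.map (λ p n → cong (λ z → const z n) p) (dec⇒maybe (x ℤ.≟ y))

module Solver⟦q⟧ = RingSolver
  (CommutativeRing.rawRing ℤ.+-*-commutativeRing) (fromCommutativeRing ℤ⟦q⟧) const-morphism const-≟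

-- Induction on the coefficient with `tail f` in place of `f`. Shifting costs one unit of the index,
-- so `tail (θ f)` is `tail f` plus `θ (tail f)`; the extra copy is the summand `F`.
θ-· : ∀ f g → θ (f · g) ≗ (θ f · g) ⊕ (f · θ g)
θ-· f g zero = begin
  _ ≡⟨ ℤ.*-zeroˡ ((f · g) 0) ⟩
  _ ≡⟨ cong₂ _+ᶻ_ (·-zero (θ f) g) (trans (·-zero f (θ g)) (ℤ.*-zeroʳ (f 0))) ⟨
  _ ∎
  where open ≡-Reasoning
θ-· f g (suc n) = begin
  + suc n *ᶻ (f · g) (suc n)
    ≡⟨ cong (+ suc n *ᶻ_) (·-suc f g n) ⟩
  + suc n *ᶻ (f 0 *ᶻ g (suc n) +ᶻ F)
    ≡⟨ solve 4 (λ m a b c → (con 1ℤ :+ m) :* (a :* b :+ c) := a :* ((con 1ℤ :+ m) :* b) :+ (c :+ m :* c)) refl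
         (+ n) (f 0) (g (suc n)) F ⟩
  f 0 *ᶻ (θ g) (suc n) +ᶻ (F +ᶻ + n *ᶻ F)
    ≡⟨ cong (λ z → f 0 *ᶻ (θ g) (suc n) +ᶻ (F +ᶻ z)) (θ-· (tail f) g n) ⟩
  f 0 *ᶻ (θ g) (suc n) +ᶻ (F +ᶻ ((θ (tail f) · g) n +ᶻ (tail f · θ g) n))
    ≡⟨ solve 4 (λ a b c d → a :+ (b :+ (c :+ d)) := (con 0ℤ :+ (b :+ c)) :+ (a :+ d)) refl
         (f 0 *ᶻ (θ g) (suc n)) F ((θ (tail f) · g) n) ((tail f · θ g) n) ⟩
  (0ℤ +ᶻ (F +ᶻ (θ (tail f) · g) n)) +ᶻ (f 0 *ᶻ (θ g) (suc n) +ᶻ (tail f · θ g) n)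
    ≡⟨ cong₂ _+ᶻ_ (cong (0ℤ +ᶻ_) (sym tail-θ)) (sym (·-suc f (θ g) n)) ⟩
  (0ℤ +ᶻ (tail (θ f) · g) n) +ᶻ (f · θ g) (suc n)
    ≡⟨ cong (_+ᶻ (f · θ g) (suc n)) (·-suc (θ f) g n) ⟨
  (θ f · g) (suc n) +ᶻ (f · θ g) (suc n) ∎
  where
  open ≡-Reasoning
  F = (tail f · g) n
  tail-θ : (tail (θ f) · g) n ≡ F +ᶻ (θ (tail f) · g) n
  tail-θ = trans (·-cong {g = g} (λ i → ℤ.suc-* (+ i) (f (suc i))) (λ _ → refl) n)
                 (·-distribʳ g (tail f) (θ (tail f)) n)

-- Lambert series

module ℤ⟦q⟧ = CommutativeRing ℤ⟦q⟧
open Solver⟦q⟧ using () renaming (solve to solve⟦q⟧; _:=_ to _⊜_; _:+_ to _⊞_; _:*_ to _⊠_; _:-_ to _⊟_; con to con⟦q⟧)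

q^0≗1 : q^ 0 ≗ const 1ℤ
q^0≗1 zero    = refl
q^0≗1 (suc n) = refl

q^-·-suc : ∀ m f n → (q^ (suc m) · f) (suc n) ≡ (q^ m · f) n
q^-·-suc m f n = trans (·-suc (q^ (suc m)) f n) (ℤ.+-identityˡ _)

q^-·-+ : ∀ m f n → (q^ m · f) (m + n) ≡ f n
q^-·-+ zero    f n = trans (·-congʳ f q^0≗1 n) (·-identityˡ f n)
q^-·-+ (suc m) f n = trans (q^-·-suc m f (m + n)) (q^-·-+ m f n)

q^-·-< : ∀ m f n → n < m → (q^ m · f) n ≡ 0ℤ
q^-·-< (suc m) f zero    n<m       = ·-zero (q^ (suc m)) f
q^-·-< (suc m) f (suc n) (s≤s n<m) = trans (q^-·-suc m f n) (q^-·-< m f n n<m)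

q^-+ : ∀ a b → q^ a · q^ b ≗ q^ (a + b)
q^-+ zero    b n       = q^-·-+ 0 (q^ b) n
q^-+ (suc a) b zero    = ·-zero (q^ (suc a)) (q^ b)
q^-+ (suc a) b (suc n) = trans (q^-·-suc a (q^ b) n) (q^-+ a b n)

data Position (m n : ℕ) : Set where
  below : n < m → Position m n
  above : ∀ k → n ≡ m + k → Position m n

position : ∀ m n → Position m n
position m n with ℕ.<-≤-connex n m
... | inj₁ n<m = below n<m
... | inj₂ m≤n = above (n ∸ m) (sym (ℕ.m+[n∸m]≡n m≤n))

-- Multiplication by q^(m+1) shifts by at least one, so each coefficient is determined by strictly
-- earlier ones. This replaces division by 1 - q^(m+1).
fixpoint-unique : ∀ m {w f g} → f ≗ w ⊕ (q^ (suc m) · f) → g ≗ w ⊕ (q^ (suc m) · g) → f ≗ g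
fixpoint-unique m {w} {f} {g} f-eq g-eq = <-rec _ step
  where
  step : ∀ n → (∀ {i} → i < n → f i ≡ g i) → f n ≡ g n
  step n ih = trans (f-eq n) (trans (cong (w n +ᶻ_) (tails n ih (position (suc m) n))) (sym (g-eq n)))
    where
    tails : ∀ n → (∀ {i} → i < n → f i ≡ g i) → Position (suc m) n → (q^ (suc m) · f) n ≡ (q^ (suc m) · g) n
    tails n ih (below n<m)     = trans (q^-·-< (suc m) f n n<m) (sym (q^-·-< (suc m) g n n<m))
    tails _ ih (above k refl) = trans (q^-·-+ (suc m) f k)
      (trans (ih (s≤s (ℕ.m≤n+m k m))) (sym (q^-·-+ (suc m) g k)))

𝟙 : Bool → ℤ
𝟙 b = if b then 1ℤ else 0ℤ

-- L a = ∑_{x ≥ 1} q^(a x)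
L : ℕ → Series
L a zero    = 0ℤ
L a (suc n) = 𝟙 (does (a ∣? suc n))

L-< : ∀ a n → n < a → L a n ≡ 0ℤ
L-< a zero    n<a = refl
L-< a (suc n) n<a = cong 𝟙 (dec-false (a ∣? suc n) (λ a∣n → ℕ.<⇒≱ n<a (ℕ∣.∣⇒≤ a∣n)))

L-+ : ∀ i n → L (suc i) (suc i + n) ≡ const 1ℤ n +ᶻ L (suc i) n
L-+ i zero    = cong 𝟙 (dec-true (suc i ∣? (suc i + 0)) (subst (suc i ∣ⁿ_) (sym (ℕ.+-identityʳ (suc i))) ℕ∣.∣-refl))
L-+ i (suc n) = trans
  (cong 𝟙 (does-⇔ (mk⇔ (λ d → ℕ∣.∣m+n∣m⇒∣n d ℕ∣.∣-refl) (ℕ∣.∣m∣n⇒∣m+n ℕ∣.∣-refl)) (suc i ∣? (suc i + suc n)) (suc i ∣? suc n)))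
  (sym (ℤ.+-identityˡ _))

-- The geometric series q^a / (1 - q^a), written as an equation without a denominator.
L-fixpoint : ∀ i → L (suc i) ≗ q^ (suc i) · (const 1ℤ ⊕ L (suc i))
L-fixpoint i n with position (suc i) n
... | below n<m    = trans (L-< (suc i) n n<m) (sym (q^-·-< (suc i) (const 1ℤ ⊕ L (suc i)) n n<m))
... | above k refl = trans (L-+ i k) (sym (q^-·-+ (suc i) (const 1ℤ ⊕ L (suc i)) k))

L-·-< : ∀ i f n → n ≤ i → (L (suc i) · f) n ≡ 0ℤ
L-·-< i f n n≤i = begin
  (L (suc i) · f) n              ≡⟨ ·-congʳ f (L-fixpoint i) n ⟩
  (q^ (suc i) · 1+L · f) n       ≡⟨ ·-assoc (q^ (suc i)) 1+L f n ⟩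
  (q^ (suc i) · (1+L · f)) n     ≡⟨ q^-·-< (suc i) (1+L · f) n (s≤s n≤i) ⟩
  0ℤ                             ∎
  where
  open ≡-Reasoning
  1+L = const 1ℤ ⊕ L (suc i)

-- Both sides solve f = q^c s + q^c f: on the left because (1 + L_a)(1 + L_b) = s + L_a L_b, on the
-- right by the equation for L_c.
L-·-L : ∀ i j → let a = suc i; b = suc j; c = suc (suc (i + j)) in
        L a · L b ≗ L c · (const 1ℤ ⊕ L a ⊕ L b)
L-·-L i j = fixpoint-unique (suc (i + j)) {w = q^ c · s} {L a · L b} {L c · s} lhs rhs
  where
  open import Relation.Binary.Reasoning.Setoid ℤ⟦q⟧.setoid
  a = suc i
  b = suc j
  c = suc (suc (i + j))
  s = const 1ℤ ⊕ L a ⊕ L b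
  q^c : q^ a · q^ b ≗ q^ c
  q^c = subst (λ k → q^ a · q^ b ≗ q^ k) (cong suc (ℕ.+-suc i j)) (q^-+ a b)
  lhs : L a · L b ≗ (q^ c · s) ⊕ (q^ c · (L a · L b))
  lhs = begin
    L a · L b
      ≈⟨ ·-cong (L-fixpoint i) (L-fixpoint j) ⟩
    (q^ a · (const 1ℤ ⊕ L a)) · (q^ b · (const 1ℤ ⊕ L b))
      ≈⟨ solve⟦q⟧ 4 (λ x y u v → (x ⊠ (con⟦q⟧ 1ℤ ⊞ u)) ⊠ (y ⊠ (con⟦q⟧ 1ℤ ⊞ v))
           ⊜ x ⊠ y ⊠ (con⟦q⟧ 1ℤ ⊞ u ⊞ v) ⊞ x ⊠ y ⊠ (u ⊠ v)) (λ {_} → ℤ⟦q⟧.refl) (q^ a) (q^ b) (L a) (L b) ⟩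
    (q^ a · q^ b · s) ⊕ (q^ a · q^ b · (L a · L b))
      ≈⟨ ℤ⟦q⟧.+-cong (·-congʳ s q^c) (·-congʳ (L a · L b) q^c) ⟩
    (q^ c · s) ⊕ (q^ c · (L a · L b)) ∎
  rhs : L c · s ≗ (q^ c · s) ⊕ (q^ c · (L c · s))
  rhs = begin
    L c · s                               ≈⟨ ·-cong {g = s} (L-fixpoint (suc (i + j))) (λ _ → refl) ⟩
    q^ c · (const 1ℤ ⊕ L c) · s           ≈⟨ solve⟦q⟧ 3 (λ x u v → x ⊠ (con⟦q⟧ 1ℤ ⊞ u) ⊠ v ⊜ x ⊠ v ⊞ x ⊠ (u ⊠ v))
                                               (λ {_} → ℤ⟦q⟧.refl) (q^ c) (L c) s ⟩
    (q^ c · s) ⊕ (q^ c · (L c · s))       ∎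

θ-q^ : ∀ m → θ (q^ m) ≗ const (+ m) · q^ m
θ-q^ m n with position m n
... | below n<m = trans (cong (+ n *ᶻ_) (q^≡0 m n n<m))
                   (trans (ℤ.*-zeroʳ (+ n)) (sym (trans (·-const (+ m) (q^ m) n) (trans (cong (+ m *ᶻ_) (q^≡0 m n n<m)) (ℤ.*-zeroʳ (+ m))))))
  where
  q^≡0 : ∀ m n → n < m → q^ m n ≡ 0ℤ
  q^≡0 (suc m) zero    _         = refl
  q^≡0 (suc m) (suc n) (s≤s n<m) = q^≡0 m n n<m
... | above zero refl    = trans (cong (λ k → + k *ᶻ q^ m (m + 0)) (ℕ.+-identityʳ m)) (sym (·-const (+ m) (q^ m) (m + 0)))
... | above (suc k) refl = trans (cong (+ (m + suc k) *ᶻ_) (q^≡0 m))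
                   (trans (ℤ.*-zeroʳ (+ (m + suc k))) (sym (trans (·-const (+ m) (q^ m) (m + suc k)) (trans (cong (+ m *ᶻ_) (q^≡0 m)) (ℤ.*-zeroʳ (+ m))))))
  where
  q^≡0 : ∀ m → q^ m (m + suc k) ≡ 0ℤ
  q^≡0 zero    = refl
  q^≡0 (suc m) = q^≡0 m

-- The derivative of q^a / (1 - q^a) is a q^a / (1 - q^a)²; uniqueness of the fixed point stands in
-- for the quotient rule.
θ-L : ∀ i → θ L (suc i) ≗ const (+ suc i) · (L (suc i) ⊕ (L (suc i) · L (suc i)))
θ-L i = fixpoint-unique i {w = const (+ a) · ℓ} lhs rhs
  where
  open import Relation.Binary.Reasoning.Setoid ℤ⟦q⟧.setoid
  a = suc i
  ℓ = L a
  1+ℓ = const 1ℤ ⊕ ℓ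
  θ-1+ℓ : θ 1+ℓ ≗ θ ℓ
  θ-1+ℓ zero    = refl
  θ-1+ℓ (suc n) = cong (+ suc n *ᶻ_) (ℤ.+-identityˡ (ℓ (suc n)))
  lhs : θ ℓ ≗ (const (+ a) · ℓ) ⊕ (q^ a · θ ℓ)
  lhs = begin
    θ ℓ                                               ≈⟨ (λ n → cong (+ n *ᶻ_) (L-fixpoint i n)) ⟩
    θ (q^ a · 1+ℓ)                                    ≈⟨ θ-· (q^ a) 1+ℓ ⟩
    (θ (q^ a) · 1+ℓ) ⊕ (q^ a · θ 1+ℓ)                 ≈⟨ ℤ⟦q⟧.+-cong (·-congʳ 1+ℓ (θ-q^ a))
                                                          (·-congˡ (q^ a) θ-1+ℓ) ⟩
    (const (+ a) · q^ a · 1+ℓ) ⊕ (q^ a · θ ℓ)         ≈⟨ ℤ⟦q⟧.+-congʳ (·-assoc (const (+ a)) (q^ a) 1+ℓ) ⟩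
    (const (+ a) · (q^ a · 1+ℓ)) ⊕ (q^ a · θ ℓ)       ≈⟨ ℤ⟦q⟧.+-congʳ (·-congˡ (const (+ a)) (L-fixpoint i)) ⟨
    (const (+ a) · ℓ) ⊕ (q^ a · θ ℓ)                  ∎
  rhs : const (+ a) · (ℓ ⊕ (ℓ · ℓ)) ≗ (const (+ a) · ℓ) ⊕ (q^ a · (const (+ a) · (ℓ ⊕ (ℓ · ℓ))))
  rhs = begin
    const (+ a) · (ℓ ⊕ (ℓ · ℓ))
      ≈⟨ ·-congˡ (const (+ a)) (λ n → cong (ℓ n +ᶻ_) (·-congʳ ℓ (L-fixpoint i) n)) ⟩
    const (+ a) · (ℓ ⊕ (q^ a · 1+ℓ · ℓ))
      ≈⟨ solve⟦q⟧ 3 (λ c x u → c ⊠ (u ⊞ x ⊠ (con⟦q⟧ 1ℤ ⊞ u) ⊠ u) ⊜ c ⊠ u ⊞ x ⊠ (c ⊠ (u ⊞ u ⊠ u)))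
           (λ {_} → ℤ⟦q⟧.refl) (const (+ a)) (q^ a) ℓ ⟩
    (const (+ a) · ℓ) ⊕ (q^ a · (const (+ a) · (ℓ ⊕ (ℓ · ℓ)))) ∎

-- Convolution sums

∑-+₃ : ∀ n (f g h : ℕ → ℤ) → ∑< n (λ i → f i +ᶻ g i +ᶻ h i) ≡ ∑< n f +ᶻ ∑< n g +ᶻ ∑< n h
∑-+₃ n f g h = trans (∑-+ n _ h) (cong (_+ᶻ ∑< n h) (∑-+ n f g))

∑-split : ∀ n (f : ℕ → ℕ → ℤ) →
          ∑< n (λ i → ∑< n (f i)) ≡
          ∑< n (λ i → ∑< i (f i)) +ᶻ ∑< n (λ i → f i i) +ᶻ ∑< n (λ i → ∑< i (λ j → f j i))
∑-split zero f = trans (∑-nil _) (sym (cong₂ _+ᶻ_ (cong₂ _+ᶻ_ (∑-nil _) (∑-nil _)) (∑-nil _)))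
∑-split (suc n) f = begin
  ∑< (suc n) (λ i → ∑< (suc n) (f i))
    ≡⟨ ∑-last n _ ⟩
  ∑< n (λ i → ∑< (suc n) (f i)) +ᶻ ∑< (suc n) (f n)
    ≡⟨ cong₂ _+ᶻ_ (trans (∑-cong n (λ i → ∑-last n (f i))) (∑-+ n _ _)) (∑-last n (f n)) ⟩
  (∑< n (λ i → ∑< n (f i)) +ᶻ ∑< n (λ i → f i n)) +ᶻ (∑< n (f n) +ᶻ f n n)
    ≡⟨ cong (λ z → z +ᶻ ∑< n (λ i → f i n) +ᶻ (∑< n (f n) +ᶻ f n n)) (∑-split n f) ⟩
  (lo +ᶻ di +ᶻ up +ᶻ ∑< n (λ i → f i n)) +ᶻ (∑< n (f n) +ᶻ f n n)
    ≡⟨ solve 6 (λ a b c d e k → (a :+ b :+ c :+ d) :+ (e :+ k) := (a :+ e) :+ (b :+ k) :+ (c :+ d)) refl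
         lo di up (∑< n (λ i → f i n)) (∑< n (f n)) (f n n) ⟩
  (lo +ᶻ ∑< n (f n)) +ᶻ (di +ᶻ f n n) +ᶻ (up +ᶻ ∑< n (λ i → f i n))
    ≡⟨ cong₂ _+ᶻ_ (cong₂ _+ᶻ_ (∑-last n _) (∑-last n _)) (∑-last n _) ⟨
  _ ∎
  where
  open ≡-Reasoning
  lo = ∑< n (λ i → ∑< i (f i))
  di = ∑< n (λ i → f i i)
  up = ∑< n (λ i → ∑< i (λ j → f j i))

-- Reindexing by k = i + j + 1 turns the square into a triangle together with rows k ≥ n, which are
-- assumed to vanish.
∑-triangle : ∀ n (f : ℕ → ℕ → ℤ) → (∀ i j → n ≤ i → f i j ≡ 0ℤ) →
             ∑< n (λ i → ∑< n (λ j → f (suc (i + j)) i)) ≡ ∑< n (λ k → ∑< k (f k))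
∑-triangle zero    f _       = trans (∑-nil _) (sym (∑-nil _))
∑-triangle (suc n) f outside = begin
  ∑< (suc n) (λ i → ∑< (suc n) (λ j → f (suc (i + j)) i))
    ≡⟨ ∑-cong (suc n) (λ i → trans (∑-last n (λ j → f (suc (i + j)) i))
         (trans (cong (∑< n (λ j → f (suc (i + j)) i) +ᶻ_) (outside _ i (s≤s (ℕ.m≤n+m n i)))) (ℤ.+-identityʳ _))) ⟩
  ∑< (suc n) (λ i → ∑< n (λ j → f (suc (i + j)) i))
    ≡⟨ ∑-head n _ ⟩
  ∑< n (λ j → f (suc j) 0) +ᶻ ∑< n (λ i → ∑< n (λ j → f (suc (suc (i + j))) (suc i)))
    ≡⟨ cong (∑< n (λ j → f (suc j) 0) +ᶻ_)
         (∑-triangle n (λ i j → f (suc i) (suc j)) (λ i j n≤i → outside (suc i) (suc j) (s≤s n≤i))) ⟩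
  ∑< n (λ k → f (suc k) 0) +ᶻ ∑< n (λ k → ∑< k (f (suc k) ∘ suc))
    ≡⟨ ∑-+ n _ _ ⟨
  ∑< n (λ k → f (suc k) 0 +ᶻ ∑< k (f (suc k) ∘ suc))
    ≡⟨ ∑-cong n (λ k → ∑-head k (f (suc k))) ⟨
  ∑< n (λ k → ∑< (suc k) (f (suc k)))
    ≡⟨ ℤ.+-identityˡ _ ⟨
  0ℤ +ᶻ ∑< n (λ k → ∑< (suc k) (f (suc k)))
    ≡⟨ cong (_+ᶻ ∑< n (λ k → ∑< (suc k) (f (suc k)))) (∑-nil (f 0)) ⟨
  ∑< 0 (f 0) +ᶻ ∑< n (λ k → ∑< (suc k) (f (suc k)))
    ≡⟨ ∑-head n (λ k → ∑< k (f k)) ⟨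
  ∑< (suc n) (λ k → ∑< k (f k)) ∎
  where open ≡-Reasoning

-- A combinatorial proof of Eisenstein series identities in the style of
-- Skoruppa: summing g(a,b) L_a L_b = g(a,b) (L_c + L_c L_a + L_c L_b), c = a + b,
-- over all a, b turns the last two families into sums of h(c,a) L_c L_a over
-- a < c and over a > c.
module _ (n : ℕ) where

  LL : ℕ → ℕ → ℤ
  LL i j = (L (suc i) · L (suc j)) n

  ∑∑ : (ℤ → ℤ → ℤ) → ℤ
  ∑∑ f = ∑< n (λ i → ∑< n (λ j → f (+ suc i) (+ suc j) *ᶻ LL i j))

  three-term : ∀ i j → LL i j ≡ L (suc (suc (i + j))) n +ᶻ LL (suc (i + j)) i +ᶻ LL (suc (i + j)) j
  three-term i j = trans (L-·-L i j n) (solve⟦q⟧ 3 (λ c a b → c ⊠ (con⟦q⟧ 1ℤ ⊞ a ⊞ b) ⊜ c ⊞ c ⊠ a ⊞ c ⊠ b)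
    (λ {_} → ℤ⟦q⟧.refl) (L (suc (suc (i + j)))) (L (suc i)) (L (suc j)) n)

  module _ (g h : ℤ → ℤ → ℤ) (g-sym : ∀ x y → g x y ≡ g y x) (h-sym : ∀ x y → h x y ≡ h y x)
           (h-shift : ∀ x y → h (x +ᶻ y) y ≡ g x y) where

    private
      a : ℕ → ℤ
      a i = + suc i

      lower : ℤ
      lower = ∑< n (λ k → ∑< k (λ i → h (a k) (a i) *ᶻ LL k i))

      h-sum : ∀ i j → h (a (suc (i + j))) (a i) ≡ g (a i) (a j)
      h-sum i j = trans (cong (λ m → h (+ m) (a i)) (trans (cong suc (ℕ.+-comm (suc i) j)) refl))
                    (trans (h-shift (a j) (a i)) (g-sym (a j) (a i)))

      left : ∑< n (λ i → ∑< n (λ j → g (a i) (a j) *ᶻ LL (suc (i + j)) i)) ≡ lower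
      left = trans (∑-cong n (λ i → ∑-cong n (λ j → cong (_*ᶻ LL (suc (i + j)) i) (sym (h-sum i j)))))
        (∑-triangle n (λ k i → h (a k) (a i) *ᶻ LL k i)
          (λ k i n≤k → trans (cong (h (a k) (a i) *ᶻ_) (L-·-< k (L (suc i)) n n≤k)) (ℤ.*-zeroʳ (h (a k) (a i)))))

      right : ∑< n (λ i → ∑< n (λ j → g (a i) (a j) *ᶻ LL (suc (i + j)) j)) ≡ lower
      right = trans (∑-swap n n _)
        (trans (∑-cong n (λ j → ∑-cong n (λ i → cong₂ (λ x k → x *ᶻ LL (suc k) j) (g-sym (a i) (a j)) (ℕ.+-comm i j)))) left)

      middle : ∑< n (λ i → ∑< n (λ j → g (a i) (a j) *ᶻ L (suc (suc (i + j))) n)) ≡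
               ∑< n (λ k → ∑< k (λ i → h (a k) (a i)) *ᶻ L (suc k) n)
      middle = begin
        ∑< n (λ i → ∑< n (λ j → g (a i) (a j) *ᶻ L (suc (suc (i + j))) n))
          ≡⟨ ∑-cong n (λ i → ∑-cong n (λ j → cong (_*ᶻ L (suc (suc (i + j))) n) (sym (h-sum i j)))) ⟩
        ∑< n (λ i → ∑< n (λ j → h (a (suc (i + j))) (a i) *ᶻ L (suc (suc (i + j))) n))
          ≡⟨ ∑-triangle n (λ k i → h (a k) (a i) *ᶻ L (suc k) n)
               (λ k i n≤k → trans (cong (h (a k) (a i) *ᶻ_) (L-< (suc k) n (s≤s n≤k))) (ℤ.*-zeroʳ (h (a k) (a i)))) ⟩
        ∑< n (λ k → ∑< k (λ i → h (a k) (a i) *ᶻ L (suc k) n))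
          ≡⟨ ∑-cong n (λ k → ∑-*ʳ k (L (suc k) n) (λ i → h (a k) (a i))) ⟨
        ∑< n (λ k → ∑< k (λ i → h (a k) (a i)) *ᶻ L (suc k) n) ∎
        where open ≡-Reasoning

      ∑∑g : ∑∑ g ≡ ∑< n (λ k → ∑< k (λ i → h (a k) (a i)) *ᶻ L (suc k) n) +ᶻ lower +ᶻ lower
      ∑∑g = begin
        ∑∑ g
          ≡⟨ ∑-cong n (λ i → trans (∑-cong n (λ j → trans (cong (g (a i) (a j) *ᶻ_) (three-term i j))
               (solve 4 (λ z u v w → z :* (u :+ v :+ w) := z :* u :+ z :* v :+ z :* w) refl
                 (g (a i) (a j)) (L (suc (suc (i + j))) n) (LL (suc (i + j)) i) (LL (suc (i + j)) j))))
               (∑-+₃ n _ _ _)) ⟩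
        _ ≡⟨ ∑-+₃ n _ _ _ ⟩
        _ ≡⟨ cong₂ _+ᶻ_ (cong₂ _+ᶻ_ middle left) right ⟩
        _ ∎
        where open ≡-Reasoning

      ∑∑h : ∑∑ h ≡ lower +ᶻ ∑< n (λ i → h (a i) (a i) *ᶻ LL i i) +ᶻ lower
      ∑∑h = trans (∑-split n (λ i j → h (a i) (a j) *ᶻ LL i j))
        (cong (lower +ᶻ ∑< n (λ i → h (a i) (a i) *ᶻ LL i i) +ᶻ_)
          (∑-cong n (λ k → ∑-cong k (λ i → cong₂ _*ᶻ_ (h-sym (a i) (a k)) (·-comm (L (suc i)) (L (suc k)) n)))))

    -- Each of the two double sums contains `lower` twice, so all off-diagonal products cancel. What
    -- remains is linear in the L_c, apart from the squares on the diagonal, which `θ-L` evaluates.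
    ∑∑-difference : ∑∑ (λ x y → g x y -ᶻ h x y) ≡
                    ∑< n (λ k → ∑< k (λ i → h (+ suc k) (+ suc i)) *ᶻ L (suc k) n) -ᶻ
                    ∑< n (λ i → h (+ suc i) (+ suc i) *ᶻ LL i i)
    ∑∑-difference = begin
      ∑∑ (λ x y → g x y -ᶻ h x y)
        ≡⟨ solve 2 (λ x y → x := (x :+ y) :- y) refl (∑∑ (λ x y → g x y -ᶻ h x y)) (∑∑ h) ⟩
      (∑∑ (λ x y → g x y -ᶻ h x y) +ᶻ ∑∑ h) -ᶻ ∑∑ h
        ≡⟨ cong (_-ᶻ ∑∑ h) (trans (sym (∑-+ n _ _)) (∑-cong n (λ i → trans (sym (∑-+ n _ _)) (∑-cong n (λ j →
             solve 3 (λ x y l → (x :- y) :* l :+ y :* l := x :* l) refl (g (a i) (a j)) (h (a i) (a j)) (LL i j)))))) ⟩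
      ∑∑ g -ᶻ ∑∑ h
        ≡⟨ cong₂ _-ᶻ_ ∑∑g ∑∑h ⟩
      (s +ᶻ lower +ᶻ lower) -ᶻ (lower +ᶻ d +ᶻ lower)
        ≡⟨ solve 3 (λ s l d → (s :+ l :+ l) :- (l :+ d :+ l) := s :- d) refl s lower d ⟩
      s -ᶻ d ∎
      where
      open ≡-Reasoning
      s = ∑< n (λ k → ∑< k (λ i → h (a k) (a i)) *ᶻ L (suc k) n)
      d = ∑< n (λ i → h (a i) (a i) *ᶻ LL i i)

∑-extend : ∀ {m n} → m ≤ n → (f : ℕ → ℤ) → (∀ i → m ≤ i → f i ≡ 0ℤ) → ∑< n f ≡ ∑< m f
∑-extend {n = n} z≤n f outside = trans (∑-vanish n (λ i _ → outside i z≤n)) (sym (∑-nil f))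
∑-extend {suc m} {suc n} (s≤s m≤n) f outside = begin
  ∑< (suc n) f              ≡⟨ ∑-head n f ⟩
  f 0 +ᶻ ∑< n (f ∘ suc)     ≡⟨ cong (f 0 +ᶻ_) (∑-extend m≤n (f ∘ suc) (λ i m≤i → outside (suc i) (s≤s m≤i))) ⟩
  f 0 +ᶻ ∑< m (f ∘ suc)     ≡⟨ ∑-head m f ⟨
  ∑< (suc m) f              ∎
  where open ≡-Reasoning

∑-· : ∀ N (c : ℕ → ℤ) (F : ℕ → Series) g n →
      ((λ m → ∑< N (λ i → c i *ᶻ F i m)) · g) n ≡ ∑< N (λ i → c i *ᶻ (F i · g) n)
∑-· N c F g n = begin
  ((λ m → ∑< N (λ i → c i *ᶻ F i m)) · g) n
    ≡⟨ ·-sum (λ m → ∑< N (λ i → c i *ᶻ F i m)) g n ⟩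
  ∑< (suc n) (λ k → ∑< N (λ i → c i *ᶻ F i k) *ᶻ g (n ∸ k))
    ≡⟨ ∑-cong (suc n) (λ k → ∑-*ʳ N (g (n ∸ k)) (λ i → c i *ᶻ F i k)) ⟩
  ∑< (suc n) (λ k → ∑< N (λ i → c i *ᶻ F i k *ᶻ g (n ∸ k)))
    ≡⟨ ∑-swap (suc n) N _ ⟩
  ∑< N (λ i → ∑< (suc n) (λ k → c i *ᶻ F i k *ᶻ g (n ∸ k)))
    ≡⟨ ∑-cong N (λ i → ∑-cong (suc n) (λ k → ℤ.*-assoc (c i) (F i k) (g (n ∸ k)))) ⟩
  ∑< N (λ i → ∑< (suc n) (λ k → c i *ᶻ (F i k *ᶻ g (n ∸ k))))
    ≡⟨ ∑-cong N (λ i → ∑-*ˡ (suc n) (c i) _) ⟨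
  ∑< N (λ i → c i *ᶻ ∑< (suc n) (λ k → F i k *ᶻ g (n ∸ k)))
    ≡⟨ ∑-cong N (λ i → cong (c i *ᶻ_) (·-sum (F i) g n)) ⟨
  ∑< N (λ i → c i *ᶻ (F i · g) n) ∎
  where open ≡-Reasoning

-- The coefficient of qⁿ, n ≥ 1, is ∑_{d ∣ n} dʲ.
σ-series : ℕ → Series
σ-series j n = ∑< n (λ i → (+ suc i) ^ᶻ j *ᶻ L (suc i) n)

-- The range of `σ-series` grows with the coefficient. A fixed range gives a finite combination of
-- Lambert series, through which a product can be distributed and which occurs as the logarithmic
-- derivative of a finite product.
σ-truncated : ℕ → ℕ → Series
σ-truncated j N n = ∑< N (λ i → (+ suc i) ^ᶻ j *ᶻ L (suc i) n)

σ-truncated-≡ : ∀ j {N n} → n ≤ N → σ-truncated j N n ≡ σ-series j n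
σ-truncated-≡ j {N} {n} n≤N = ∑-extend n≤N _
  (λ i n≤i → trans (cong ((+ suc i) ^ᶻ j *ᶻ_) (L-< (suc i) n (s≤s n≤i))) (ℤ.*-zeroʳ ((+ suc i) ^ᶻ j)))

∑∑-monomial : ∀ n i j → ∑∑ n (λ x y → x ^ᶻ i *ᶻ y ^ᶻ j) ≡ (σ-series i · σ-series j) n
∑∑-monomial n i j = begin
  ∑∑ n (λ x y → x ^ᶻ i *ᶻ y ^ᶻ j)
    ≡⟨ ∑-cong n (λ k → trans (∑-cong n (λ l → ℤ.*-assoc ((+ suc k) ^ᶻ i) ((+ suc l) ^ᶻ j) (LL n k l)))
                             (sym (∑-*ˡ n ((+ suc k) ^ᶻ i) _))) ⟩
  ∑< n (λ k → (+ suc k) ^ᶻ i *ᶻ ∑< n (λ l → (+ suc l) ^ᶻ j *ᶻ LL n k l))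
    ≡⟨ ∑-cong n (λ k → cong ((+ suc k) ^ᶻ i *ᶻ_) (inner k)) ⟨
  ∑< n (λ k → (+ suc k) ^ᶻ i *ᶻ (L (suc k) · σ-truncated j n) n)
    ≡⟨ ∑-· n (λ k → (+ suc k) ^ᶻ i) (L ∘ suc) (σ-truncated j n) n ⟨
  (σ-truncated i n · σ-truncated j n) n
    ≡⟨ ·-cong≤ n {σ-truncated i n} {σ-series i} {σ-truncated j n} {σ-series j}
         (λ _ → σ-truncated-≡ i) (λ _ → σ-truncated-≡ j) ⟩
  (σ-series i · σ-series j) n ∎
  where
  open ≡-Reasoning
  inner : ∀ k → (L (suc k) · σ-truncated j n) n ≡ ∑< n (λ l → (+ suc l) ^ᶻ j *ᶻ LL n k l)
  inner k = trans (·-comm (L (suc k)) (σ-truncated j n) n)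
    (trans (∑-· n (λ l → (+ suc l) ^ᶻ j) (L ∘ suc) (L (suc k)) n)
      (∑-cong n (λ l → cong ((+ suc l) ^ᶻ j *ᶻ_) (·-comm (L (suc l)) (L (suc k)) n))))

A B C D : Series
A = σ-series 1
B = σ-series 3
C = σ-series 5
D = σ-series 7

module _ (n : ℕ) where

  ∑∑-cong : ∀ {f g} → (∀ x y → f x y ≡ g x y) → ∑∑ n f ≡ ∑∑ n g
  ∑∑-cong eq = ∑-cong n (λ i → ∑-cong n (λ j → cong (_*ᶻ LL n i j) (eq (+ suc i) (+ suc j))))

  ∑∑-+ : ∀ f g → ∑∑ n (λ x y → f x y +ᶻ g x y) ≡ ∑∑ n f +ᶻ ∑∑ n g
  ∑∑-+ f g = trans (∑-cong n (λ i → trans (∑-cong n (λ j → ℤ.*-distribʳ-+ (LL n i j) (f (+ suc i) (+ suc j)) (g (+ suc i) (+ suc j))))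
                                          (∑-+ n _ _)))
                   (∑-+ n _ _)

  ∑∑-* : ∀ c f → ∑∑ n (λ x y → c *ᶻ f x y) ≡ c *ᶻ ∑∑ n f
  ∑∑-* c f = begin
    ∑∑ n (λ x y → c *ᶻ f x y)
      ≡⟨ ∑-cong n (λ i → trans (∑-cong n (λ j → ℤ.*-assoc c (f (+ suc i) (+ suc j)) (LL n i j))) (sym (∑-*ˡ n c _))) ⟩
    ∑< n (λ i → c *ᶻ ∑< n (λ j → f (+ suc i) (+ suc j) *ᶻ LL n i j))
      ≡⟨ ∑-*ˡ n c _ ⟨
    c *ᶻ ∑∑ n f ∎
    where open ≡-Reasoning

  -- One shape for all the weights below: the symmetric combinations of monomials with odd exponents
  -- and total degree at most 6.
  ∑∑-terms : ∀ s t u v →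
    ∑∑ n (λ x y → s *ᶻ (x ^ᶻ 1 *ᶻ y ^ᶻ 1) +ᶻ t *ᶻ (x ^ᶻ 1 *ᶻ y ^ᶻ 3 +ᶻ x ^ᶻ 3 *ᶻ y ^ᶻ 1)
                  +ᶻ u *ᶻ (x ^ᶻ 1 *ᶻ y ^ᶻ 5 +ᶻ x ^ᶻ 5 *ᶻ y ^ᶻ 1) +ᶻ v *ᶻ (x ^ᶻ 3 *ᶻ y ^ᶻ 3)) ≡
    s *ᶻ (A · A) n +ᶻ t *ᶻ (+ 2 *ᶻ (A · B) n)
      +ᶻ u *ᶻ (+ 2 *ᶻ (A · C) n) +ᶻ v *ᶻ (B · B) n
  ∑∑-terms s t u v = begin
    _ ≡⟨ ∑∑-+ (λ x y → f₁ x y +ᶻ f₂ x y +ᶻ f₃ x y) f₄ ⟩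
    _ ≡⟨ cong (_+ᶻ ∑∑ n f₄) (trans (∑∑-+ (λ x y → f₁ x y +ᶻ f₂ x y) f₃) (cong (_+ᶻ ∑∑ n f₃) (∑∑-+ f₁ f₂))) ⟩
    _ ≡⟨ cong₂ _+ᶻ_ (cong₂ _+ᶻ_ (cong₂ _+ᶻ_
           (trans (∑∑-* s (μ 1 1)) (cong (s *ᶻ_) (∑∑-monomial n 1 1)))
           (trans (∑∑-* t (λ x y → μ 1 3 x y +ᶻ μ 3 1 x y)) (cong (t *ᶻ_) (symmetric 3))))
           (trans (∑∑-* u (λ x y → μ 1 5 x y +ᶻ μ 5 1 x y)) (cong (u *ᶻ_) (symmetric 5))))
           (trans (∑∑-* v (μ 3 3)) (cong (v *ᶻ_) (∑∑-monomial n 3 3))) ⟩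
    _ ∎
    where
    open ≡-Reasoning
    μ : ℕ → ℕ → ℤ → ℤ → ℤ
    μ i j x y = x ^ᶻ i *ᶻ y ^ᶻ j
    f₁ f₂ f₃ f₄ : ℤ → ℤ → ℤ
    f₁ x y = s *ᶻ μ 1 1 x y
    f₂ x y = t *ᶻ (μ 1 3 x y +ᶻ μ 3 1 x y)
    f₃ x y = u *ᶻ (μ 1 5 x y +ᶻ μ 5 1 x y)
    f₄ x y = v *ᶻ μ 3 3 x y
    symmetric : ∀ j → ∑∑ n (λ x y → x ^ᶻ 1 *ᶻ y ^ᶻ j +ᶻ x ^ᶻ j *ᶻ y ^ᶻ 1) ≡ + 2 *ᶻ (A · σ-series j) n
    symmetric j = begin
      _ ≡⟨ ∑∑-+ (λ x y → x ^ᶻ 1 *ᶻ y ^ᶻ j) (λ x y → x ^ᶻ j *ᶻ y ^ᶻ 1) ⟩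
      _ ≡⟨ cong₂ _+ᶻ_ (∑∑-monomial n 1 j) (trans (∑∑-monomial n j 1) (·-comm (σ-series j) (A) n)) ⟩
      _ ≡⟨ solve 1 (λ x → x :+ x := con (+ 2) :* x) refl ((A · σ-series j) n) ⟩
      _ ∎

  ∑-terms : ∀ w x y z →
    ∑< n (λ k → let c = + suc k in (w *ᶻ c ^ᶻ 7 +ᶻ x *ᶻ c ^ᶻ 5 +ᶻ y *ᶻ c ^ᶻ 3 +ᶻ z *ᶻ c ^ᶻ 1) *ᶻ L (suc k) n) ≡
    w *ᶻ D n +ᶻ x *ᶻ C n +ᶻ y *ᶻ B n +ᶻ z *ᶻ A n
  ∑-terms w x y z = begin
    _ ≡⟨ ∑-cong n (λ k → solve 9 (λ w x y z a b c d l →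
           (w :* a :+ x :* b :+ y :* c :+ z :* d) :* l :=
           w :* (a :* l) :+ x :* (b :* l) :+ y :* (c :* l) :+ z :* (d :* l)) refl w x y z
           ((+ suc k) ^ᶻ 7) ((+ suc k) ^ᶻ 5) ((+ suc k) ^ᶻ 3) ((+ suc k) ^ᶻ 1) (L (suc k) n)) ⟩
    _ ≡⟨ trans (∑-+ n _ _) (cong₂ _+ᶻ_ (∑-+₃ n _ _ _) refl) ⟩
    _ ≡⟨ cong₂ _+ᶻ_ (cong₂ _+ᶻ_ (cong₂ _+ᶻ_ (∑-*ˡ n w _) (∑-*ˡ n x _)) (∑-*ˡ n y _)) (∑-*ˡ n z _) ⟨
    _ ∎
    where open ≡-Reasoning

  -- By `θ-L`, n L = c (L + L²) at the coefficient n. This is how the factor n, hence θ, enters the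
  -- convolution formulas.
  LL-diagonal : ∀ k → + suc k *ᶻ LL n k k ≡ (+ n -ᶻ + suc k) *ᶻ L (suc k) n
  LL-diagonal k = begin
    c *ᶻ LL n k k
      ≡⟨ solve 3 (λ c l m → c :* m := c :* (l :+ m) :- c :* l) refl c (L (suc k) n) (LL n k k) ⟩
    c *ᶻ (L (suc k) n +ᶻ LL n k k) -ᶻ c *ᶻ L (suc k) n
      ≡⟨ cong (_-ᶻ c *ᶻ L (suc k) n) (trans (θ-L k n) (·-const c (L (suc k) ⊕ (L (suc k) · L (suc k))) n)) ⟨
    + n *ᶻ L (suc k) n -ᶻ c *ᶻ L (suc k) n
      ≡⟨ solve 3 (λ m c l → m :* l :- c :* l := (m :- c) :* l) refl (+ n) c (L (suc k) n) ⟩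
    (+ n -ᶻ c) *ᶻ L (suc k) n ∎
    where
    open ≡-Reasoning
    c = + suc k

-- Polynomial weights and the convolution sums they evaluate

Form : Set
Form = ∀ {m} → Polynomial m → Polynomial m → Polynomial m

-- Weights are kept as solver syntax, so that one expression serves both as a function on ℤ and
-- inside the identities given to the ring solver.
eval : Form → ℤ → ℤ → ℤ
eval f x y = ⟦ f (var 0F) (var 1F) ⟧ (x ∷ y ∷ [])

-- Telescoping: `F` is a discrete antiderivative of d · f, where `d` clears the denominators of the
-- power-sum formulas.
∑-closed-form : ∀ d (f F : ℤ → ℤ) → F 0ℤ ≡ 0ℤ → (∀ x → F x +ᶻ d *ᶻ f (1ℤ +ᶻ x) ≡ F (1ℤ +ᶻ x)) →
                ∀ m → d *ᶻ ∑< m (λ i → f (+ suc i)) ≡ F (+ m)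
∑-closed-form d f F F0 F+ zero    = trans (trans (cong (d *ᶻ_) (∑-nil _)) (ℤ.*-zeroʳ d)) (sym F0)
∑-closed-form d f F F0 F+ (suc m) = begin
  d *ᶻ ∑< (suc m) (λ i → f (+ suc i))                  ≡⟨ cong (d *ᶻ_) (∑-last m (λ i → f (+ suc i))) ⟩
  d *ᶻ (∑< m (λ i → f (+ suc i)) +ᶻ f (+ suc m))       ≡⟨ ℤ.*-distribˡ-+ d _ _ ⟩
  d *ᶻ ∑< m (λ i → f (+ suc i)) +ᶻ d *ᶻ f (+ suc m)    ≡⟨ cong (_+ᶻ d *ᶻ f (+ suc m)) (∑-closed-form d f F F0 F+ m) ⟩
  F (+ m) +ᶻ d *ᶻ f (+ suc m)                          ≡⟨ F+ (+ m) ⟩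
  F (+ suc m)                                          ∎
  where open ≡-Reasoning

-- F c m is the closed form of d ∑_{a = 1}^m h(c,a).
module _ (h F : Form) (d : ℤ)
  (h-sym : ∀ x y → eval h x y ≡ eval h y x)
  (h-shift-sym : ∀ x y → eval h (x +ᶻ y) y ≡ eval h (y +ᶻ x) x)
  (F0 : ∀ c → eval F c 0ℤ ≡ 0ℤ)
  (F+ : ∀ c x → eval F c x +ᶻ d *ᶻ eval h c (1ℤ +ᶻ x) ≡ eval F c (1ℤ +ᶻ x))
  (n : ℕ) where

  -- `∑∑-difference` multiplied by `d`. The inner sums run over a < c, so with c = k + 1 their
  -- closed form is taken at `k`; `closed` is the resulting identity for the contribution of a
  -- single c.
  convolution-sum : ∀ s t u v w x y z →
    (∀ x y → eval h (x +ᶻ y) y -ᶻ eval h x y ≡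
      s *ᶻ (x ^ᶻ 1 *ᶻ y ^ᶻ 1) +ᶻ t *ᶻ (x ^ᶻ 1 *ᶻ y ^ᶻ 3 +ᶻ x ^ᶻ 3 *ᶻ y ^ᶻ 1)
        +ᶻ u *ᶻ (x ^ᶻ 1 *ᶻ y ^ᶻ 5 +ᶻ x ^ᶻ 5 *ᶻ y ^ᶻ 1) +ᶻ v *ᶻ (x ^ᶻ 3 *ᶻ y ^ᶻ 3)) →
    (∀ k → let c = + suc k in
      eval F c (+ k) *ᶻ L (suc k) n -ᶻ d *ᶻ (eval h c c *ᶻ LL n k k) ≡
      (w *ᶻ c ^ᶻ 7 +ᶻ x *ᶻ c ^ᶻ 5 +ᶻ y *ᶻ c ^ᶻ 3 +ᶻ z *ᶻ c ^ᶻ 1) *ᶻ L (suc k) n) →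
    d *ᶻ (s *ᶻ (A · A) n +ᶻ t *ᶻ (+ 2 *ᶻ (A · B) n)
      +ᶻ u *ᶻ (+ 2 *ᶻ (A · C) n) +ᶻ v *ᶻ (B · B) n) ≡
    w *ᶻ D n +ᶻ x *ᶻ C n +ᶻ y *ᶻ B n +ᶻ z *ᶻ A n
  convolution-sum s t u v w x y z difference closed = begin
    _ ≡⟨ cong (d *ᶻ_) (trans (∑∑-cong n difference) (∑∑-terms n s t u v)) ⟨
    d *ᶻ ∑∑ n (λ x y → eval h (x +ᶻ y) y -ᶻ eval h x y)
      ≡⟨ cong (d *ᶻ_) (∑∑-difference n (λ x y → eval h (x +ᶻ y) y) (eval h) h-shift-sym h-sym (λ _ _ → refl)) ⟩
    d *ᶻ (∑< n p -ᶻ ∑< n r)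
      ≡⟨ solve 3 (λ d p r → d :* (p :- r) := d :* p :+ :- d :* r) refl d (∑< n p) (∑< n r) ⟩
    d *ᶻ ∑< n p +ᶻ -ᶻ d *ᶻ ∑< n r
      ≡⟨ cong₂ _+ᶻ_ (∑-*ˡ n d p) (∑-*ˡ n (-ᶻ d) r) ⟩
    ∑< n (λ k → d *ᶻ p k) +ᶻ ∑< n (λ k → -ᶻ d *ᶻ r k)
      ≡⟨ ∑-+ n _ _ ⟨
    ∑< n (λ k → d *ᶻ p k +ᶻ -ᶻ d *ᶻ r k)
      ≡⟨ ∑-cong n (λ k → trans (regroup k) (closed k)) ⟩
    _ ≡⟨ ∑-terms n w x y z ⟩
    _ ∎
    where
    open ≡-Reasoning
    p r : ℕ → ℤ
    p k = ∑< k (λ i → eval h (+ suc k) (+ suc i)) *ᶻ L (suc k) n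
    r k = eval h (+ suc k) (+ suc k) *ᶻ LL n k k
    regroup : ∀ k → d *ᶻ p k +ᶻ -ᶻ d *ᶻ r k ≡ eval F (+ suc k) (+ k) *ᶻ L (suc k) n -ᶻ d *ᶻ r k
    regroup k = trans
      (solve 4 (λ d s l r → d :* (s :* l) :+ :- d :* r := d :* s :* l :- d :* r) refl
        d (∑< k (λ i → eval h (+ suc k) (+ suc i))) (L (suc k) n) (r k))
      (cong (λ e → e *ᶻ L (suc k) n -ᶻ d *ᶻ r k)
        (∑-closed-form d (eval h (+ suc k)) (eval F (+ suc k)) (F0 (+ suc k)) (F+ (+ suc k)) k))

-- N and T are invariant under (x, y) ↦ (x, x - y), so h(x + y, y) is symmetric
-- in x and y for h = N^m and h = T²; T itself is not symmetric.
N T : Form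
N x y = x :* x :- x :* y :+ y :* y
T x y = x :* y :* (x :- y)

∑N : Form
∑N c m =
    con (+ 6) :* c :^ 2 :* m :- con (+ 3) :* c :* m :^ 2 :- con (+ 3) :* c :* m :+ con (+ 2) :* m :^ 3
    :+ con (+ 3) :* m :^ 2 :+ con (+ 1) :* m

N-sums : ∀ n →
  + 6 *ᶻ (+ 2 *ᶻ (A · A) n +ᶻ + 0 *ᶻ (+ 2 *ᶻ (A · B) n)
    +ᶻ + 0 *ᶻ (+ 2 *ᶻ (A · C) n) +ᶻ + 0 *ᶻ (B · B) n) ≡
  + 0 *ᶻ D n +ᶻ + 0 *ᶻ C n +ᶻ + 5 *ᶻ B n +ᶻ (1ℤ -ᶻ + 6 *ᶻ + n) *ᶻ A n
N-sums n = convolution-sum N ∑N (+ 6)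
  (solve 2 (λ x y → N x y := N y x) refl)
  (solve 2 (λ x y → N (x :+ y) y := N (y :+ x) x) refl)
  (solve 1 (λ c → ∑N c (con 0ℤ) := con 0ℤ) refl)
  (solve 2 (λ c m → ∑N c m :+ con (+ 6) :* N c (con 1ℤ :+ m) := ∑N c (con 1ℤ :+ m)) refl)
  n (+ 2) (+ 0) (+ 0) (+ 0) (+ 0) (+ 0) (+ 5) (1ℤ -ᶻ + 6 *ᶻ + n)
  (solve 2 (λ x y → N (x :+ y) y :- N x y :=
     con (+ 2) :* (x :^ 1 :* y :^ 1) :+ con (+ 0) :* (x :^ 1 :* y :^ 3 :+ x :^ 3 :* y :^ 1)
       :+ con (+ 0) :* (x :^ 1 :* y :^ 5 :+ x :^ 5 :* y :^ 1) :+ con (+ 0) :* (x :^ 3 :* y :^ 3)) refl)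
  (λ k → trans
    (cong (λ e → eval ∑N (+ suc k) (+ k) *ᶻ L (suc k) n -ᶻ + 6 *ᶻ e)
      -- N(c,c) = c²; one factor c is absorbed by `LL-diagonal`, which trades the square of L_c for
      -- (n - c) L_c.
      (trans (solve 2 (λ c l → N c c :* l := c :^ 1 :* (c :* l)) refl (+ suc k) (LL n k k))
             (cong ((+ suc k) ^ᶻ 1 *ᶻ_) (LL-diagonal n k))))
    (solve 3 (λ k n l → let c = con 1ℤ :+ k in
      ∑N c k :* l :- con (+ 6) :* (c :^ 1 :* ((n :- c) :* l)) :=
      (con (+ 0) :* c :^ 7 :+ con (+ 0) :* c :^ 5 :+ con (+ 5) :* c :^ 3 :+ (con 1ℤ :- con (+ 6) :* n) :* c :^ 1) :* l) refl
      (+ k) (+ n) (L (suc k) n)))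

N² : Form
N² x y = N x y :* N x y

∑N² : Form
∑N² c m =
    con (+ 30) :* c :^ 4 :* m :- con (+ 30) :* c :^ 3 :* m :^ 2 :- con (+ 30) :* c :^ 3 :* m
    :+ con (+ 30) :* c :^ 2 :* m :^ 3 :+ con (+ 45) :* c :^ 2 :* m :^ 2 :+ con (+ 15) :* c :^ 2 :* m
    :- con (+ 15) :* c :* m :^ 4 :- con (+ 30) :* c :* m :^ 3 :- con (+ 15) :* c :* m :^ 2
    :+ con (+ 6) :* m :^ 5 :+ con (+ 15) :* m :^ 4 :+ con (+ 10) :* m :^ 3 :- con (+ 1) :* m

N²-sums : ∀ n →
  + 30 *ᶻ (+ 0 *ᶻ (A · A) n +ᶻ + 4 *ᶻ (+ 2 *ᶻ (A · B) n)
    +ᶻ + 0 *ᶻ (+ 2 *ᶻ (A · C) n) +ᶻ + 0 *ᶻ (B · B) n) ≡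
  + 0 *ᶻ D n +ᶻ + 21 *ᶻ C n +ᶻ (+ 10 -ᶻ + 30 *ᶻ + n) *ᶻ B n +ᶻ -ᶻ 1ℤ *ᶻ A n
N²-sums n = convolution-sum N² ∑N² (+ 30)
  (solve 2 (λ x y → N² x y := N² y x) refl)
  (solve 2 (λ x y → N² (x :+ y) y := N² (y :+ x) x) refl)
  (solve 1 (λ c → ∑N² c (con 0ℤ) := con 0ℤ) refl)
  (solve 2 (λ c m → ∑N² c m :+ con (+ 30) :* N² c (con 1ℤ :+ m) := ∑N² c (con 1ℤ :+ m)) refl)
  n (+ 0) (+ 4) (+ 0) (+ 0) (+ 0) (+ 21) (+ 10 -ᶻ + 30 *ᶻ + n) (-ᶻ 1ℤ)
  (solve 2 (λ x y → N² (x :+ y) y :- N² x y :=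
     con (+ 0) :* (x :^ 1 :* y :^ 1) :+ con (+ 4) :* (x :^ 1 :* y :^ 3 :+ x :^ 3 :* y :^ 1)
       :+ con (+ 0) :* (x :^ 1 :* y :^ 5 :+ x :^ 5 :* y :^ 1) :+ con (+ 0) :* (x :^ 3 :* y :^ 3)) refl)
  (λ k → trans
    (cong (λ e → eval ∑N² (+ suc k) (+ k) *ᶻ L (suc k) n -ᶻ + 30 *ᶻ e)
      (trans (solve 2 (λ c l → N² c c :* l := c :^ 3 :* (c :* l)) refl (+ suc k) (LL n k k))
             (cong ((+ suc k) ^ᶻ 3 *ᶻ_) (LL-diagonal n k))))
    (solve 3 (λ k n l → let c = con 1ℤ :+ k in
      ∑N² c k :* l :- con (+ 30) :* (c :^ 3 :* ((n :- c) :* l)) :=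
      (con (+ 0) :* c :^ 7 :+ con (+ 21) :* c :^ 5 :+ (con (+ 10) :- con (+ 30) :* n) :* c :^ 3 :+ :- con 1ℤ :* c :^ 1) :* l) refl
      (+ k) (+ n) (L (suc k) n)))

N³ : Form
N³ x y = N x y :* (N x y :* N x y)

∑N³ : Form
∑N³ c m =
    con (+ 420) :* c :^ 6 :* m :- con (+ 630) :* c :^ 5 :* m :^ 2 :- con (+ 630) :* c :^ 5 :* m
    :+ con (+ 840) :* c :^ 4 :* m :^ 3 :+ con (+ 1260) :* c :^ 4 :* m :^ 2 :+ con (+ 420) :* c :^ 4 :* m
    :- con (+ 735) :* c :^ 3 :* m :^ 4 :- con (+ 1470) :* c :^ 3 :* m :^ 3
    :- con (+ 735) :* c :^ 3 :* m :^ 2 :+ con (+ 504) :* c :^ 2 :* m :^ 5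
    :+ con (+ 1260) :* c :^ 2 :* m :^ 4 :+ con (+ 840) :* c :^ 2 :* m :^ 3 :- con (+ 84) :* c :^ 2 :* m
    :- con (+ 210) :* c :* m :^ 6 :- con (+ 630) :* c :* m :^ 5 :- con (+ 525) :* c :* m :^ 4
    :+ con (+ 105) :* c :* m :^ 2 :+ con (+ 60) :* m :^ 7 :+ con (+ 210) :* m :^ 6
    :+ con (+ 210) :* m :^ 5 :- con (+ 70) :* m :^ 3 :+ con (+ 10) :* m

N³-sums : ∀ n →
  + 420 *ᶻ (+ 0 *ᶻ (A · A) n +ᶻ + 0 *ᶻ (+ 2 *ᶻ (A · B) n)
    +ᶻ + 6 *ᶻ (+ 2 *ᶻ (A · C) n) +ᶻ + 14 *ᶻ (B · B) n) ≡
  + 249 *ᶻ D n +ᶻ (+ 210 -ᶻ + 420 *ᶻ + n) *ᶻ C n +ᶻ -ᶻ + 49 *ᶻ B n +ᶻ + 10 *ᶻ A n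
N³-sums n = convolution-sum N³ ∑N³ (+ 420)
  (solve 2 (λ x y → N³ x y := N³ y x) refl)
  (solve 2 (λ x y → N³ (x :+ y) y := N³ (y :+ x) x) refl)
  (solve 1 (λ c → ∑N³ c (con 0ℤ) := con 0ℤ) refl)
  (solve 2 (λ c m → ∑N³ c m :+ con (+ 420) :* N³ c (con 1ℤ :+ m) := ∑N³ c (con 1ℤ :+ m)) refl)
  n (+ 0) (+ 0) (+ 6) (+ 14) (+ 249) (+ 210 -ᶻ + 420 *ᶻ + n) (-ᶻ + 49) (+ 10)
  (solve 2 (λ x y → N³ (x :+ y) y :- N³ x y :=
     con (+ 0) :* (x :^ 1 :* y :^ 1) :+ con (+ 0) :* (x :^ 1 :* y :^ 3 :+ x :^ 3 :* y :^ 1)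
       :+ con (+ 6) :* (x :^ 1 :* y :^ 5 :+ x :^ 5 :* y :^ 1) :+ con (+ 14) :* (x :^ 3 :* y :^ 3)) refl)
  (λ k → trans
    (cong (λ e → eval ∑N³ (+ suc k) (+ k) *ᶻ L (suc k) n -ᶻ + 420 *ᶻ e)
      (trans (solve 2 (λ c l → N³ c c :* l := c :^ 5 :* (c :* l)) refl (+ suc k) (LL n k k))
             (cong ((+ suc k) ^ᶻ 5 *ᶻ_) (LL-diagonal n k))))
    (solve 3 (λ k n l → let c = con 1ℤ :+ k in
      ∑N³ c k :* l :- con (+ 420) :* (c :^ 5 :* ((n :- c) :* l)) :=
      (con (+ 249) :* c :^ 7 :+ (con (+ 210) :- con (+ 420) :* n) :* c :^ 5 :+ :- con (+ 49) :* c :^ 3 :+ con (+ 10) :* c :^ 1) :* l) refl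
      (+ k) (+ n) (L (suc k) n)))

T² : Form
T² x y = T x y :* T x y

∑T² : Form
∑T² c m =
    con (+ 10) :* c :^ 4 :* m :^ 3 :+ con (+ 15) :* c :^ 4 :* m :^ 2 :+ con (+ 5) :* c :^ 4 :* m
    :- con (+ 15) :* c :^ 3 :* m :^ 4 :- con (+ 30) :* c :^ 3 :* m :^ 3
    :- con (+ 15) :* c :^ 3 :* m :^ 2 :+ con (+ 6) :* c :^ 2 :* m :^ 5 :+ con (+ 15) :* c :^ 2 :* m :^ 4
    :+ con (+ 10) :* c :^ 2 :* m :^ 3 :- con (+ 1) :* c :^ 2 :* m

-- T(x+y,y)² - T(x,y)² = x²y² ((x+y)² - (x-y)²) = 4x³y³, which isolates the product of σ₃ with
-- itself. As T vanishes on the diagonal, no term with n appears.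
T²-sums : ∀ n →
  + 30 *ᶻ (+ 0 *ᶻ (A · A) n +ᶻ + 0 *ᶻ (+ 2 *ᶻ (A · B) n)
    +ᶻ + 0 *ᶻ (+ 2 *ᶻ (A · C) n) +ᶻ + 4 *ᶻ (B · B) n) ≡
  1ℤ *ᶻ D n +ᶻ + 0 *ᶻ C n +ᶻ -ᶻ 1ℤ *ᶻ B n +ᶻ + 0 *ᶻ A n
T²-sums n = convolution-sum T² ∑T² (+ 30)
  (solve 2 (λ x y → T² x y := T² y x) refl)
  (solve 2 (λ x y → T² (x :+ y) y := T² (y :+ x) x) refl)
  (solve 1 (λ c → ∑T² c (con 0ℤ) := con 0ℤ) refl)
  (solve 2 (λ c m → ∑T² c m :+ con (+ 30) :* T² c (con 1ℤ :+ m) := ∑T² c (con 1ℤ :+ m)) refl)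
  n (+ 0) (+ 0) (+ 0) (+ 4) 1ℤ (+ 0) (-ᶻ 1ℤ) (+ 0)
  (solve 2 (λ x y → T² (x :+ y) y :- T² x y :=
     con (+ 0) :* (x :^ 1 :* y :^ 1) :+ con (+ 0) :* (x :^ 1 :* y :^ 3 :+ x :^ 3 :* y :^ 1)
       :+ con (+ 0) :* (x :^ 1 :* y :^ 5 :+ x :^ 5 :* y :^ 1) :+ con (+ 4) :* (x :^ 3 :* y :^ 3)) refl)
  (λ k → solve 3 (λ k l m → let c = con 1ℤ :+ k in
      ∑T² c k :* l :- con (+ 30) :* (T² c c :* m) :=
      (con 1ℤ :* c :^ 7 :+ con (+ 0) :* c :^ 5 :+ :- con 1ℤ :* c :^ 3 :+ con (+ 0) :* c :^ 1) :* l) refl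
      (+ k) (L (suc k) n) (LL n k k))

-- Ramanujan's differential equations and Δ

-- Equivalent to Ramanujan's equation for the remaining series, 12 θP = P² - Q. It turns σ₁ ∗ σ₁
-- into n σ₁ in the argument modulo 5.
A·A : ∀ n → + 12 *ᶻ (A · A) n ≡ + 5 *ᶻ B n +ᶻ A n -ᶻ + 6 *ᶻ (+ n *ᶻ A n)
A·A n = trans
  (solve 4 (λ aa ab ac bb → con (+ 12) :* aa :=
     con (+ 6) :* (con (+ 2) :* aa :+ con (+ 0) :* (con (+ 2) :* ab) :+ con (+ 0) :* (con (+ 2) :* ac) :+ con (+ 0) :* bb))
     refl ((A · A) n) ((A · B) n) ((A · C) n) ((B · B) n))
  (trans (N-sums n)
  (solve 5 (λ n a b c d → con (+ 0) :* d :+ con (+ 0) :* c :+ con (+ 5) :* b :+ (con 1ℤ :- con (+ 6) :* n) :* a :=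
     con (+ 5) :* b :+ a :- con (+ 6) :* (n :* a)) refl (+ n) (A n) (B n) (C n) (D n)))

A·B : ∀ n → + 240 *ᶻ (A · B) n ≡ + 21 *ᶻ C n +ᶻ + 10 *ᶻ B n -ᶻ A n -ᶻ + 30 *ᶻ (+ n *ᶻ B n)
A·B n = trans
  (solve 4 (λ aa ab ac bb → con (+ 240) :* ab :=
     con (+ 30) :* (con (+ 0) :* aa :+ con (+ 4) :* (con (+ 2) :* ab) :+ con (+ 0) :* (con (+ 2) :* ac) :+ con (+ 0) :* bb))
     refl ((A · A) n) ((A · B) n) ((A · C) n) ((B · B) n))
  (trans (N²-sums n)
  (solve 5 (λ n a b c d → con (+ 0) :* d :+ con (+ 21) :* c :+ (con (+ 10) :- con (+ 30) :* n) :* b :+ :- con 1ℤ :* a :=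
     con (+ 21) :* c :+ con (+ 10) :* b :- a :- con (+ 30) :* (n :* b)) refl (+ n) (A n) (B n) (C n) (D n)))

-- Equivalent to Q² = 1 + 480 D, that is, E₄² = E₈.
B·B : ∀ n → + 120 *ᶻ (B · B) n ≡ D n -ᶻ B n
B·B n = trans
  (solve 4 (λ aa ab ac bb → con (+ 120) :* bb :=
     con (+ 30) :* (con (+ 0) :* aa :+ con (+ 0) :* (con (+ 2) :* ab) :+ con (+ 0) :* (con (+ 2) :* ac) :+ con (+ 4) :* bb))
     refl ((A · A) n) ((A · B) n) ((A · C) n) ((B · B) n))
  (trans (T²-sums n)
  (solve 4 (λ a b c d → con 1ℤ :* d :+ con (+ 0) :* c :+ :- con 1ℤ :* b :+ con (+ 0) :* a :=
     d :- b) refl (A n) (B n) (C n) (D n)))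

A·C : ∀ n → + 504 *ᶻ (A · C) n ≡ + 20 *ᶻ D n +ᶻ + 21 *ᶻ C n +ᶻ A n -ᶻ + 42 *ᶻ (+ n *ᶻ C n)
A·C n = ℤ.*-cancelˡ-≡ (+ 10) _ _ (begin
  + 10 *ᶻ (+ 504 *ᶻ ac)
    -- Since 420 · 14 = 49 · 120, subtracting 49 times the formula for B · B removes that product;
    -- the σ₃ terms then cancel as well, and a common factor 10 is left to divide out.
    ≡⟨ solve 4 (λ aa ab ac bb → con (+ 10) :* (con (+ 504) :* ac) :=
         con (+ 420) :* (con (+ 0) :* aa :+ con (+ 0) :* (con (+ 2) :* ab) :+ con (+ 6) :* (con (+ 2) :* ac) :+ con (+ 14) :* bb)
         :- con (+ 49) :* (con (+ 120) :* bb)) refl ((A · A) n) ((A · B) n) ac ((B · B) n) ⟩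
  _ ≡⟨ cong₂ (λ u v → u -ᶻ + 49 *ᶻ v) (N³-sums n) (B·B n) ⟩
  _ ≡⟨ solve 5 (λ n a b c d →
         con (+ 249) :* d :+ (con (+ 210) :- con (+ 420) :* n) :* c :+ :- con (+ 49) :* b :+ con (+ 10) :* a :- con (+ 49) :* (d :- b) :=
         con (+ 10) :* (con (+ 20) :* d :+ con (+ 21) :* c :+ a :- con (+ 42) :* (n :* c))) refl (+ n) (A n) (B n) (C n) (D n) ⟩
  _ ∎)
  where
  open ≡-Reasoning
  ac = (A · C) n

P Q R : Series
P = const 1ℤ ⊕ const (-ᶻ + 24) · A
Q = const 1ℤ ⊕ const (+ 240) · B
R = const 1ℤ ⊕ const (-ᶻ + 504) · C

θ-1+ : ∀ z f → θ (const 1ℤ ⊕ const z · f) ≗ const z · θ f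
θ-1+ z f zero    = sym (trans (·-const z (θ f) 0) (ℤ.*-zeroʳ z))
θ-1+ z f (suc n) = begin
  + suc n *ᶻ (0ℤ +ᶻ (const z · f) (suc n))  ≡⟨ cong (+ suc n *ᶻ_) (ℤ.+-identityˡ _) ⟩
  + suc n *ᶻ (const z · f) (suc n)          ≡⟨ cong (+ suc n *ᶻ_) (·-const z f (suc n)) ⟩
  + suc n *ᶻ (z *ᶻ f (suc n))               ≡⟨ solve 3 (λ m z x → m :* (z :* x) := z :* (m :* x)) refl (+ suc n) z (f (suc n)) ⟩
  z *ᶻ (+ suc n *ᶻ f (suc n))               ≡⟨ ·-const z (θ f) (suc n) ⟨
  (const z · θ f) (suc n)                   ∎
  where open ≡-Reasoning

3θQ : const (+ 3) · θ Q ≗ P · Q ⊕ ⊖ R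
3θQ n = begin
  (const (+ 3) · θ Q) n
    ≡⟨ trans (·-const (+ 3) (θ Q) n) (cong (+ 3 *ᶻ_) (trans (θ-1+ (+ 240) B n) (·-const (+ 240) (θ B) n))) ⟩
  + 3 *ᶻ (+ 240 *ᶻ (+ n *ᶻ B n))
    ≡⟨ solve 4 (λ n a b c → con (+ 3) :* (con (+ 240) :* (n :* b)) :=
         con (-ᶻ + 24) :* a :+ con (+ 240) :* b :+ con (+ 504) :* c
           :+ con (-ᶻ + 24) :* (con (+ 21) :* c :+ con (+ 10) :* b :- a :- con (+ 30) :* (n :* b))) refl (+ n) (A n) (B n) (C n) ⟩
  _ ≡⟨ cong (λ z → -ᶻ + 24 *ᶻ A n +ᶻ + 240 *ᶻ B n +ᶻ + 504 *ᶻ C n +ᶻ -ᶻ + 24 *ᶻ z) (A·B n) ⟨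
  _ ≡⟨ cong₂ _+ᶻ_ (cong₂ _+ᶻ_ (cong₂ _+ᶻ_ (·-const (-ᶻ + 24) A n) (·-const (+ 240) B n)) (·-const (+ 504) C n))
         (trans (·-const (-ᶻ + 24) (const (+ 240) · (A · B)) n) (cong (-ᶻ + 24 *ᶻ_) (·-const (+ 240) (A · B) n))) ⟨
  _ ≡⟨ solve⟦q⟧ 3 (λ a b c → con⟦q⟧ (-ᶻ + 24) ⊠ a ⊞ con⟦q⟧ (+ 240) ⊠ b ⊞ con⟦q⟧ (+ 504) ⊠ c ⊞ con⟦q⟧ (-ᶻ + 24) ⊠ (con⟦q⟧ (+ 240) ⊠ (a ⊠ b))
         ⊜ (con⟦q⟧ 1ℤ ⊞ con⟦q⟧ (-ᶻ + 24) ⊠ a) ⊠ (con⟦q⟧ 1ℤ ⊞ con⟦q⟧ (+ 240) ⊠ b) ⊟ (con⟦q⟧ 1ℤ ⊞ con⟦q⟧ (-ᶻ + 504) ⊠ c))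
         (λ {_} → ℤ⟦q⟧.refl) A B C n ⟩
  (P · Q ⊕ ⊖ R) n ∎
  where open ≡-Reasoning

-- The products in P R - Q² are 24 · 504 A C and -240² B², with 240² = 480 · 120. Since 24 · 20 =
-- 480, the σ₇ terms of the two convolution formulas cancel.
2θR : const (+ 2) · θ R ≗ P · R ⊕ ⊖ (Q · Q)
2θR n = begin
  (const (+ 2) · θ R) n
    ≡⟨ trans (·-const (+ 2) (θ R) n) (cong (+ 2 *ᶻ_) (trans (θ-1+ (-ᶻ + 504) C n) (·-const (-ᶻ + 504) (θ C) n))) ⟩
  + 2 *ᶻ (-ᶻ + 504 *ᶻ (+ n *ᶻ C n))
    ≡⟨ solve 5 (λ n a b c d → con (+ 2) :* (con (-ᶻ + 504) :* (n :* c)) :=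
         con (-ᶻ + 24) :* a :+ con (-ᶻ + 504) :* c :+ con (-ᶻ + 480) :* b
           :+ con (+ 24) :* (con (+ 20) :* d :+ con (+ 21) :* c :+ a :- con (+ 42) :* (n :* c))
           :+ con (-ᶻ + 480) :* (d :- b)) refl (+ n) (A n) (B n) (C n) (D n) ⟩
  _ ≡⟨ cong₂ (λ y z → -ᶻ + 24 *ᶻ A n +ᶻ -ᶻ + 504 *ᶻ C n +ᶻ -ᶻ + 480 *ᶻ B n +ᶻ + 24 *ᶻ y +ᶻ -ᶻ + 480 *ᶻ z) (A·C n) (B·B n) ⟨
  _ ≡⟨ cong₂ _+ᶻ_ (cong₂ _+ᶻ_ (cong₂ _+ᶻ_ (cong₂ _+ᶻ_ (·-const (-ᶻ + 24) A n) (·-const (-ᶻ + 504) C n)) (·-const (-ᶻ + 480) B n))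
         (trans (·-const (+ 24) (const (+ 504) · (A · C)) n) (cong (+ 24 *ᶻ_) (·-const (+ 504) (A · C) n))))
         (trans (·-const (-ᶻ + 480) (const (+ 120) · (B · B)) n) (cong (-ᶻ + 480 *ᶻ_) (·-const (+ 120) (B · B) n))) ⟨
  _ ≡⟨ solve⟦q⟧ 3 (λ a b c → con⟦q⟧ (-ᶻ + 24) ⊠ a ⊞ con⟦q⟧ (-ᶻ + 504) ⊠ c ⊞ con⟦q⟧ (-ᶻ + 480) ⊠ b
           ⊞ con⟦q⟧ (+ 24) ⊠ (con⟦q⟧ (+ 504) ⊠ (a ⊠ c)) ⊞ con⟦q⟧ (-ᶻ + 480) ⊠ (con⟦q⟧ (+ 120) ⊠ (b ⊠ b))
         ⊜ (con⟦q⟧ 1ℤ ⊞ con⟦q⟧ (-ᶻ + 24) ⊠ a) ⊠ (con⟦q⟧ 1ℤ ⊞ con⟦q⟧ (-ᶻ + 504) ⊠ c)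
           ⊟ (con⟦q⟧ 1ℤ ⊞ con⟦q⟧ (+ 240) ⊠ b) ⊠ (con⟦q⟧ 1ℤ ⊞ con⟦q⟧ (+ 240) ⊠ b))
         (λ {_} → ℤ⟦q⟧.refl) A B C n ⟩
  (P · R ⊕ ⊖ (Q · Q)) n ∎
  where open ≡-Reasoning

X : Series
X = Q · (Q · Q) ⊕ ⊖ (R · R)

θX : θ X ≗ P · X
θX = begin
  θ X
    ≈⟨ (λ n → ℤ.*-distribˡ-+ (+ n) ((Q · (Q · Q)) n) (-ᶻ (R · R) n)) ⟩
  θ (Q · (Q · Q)) ⊕ θ (⊖ (R · R))
    ≈⟨ ℤ⟦q⟧.+-cong (λ n → trans (θ-· Q (Q · Q) n) (cong ((θ Q · (Q · Q)) n +ᶻ_) (·-congˡ Q (θ-· Q Q) n)))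
                   (λ n → trans (sym (ℤ.neg-distribʳ-* (+ n) ((R · R) n))) (cong -ᶻ_ (θ-· R R n))) ⟩
  (θ Q · (Q · Q) ⊕ Q · (θ Q · Q ⊕ Q · θ Q)) ⊕ ⊖ (θ R · R ⊕ R · θ R)
    ≈⟨ solve⟦q⟧ 4 (λ q r q′ r′ → (q′ ⊠ (q ⊠ q) ⊞ q ⊠ (q′ ⊠ q ⊞ q ⊠ q′)) ⊟ (r′ ⊠ r ⊞ r ⊠ r′)
         ⊜ q ⊠ q ⊠ (con⟦q⟧ (+ 3) ⊠ q′) ⊟ r ⊠ (con⟦q⟧ (+ 2) ⊠ r′)) (λ {_} → ℤ⟦q⟧.refl) Q R (θ Q) (θ R) ⟩
  Q · Q · (const (+ 3) · θ Q) ⊕ ⊖ (R · (const (+ 2) · θ R))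
    ≈⟨ ℤ⟦q⟧.+-cong (·-congˡ (Q · Q) 3θQ) (λ n → cong -ᶻ_ (·-congˡ R 2θR n)) ⟩
  Q · Q · (P · Q ⊕ ⊖ R) ⊕ ⊖ (R · (P · R ⊕ ⊖ (Q · Q)))
    -- The two mixed terms Q²R cancel.
    ≈⟨ solve⟦q⟧ 3 (λ p q r → q ⊠ q ⊠ (p ⊠ q ⊟ r) ⊟ r ⊠ (p ⊠ r ⊟ q ⊠ q)
         ⊜ p ⊠ (q ⊠ (q ⊠ q) ⊟ r ⊠ r)) (λ {_} → ℤ⟦q⟧.refl) P Q R ⟩
  P · X ∎
  where open import Relation.Binary.Reasoning.Setoid ℤ⟦q⟧.setoid

opaque
  unfolding ∑< _·_

  X0≡0 : X 0 ≡ 0ℤ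
  X0≡0 = refl

  -- 3 · 240 + 2 · 504, the initial value that fixes the ratio of X to Δ.
  X1≡1728 : X 1 ≡ + 1728
  X1≡1728 = refl

  A0≡0 : A 0 ≡ 0ℤ
  A0≡0 = refl

-- In θX = P X the constant term 1 of P moves to the left, and X 0 = 0 allows division by q. Thus
-- X/q solves θf = -24 A f, the equation of the product without its leading q.
X-recurrence : ∀ n → + n *ᶻ X (suc n) ≡ -ᶻ + 24 *ᶻ (A · tail X) n
X-recurrence n = begin
  + n *ᶻ X (suc n)
    ≡⟨ solve 2 (λ n x → n :* x := (con 1ℤ :+ n) :* x :- x) refl (+ n) (X (suc n)) ⟩
  + suc n *ᶻ X (suc n) -ᶻ X (suc n)
    ≡⟨ cong (_-ᶻ X (suc n)) (trans (θX (suc n)) (solve⟦q⟧ 2 (λ a x → (con⟦q⟧ 1ℤ ⊞ con⟦q⟧ (-ᶻ + 24) ⊠ a) ⊠ x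
         ⊜ x ⊞ con⟦q⟧ (-ᶻ + 24) ⊠ (a ⊠ x)) (λ {_} → ℤ⟦q⟧.refl) A X (suc n))) ⟩
  X (suc n) +ᶻ (const (-ᶻ + 24) · (A · X)) (suc n) -ᶻ X (suc n)
    ≡⟨ cong (λ z → X (suc n) +ᶻ z -ᶻ X (suc n)) (trans (·-const (-ᶻ + 24) (A · X) (suc n))
         (cong (-ᶻ + 24 *ᶻ_) (trans (·-suc′ A X n) (cong (λ z → A (suc n) *ᶻ z +ᶻ (A · tail X) n) X0≡0)))) ⟩
  X (suc n) +ᶻ -ᶻ + 24 *ᶻ (A (suc n) *ᶻ 0ℤ +ᶻ (A · tail X) n) -ᶻ X (suc n)
    ≡⟨ solve 3 (λ x a t → x :+ con (-ᶻ + 24) :* (a :* con 0ℤ :+ t) :- x := con (-ᶻ + 24) :* t) refl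
         (X (suc n)) (A (suc n)) ((A · tail X) n) ⟩
  -ᶻ + 24 *ᶻ (A · tail X) n ∎
  where open ≡-Reasoning

-- The logarithmic derivative of the product and the identity 1728 Δ = Q³ - R²

θ-·-log : ∀ {f g u v} → θ f ≗ f · u → θ g ≗ g · v → θ (f · g) ≗ (f · g) · (u ⊕ v)
θ-·-log {f} {g} {u} {v} p q n = begin
  _ ≡⟨ θ-· f g n ⟩
  _ ≡⟨ cong₂ _+ᶻ_ (·-congʳ g p n) (·-congˡ f q n) ⟩
  _ ≡⟨ solve⟦q⟧ 4 (λ f g u v → f ⊠ u ⊠ g ⊞ f ⊠ (g ⊠ v) ⊜ f ⊠ g ⊠ (u ⊞ v)) (λ {_} → ℤ⟦q⟧.refl) f g u v n ⟩
  _ ∎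
  where open ≡-Reasoning

θ-q^0 : ∀ n → (θ q^ 0) n ≡ 0ℤ
θ-q^0 zero    = refl
θ-q^0 (suc n) = ℤ.*-zeroʳ (+ suc n)

θ-⊛^-log : ∀ {f u} → θ f ≗ f · u → ∀ r → θ (f ⊛^ r) ≗ (f ⊛^ r) · (const (+ r) · u)
θ-⊛^-log {f} {u} p zero    n = trans (θ-q^0 n) (sym (trans (·-congˡ (q^ 0) (·-const 0ℤ u) n)
  (trans (·-congʳ _ q^0≗1 n) (·-identityˡ _ n))))
θ-⊛^-log {f} {u} p (suc r) =
  subst (λ g → θ g ≗ g · (const (+ suc r) · u)) (sym (⊛^-suc f r)) λ n →
    trans (θ-·-log {f} {f ⊛^ r} {u} p (θ-⊛^-log p r) n)
      (·-congˡ (f · (f ⊛^ r)) (λ k → trans (cong (u k +ᶻ_) (·-const (+ r) u k))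
        (trans (sym (ℤ.suc-* (+ r) (u k))) (sym (·-const (+ suc r) u k)))) n)

-- The logarithmic derivative of 1 - q^a is -a q^a / (1 - q^a) = -a L_a.
θ-1-q^-log : ∀ i → θ (1-q^ (suc i)) ≗ 1-q^ (suc i) · (const (-ᶻ + suc i) · L (suc i))
θ-1-q^-log i n = begin
  + n *ᶻ (q^ 0 n -ᶻ q^ a n)
    ≡⟨ solve 3 (λ n x y → n :* (x :- y) := n :* x :- n :* y) refl (+ n) (q^ 0 n) (q^ a n) ⟩
  + n *ᶻ q^ 0 n -ᶻ + n *ᶻ q^ a n
    ≡⟨ cong₂ _-ᶻ_ (θ-q^0 n) (trans (θ-q^ a n) (·-const (+ a) (q^ a) n)) ⟩
  0ℤ -ᶻ + a *ᶻ q^ a n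
    ≡⟨ solve 2 (λ a x → con 0ℤ :- a :* x := :- a :* x) refl (+ a) (q^ a n) ⟩
  -ᶻ + a *ᶻ q^ a n
    ≡⟨ cong (-ᶻ + a *ᶻ_) (q^a n) ⟩
  -ᶻ + a *ᶻ (1-q^ a · L a) n
    ≡⟨ ·-const (-ᶻ + a) (1-q^ a · L a) n ⟨
  (const (-ᶻ + a) · (1-q^ a · L a)) n
    ≡⟨ solve⟦q⟧ 3 (λ c x l → c ⊠ (x ⊠ l) ⊜ x ⊠ (c ⊠ l)) (λ {_} → ℤ⟦q⟧.refl) (const (-ᶻ + a)) (1-q^ a) (L a) n ⟩
  (1-q^ a · (const (-ᶻ + a) · L a)) n ∎
  where
  open ≡-Reasoning
  a = suc i
  q^a : q^ a ≗ 1-q^ a · L a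
  q^a n = begin
    q^ a n
      ≡⟨ solve⟦q⟧ 2 (λ x l → x ⊜ x ⊠ (con⟦q⟧ 1ℤ ⊞ l) ⊟ x ⊠ l) (λ {_} → ℤ⟦q⟧.refl) (q^ a) (L a) n ⟩
    (q^ a · (const 1ℤ ⊕ L a)) n -ᶻ (q^ a · L a) n
      ≡⟨ cong (_-ᶻ (q^ a · L a) n) (L-fixpoint i n) ⟨
    L a n -ᶻ (q^ a · L a) n
      ≡⟨ solve⟦q⟧ 2 (λ x l → l ⊟ x ⊠ l ⊜ (con⟦q⟧ 1ℤ ⊟ x) ⊠ l) (λ {_} → ℤ⟦q⟧.refl) (q^ a) (L a) n ⟩
    ((const 1ℤ ⊕ ⊖ q^ a) · L a) n
      ≡⟨ ·-congʳ (L a) (λ k → cong (_-ᶻ q^ a k) (q^0≗1 k)) n ⟨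
    (1-q^ a · L a) n ∎

-- The exponent is a variable, later set to 24, so that the power does not unfold.
θ-·-1-q^ : ∀ N r {g u} → θ g ≗ g · u →
           θ (g · (1-q^ (suc N) ⊛^ r)) ≗ (g · (1-q^ (suc N) ⊛^ r)) · (u ⊕ const (+ r) · (const (-ᶻ + suc N) · L (suc N)))
θ-·-1-q^ N r {g} {u} p = θ-·-log {g} {1-q^ (suc N) ⊛^ r} {u} p (θ-⊛^-log (θ-1-q^-log N) r)

θ-partialProduct : ∀ N → θ (partialProduct N) ≗ partialProduct N · (const (-ᶻ + 24) · σ-truncated 1 N)
θ-partialProduct zero    n = trans (θ-q^0 n) (sym (trans (·-congˡ (q^ 0) (λ k → trans (·-const (-ᶻ + 24) (σ-truncated 1 0) k)
  (cong (-ᶻ + 24 *ᶻ_) (∑-nil _))) n) (trans (·-congʳ _ q^0≗1 n) (·-identityˡ (λ _ → 0ℤ) n))))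
θ-partialProduct (suc N) = subst (λ g → θ g ≗ g · (const (-ᶻ + 24) · σ-truncated 1 (suc N))) (sym (partialProduct-suc N)) λ n →
  trans (θ-·-1-q^ N 24 (θ-partialProduct N) n) (·-congˡ _ exponent n)
  where
  open ≡-Reasoning
  exponent : const (-ᶻ + 24) · σ-truncated 1 N ⊕ const (+ 24) · (const (-ᶻ + suc N) · L (suc N))
             ≗ const (-ᶻ + 24) · σ-truncated 1 (suc N)
  exponent k = begin
    _ ≡⟨ cong₂ _+ᶻ_ (·-const (-ᶻ + 24) (σ-truncated 1 N) k)
           (trans (·-const (+ 24) (const (-ᶻ + suc N) · L (suc N)) k) (cong (+ 24 *ᶻ_) (·-const (-ᶻ + suc N) (L (suc N)) k))) ⟩
    _ ≡⟨ solve 3 (λ s a l → con (-ᶻ + 24) :* s :+ con (+ 24) :* (:- a :* l) := con (-ᶻ + 24) :* (s :+ a :^ 1 :* l)) refl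
           (σ-truncated 1 N k) (+ suc N) (L (suc N) k) ⟩
    _ ≡⟨ cong (-ᶻ + 24 *ᶻ_) (∑-last N _) ⟨
    _ ≡⟨ ·-const (-ᶻ + 24) (σ-truncated 1 (suc N)) k ⟨
    _ ∎

⊛^-constant : ∀ f r → f 0 ≡ 1ℤ → (f ⊛^ r) 0 ≡ 1ℤ
⊛^-constant f zero    f0 = refl
⊛^-constant f (suc r) f0 = trans (cong (_$ 0) (⊛^-suc f r)) (trans (·-zero f (f ⊛^ r)) (cong₂ _*ᶻ_ f0 (⊛^-constant f r f0)))

partialProduct-constant : ∀ N → partialProduct N 0 ≡ 1ℤ
partialProduct-constant zero    = refl
partialProduct-constant (suc N) = trans (cong (_$ 0) (partialProduct-suc N)) (unit 24)
  where
  unit : ∀ r → (partialProduct N · (1-q^ (suc N) ⊛^ r)) 0 ≡ 1ℤ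
  unit r = trans (·-zero (partialProduct N) (1-q^ (suc N) ⊛^ r))
    (cong₂ _*ᶻ_ (partialProduct-constant N) (⊛^-constant (1-q^ (suc N)) r refl))

-- The logarithmic derivative of the finite product agrees with -24 A up to q^N, whence the bound on
-- k.
partialProduct-recurrence : ∀ N k → k ≤ N → + k *ᶻ partialProduct N k ≡ -ᶻ + 24 *ᶻ (A · partialProduct N) k
partialProduct-recurrence N k k≤N = begin
  _ ≡⟨ θ-partialProduct N k ⟩
  _ ≡⟨ solve⟦q⟧ 2 (λ g a → g ⊠ (con⟦q⟧ (-ᶻ + 24) ⊠ a) ⊜ con⟦q⟧ (-ᶻ + 24) ⊠ (a ⊠ g)) (λ {_} → ℤ⟦q⟧.refl)
         (partialProduct N) (σ-truncated 1 N) k ⟩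
  _ ≡⟨ ·-const (-ᶻ + 24) (σ-truncated 1 N · partialProduct N) k ⟩
  _ ≡⟨ cong (-ᶻ + 24 *ᶻ_) (·-cong≤ k {σ-truncated 1 N} {A} {partialProduct N} {partialProduct N}
         (λ i i≤k → σ-truncated-≡ 1 (ℕ.≤-trans i≤k k≤N)) (λ _ _ → refl)) ⟩
  _ ∎
  where open ≡-Reasoning

-- A has no constant term, so the recurrence refers to strictly earlier coefficients only and
-- determines its solution.
A-·-cong< : ∀ n {f g} → (∀ i → i < n → f i ≡ g i) → (A · f) n ≡ (A · g) n
A-·-cong< zero {f} {g} eq = begin
  _ ≡⟨ ·-zero A f ⟩
  _ ≡⟨ cong (_*ᶻ f 0) A0≡0 ⟩
  _ ≡⟨ cong (_*ᶻ g 0) A0≡0 ⟨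
  _ ≡⟨ ·-zero A g ⟨
  _ ∎
  where open ≡-Reasoning
A-·-cong< (suc n) {f} {g} eq = begin
  _ ≡⟨ ·-suc A f n ⟩
  _ ≡⟨ cong₂ (λ a t → a *ᶻ f (suc n) +ᶻ t) A0≡0 (·-cong≤ n {tail A} {tail A} {f} {g} (λ _ _ → refl) (λ i i≤n → eq i (s≤s i≤n))) ⟩
  _ ≡⟨ cong (λ a → a *ᶻ g (suc n) +ᶻ (tail A · g) n) A0≡0 ⟨
  _ ≡⟨ ·-suc A g n ⟨
  _ ∎
  where open ≡-Reasoning

X-partialProduct : ∀ N k → k ≤ N → + 1728 *ᶻ partialProduct N k ≡ X (suc k)
X-partialProduct N = <-rec _ step
  where
  open ≡-Reasoning
  step : ∀ k → (∀ {i} → i < k → i ≤ N → + 1728 *ᶻ partialProduct N i ≡ X (suc i)) →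
         k ≤ N → + 1728 *ᶻ partialProduct N k ≡ X (suc k)
  step zero    ih k≤N = trans (cong (+ 1728 *ᶻ_) (partialProduct-constant N)) (sym X1≡1728)
  step (suc k) ih k≤N = ℤ.*-cancelˡ-≡ (+ suc k) _ _ (begin
    + suc k *ᶻ (+ 1728 *ᶻ G (suc k))
      ≡⟨ solve 2 (λ k g → k :* (con (+ 1728) :* g) := con (+ 1728) :* (k :* g)) refl (+ suc k) (G (suc k)) ⟩
    + 1728 *ᶻ (+ suc k *ᶻ G (suc k))
      ≡⟨ cong (+ 1728 *ᶻ_) (partialProduct-recurrence N (suc k) k≤N) ⟩
    + 1728 *ᶻ (-ᶻ + 24 *ᶻ (A · G) (suc k))
      ≡⟨ solve 1 (λ t → con (+ 1728) :* (con (-ᶻ + 24) :* t) := con (-ᶻ + 24) :* (con (+ 1728) :* t)) refl ((A · G) (suc k)) ⟩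
    -ᶻ + 24 *ᶻ (+ 1728 *ᶻ (A · G) (suc k))
      ≡⟨ cong (-ᶻ + 24 *ᶻ_) (begin
           _ ≡⟨ ·-const (+ 1728) (A · G) (suc k) ⟨
           _ ≡⟨ solve⟦q⟧ 3 (λ c a g → c ⊠ (a ⊠ g) ⊜ a ⊠ (c ⊠ g)) (λ {_} → ℤ⟦q⟧.refl) (const (+ 1728)) A G (suc k) ⟩
           _ ≡⟨ A-·-cong< (suc k) (λ i i<k → trans (·-const (+ 1728) G i) (ih i<k (ℕ.≤-trans (ℕ.<⇒≤ i<k) k≤N))) ⟩
           (A · tail X) (suc k) ∎) ⟩
    -ᶻ + 24 *ᶻ (A · tail X) (suc k)
      ≡⟨ X-recurrence (suc k) ⟨
    + suc k *ᶻ X (suc (suc k)) ∎)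
    where G = partialProduct N

Δ-partialProduct : ∀ n → Δ (suc n) ≡ partialProduct (suc n) n
Δ-partialProduct n = trans (τ-· (suc n)) (trans (q^-·-suc 0 (partialProduct (suc n)) n) (q^-·-+ 0 (partialProduct (suc n)) n))

1728Δ≗X : ∀ n → + 1728 *ᶻ Δ n ≡ X n
1728Δ≗X zero    = sym X0≡0
1728Δ≗X (suc n) = trans (cong (+ 1728 *ᶻ_) (Δ-partialProduct n)) (X-partialProduct (suc n) n (ℕ.n≤1+n n))

-- Congruences for τ

mod-^ : ∀ {m x y} → x ≡ y [mod m ] → ∀ j → x ^ᶻ j ≡ y ^ᶻ j [mod m ]
mod-^ {m} {x} {y} h zero    = mod-reflexive {m} {1ℤ} refl
mod-^ {m} {x} {y} h (suc j) = mod-* {m} {x} {y} {x ^ᶻ j} {y ^ᶻ j} h (mod-^ {m} {x} {y} h j)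

mod-% : ∀ m d .{{_ : NonZero m}} → + d ≡ + (d % m) [mod m ]
mod-% m d = divides (+ (d / m)) (begin
  + d -ᶻ + (d % m)                               ≡⟨ cong (λ e → + e -ᶻ + (d % m)) (m≡m%n+[m/n]*n d m) ⟩
  + (d % m + d / m * m) -ᶻ + (d % m)             ≡⟨ cong (_-ᶻ + (d % m)) (cong (+ (d % m) +ᶻ_) (ℤ.pos-* (d / m) m)) ⟩
  + (d % m) +ᶻ + (d / m) *ᶻ + m -ᶻ + (d % m)     ≡⟨ solve 2 (λ r k → r :+ k :- r := k) refl (+ (d % m)) (+ (d / m) *ᶻ + m) ⟩
  + (d / m) *ᶻ + m                               ∎)
  where open ≡-Reasoning

module _ (w x y z : ℤ) where

  odd-septic : ℤ → ℤ
  odd-septic d = w *ᶻ d ^ᶻ 7 +ᶻ x *ᶻ d ^ᶻ 5 +ᶻ y *ᶻ d ^ᶻ 3 +ᶻ z *ᶻ d ^ᶻ 1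

  odd-septic-cong : ∀ {m c d} → c ≡ d [mod m ] → odd-septic c ≡ odd-septic d [mod m ]
  odd-septic-cong {m} {c} {d} h =
    add {w *ᶻ c ^ᶻ 7 +ᶻ x *ᶻ c ^ᶻ 5 +ᶻ y *ᶻ c ^ᶻ 3} {w *ᶻ d ^ᶻ 7 +ᶻ x *ᶻ d ^ᶻ 5 +ᶻ y *ᶻ d ^ᶻ 3} 1 z
      (add {w *ᶻ c ^ᶻ 7 +ᶻ x *ᶻ c ^ᶻ 5} {w *ᶻ d ^ᶻ 7 +ᶻ x *ᶻ d ^ᶻ 5} 3 y
        (add {w *ᶻ c ^ᶻ 7} {w *ᶻ d ^ᶻ 7} 5 x (term 7 w)))
    where
    term : ∀ j v → v *ᶻ c ^ᶻ j ≡ v *ᶻ d ^ᶻ j [mod m ]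
    term j v = mod-* {m} {v} {v} {c ^ᶻ j} {d ^ᶻ j} (mod-reflexive {m} {v} refl) (mod-^ {m} {c} {d} h j)
    add : ∀ {s t} j v → s ≡ t [mod m ] → s +ᶻ v *ᶻ c ^ᶻ j ≡ t +ᶻ v *ᶻ d ^ᶻ j [mod m ]
    add {s} {t} j v h′ = mod-+ {m} {s} {t} {v *ᶻ c ^ᶻ j} {v *ᶻ d ^ᶻ j} h′ (term j v)

  -- The value modulo `m` depends on the residue of d alone; the finitely many residues are checked
  -- by evaluation during type checking.
  ∣-residues : ∀ m .{{_ : NonZero m}} → True (all? {m} (λ r → + m ∣ᶻ? odd-septic (+ toℕ r))) →
               ∀ d → + m ∣ᶻ odd-septic (+ d)
  ∣-residues m check d = subst (+ m ∣ᶻ_)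
    (solve 2 (λ u v → u :- v :+ v := u) refl (odd-septic (+ d)) (odd-septic (+ (d % m))))
    (∣m∣n⇒∣m+n (odd-septic-cong {m} {+ d} {+ (d % m)} (mod-% m d))
      (subst (λ r → + m ∣ᶻ odd-septic (+ r)) (toℕ-fromℕ< (m%n<n d m)) (toWitness check (fromℕ< (m%n<n d m)))))

  ∣-∑ : ∀ {m} n {f : ℕ → ℤ} → (∀ i → m ∣ᶻ f i) → m ∣ᶻ ∑< n f
  ∣-∑ {m} zero        h = subst (m ∣ᶻ_) (sym (∑-nil _)) (divides 0ℤ (sym (ℤ.*-zeroˡ m)))
  ∣-∑ {m} (suc n) {f} h = subst (m ∣ᶻ_) (sym (∑-head n f)) (∣m∣n⇒∣m+n (h 0) (∣-∑ n (h ∘ suc)))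

  ∣-divisor-sums : ∀ {m} → (∀ d → m ∣ᶻ odd-septic (+ d)) → ∀ n →
                   m ∣ᶻ w *ᶻ D n +ᶻ x *ᶻ C n +ᶻ y *ᶻ B n +ᶻ z *ᶻ A n
  ∣-divisor-sums {m} h n = subst (m ∣ᶻ_) (∑-terms n w x y z) (∣-∑ n (λ i → ∣m⇒∣m*n (L (suc i) n) (h (suc i))))

3∣d³-d : ∀ d → + 3 ∣ᶻ odd-septic 0ℤ 0ℤ 1ℤ (-ᶻ 1ℤ) (+ d)
3∣d³-d = ∣-residues 0ℤ 0ℤ 1ℤ (-ᶻ 1ℤ) 3 _

5∣d⁵-d : ∀ d → + 5 ∣ᶻ odd-septic 0ℤ 1ℤ 0ℤ (-ᶻ 1ℤ) (+ d)
5∣d⁵-d = ∣-residues 0ℤ 1ℤ 0ℤ (-ᶻ 1ℤ) 5 _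

7∣d⁷-d : ∀ d → + 7 ∣ᶻ odd-septic 1ℤ 0ℤ 0ℤ (-ᶻ 1ℤ) (+ d)
7∣d⁷-d = ∣-residues 1ℤ 0ℤ 0ℤ (-ᶻ 1ℤ) 7 _

-- d⁷ + 70 d⁵ + 49 d³ - 120 d comes from 10 (12Δ - 12A) when 120 B² is replaced
-- by D - B; the remaining terms except B³ have coefficients divisible by 9.
9∣septic : ∀ d → + 9 ∣ᶻ odd-septic 1ℤ (+ 70) (+ 49) (-ᶻ + 120) (+ d)
9∣septic = ∣-residues 1ℤ (+ 70) (+ 49) (-ᶻ + 120) 9 _

-- Every coefficient in the expansion of Q³ - R² in B and C is a multiple of 144, so this much can
-- be cancelled over ℤ.
12Δ : ∀ n → + 12 *ᶻ Δ n ≡ + 5 *ᶻ B n +ᶻ + 1200 *ᶻ (B · B) n +ᶻ + 96000 *ᶻ (B · (B · B)) n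
                          +ᶻ + 7 *ᶻ C n -ᶻ + 1764 *ᶻ (C · C) n
12Δ n = ℤ.*-cancelˡ-≡ (+ 144) _ _ (begin
  + 144 *ᶻ (+ 12 *ᶻ Δ n)
    ≡⟨ ℤ.*-assoc (+ 144) (+ 12) (Δ n) ⟨
  + 1728 *ᶻ Δ n
    ≡⟨ 1728Δ≗X n ⟩
  X n
    ≡⟨ solve⟦q⟧ 2 (λ b c → let q = con⟦q⟧ 1ℤ ⊞ con⟦q⟧ (+ 240) ⊠ b; r = con⟦q⟧ 1ℤ ⊞ con⟦q⟧ (-ᶻ + 504) ⊠ c in
         q ⊠ (q ⊠ q) ⊟ r ⊠ r ⊜
         con⟦q⟧ (+ 144) ⊠ (con⟦q⟧ (+ 5) ⊠ b ⊞ con⟦q⟧ (+ 1200) ⊠ (b ⊠ b) ⊞ con⟦q⟧ (+ 96000) ⊠ (b ⊠ (b ⊠ b))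
           ⊞ con⟦q⟧ (+ 7) ⊠ c ⊟ con⟦q⟧ (+ 1764) ⊠ (c ⊠ c))) (λ {_} → ℤ⟦q⟧.refl) B C n ⟩
  _ ≡⟨ ·-const (+ 144) _ n ⟩
  _ ≡⟨ cong (+ 144 *ᶻ_) (cong₂ _-ᶻ_ (cong₂ _+ᶻ_ (cong₂ _+ᶻ_ (cong₂ _+ᶻ_ (·-const (+ 5) B n) (·-const (+ 1200) (B · B) n))
         (·-const (+ 96000) (B · (B · B)) n)) (·-const (+ 7) C n)) (·-const (+ 1764) (C · C) n)) ⟩
  _ ∎)
  where open ≡-Reasoning

-- In the eliminations below, the solver writes the goal as a multiple of the modulus, or another
-- target, plus a combination of differences of the two sides of the hypotheses; this sets those
-- differences to zero.
residual : ∀ {x y : ℤ} → x ≡ y → x -ᶻ y ≡ 0ℤ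
residual {x} refl = ℤ.+-inverseʳ x

-- The multipliers cancel aa, since 3 · 1764 = 441 · 12, and leave a multiple
-- of 5 beside t - na.
mod5-elimination : ∀ t na a b w aa u v →
  + 12 *ᶻ t ≡ + 5 *ᶻ w +ᶻ + 7 *ᶻ (a +ᶻ + 5 *ᶻ u) -ᶻ + 1764 *ᶻ (aa +ᶻ + 5 *ᶻ v) →
  + 12 *ᶻ aa ≡ + 5 *ᶻ b +ᶻ a -ᶻ + 6 *ᶻ na →
  + 5 ∣ᶻ t -ᶻ na
mod5-elimination t na a b w aa u v eq₁ eq₂ = divides K (begin
  t -ᶻ na
    ≡⟨ solve 8 (λ t na a b w aa u v →
         t :- na :=
         (con (-ᶻ + 7) :* t :+ con (+ 529) :* na :+ con (+ 3) :* w :- con (+ 84) :* a :+ con (+ 21) :* u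
           :- con (+ 5292) :* v :- con (+ 441) :* b) :* con (+ 5)
         :+ con (+ 3) :* (con (+ 12) :* t :- (con (+ 5) :* w :+ con (+ 7) :* (a :+ con (+ 5) :* u)
                                             :- con (+ 1764) :* (aa :+ con (+ 5) :* v)))
         :- con (+ 441) :* (con (+ 12) :* aa :- (con (+ 5) :* b :+ a :- con (+ 6) :* na)))
         refl t na a b w aa u v ⟩
  K *ᶻ + 5 +ᶻ + 3 *ᶻ _ -ᶻ + 441 *ᶻ _
    ≡⟨ cong₂ (λ x y → K *ᶻ + 5 +ᶻ + 3 *ᶻ x -ᶻ + 441 *ᶻ y) (residual eq₁) (residual eq₂) ⟩
  K *ᶻ + 5 +ᶻ 0ℤ -ᶻ 0ℤ
    ≡⟨ solve 1 (λ k → k :+ con 0ℤ :- con 0ℤ := k) refl (K *ᶻ + 5) ⟩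
  K *ᶻ + 5 ∎)
  where
  open ≡-Reasoning
  K = -ᶻ + 7 *ᶻ t +ᶻ + 529 *ᶻ na +ᶻ + 3 *ᶻ w -ᶻ + 84 *ᶻ a +ᶻ + 21 *ᶻ u -ᶻ + 5292 *ᶻ v -ᶻ + 441 *ᶻ b

-- The terms in B have coefficients divisible by 5, and d⁵ ≡ d gives σ₅ ≡ σ₁. So 2 Δ ≡ 2 A - 4 A²,
-- where 2 A² ≡ A - θA.
τ-mod5 : ∀ n → + 5 ∣ᶻ Δ n -ᶻ + n *ᶻ A n
τ-mod5 n = mod5-elimination (Δ n) (+ n *ᶻ A n) (A n) (B n) w ((A · A) n) (U n) V (begin
  + 12 *ᶻ Δ n
    ≡⟨ 12Δ n ⟩
  _ ≡⟨ solve 5 (λ b bb bbb c cc → con (+ 5) :* b :+ con (+ 1200) :* bb :+ con (+ 96000) :* bbb :+ con (+ 7) :* c :- con (+ 1764) :* cc :=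
         con (+ 5) :* (b :+ con (+ 240) :* bb :+ con (+ 19200) :* bbb) :+ con (+ 7) :* c :- con (+ 1764) :* cc) refl
         (B n) ((B · B) n) ((B · (B · B)) n) (C n) ((C · C) n) ⟩
  + 5 *ᶻ w +ᶻ + 7 *ᶻ C n -ᶻ + 1764 *ᶻ (C · C) n
    ≡⟨ cong₂ (λ x y → + 5 *ᶻ w +ᶻ + 7 *ᶻ x -ᶻ + 1764 *ᶻ y) (C≡ n) C·C ⟩
  _ ∎) (A·A n)
  where
  open ≡-Reasoning
  w = B n +ᶻ + 240 *ᶻ (B · B) n +ᶻ + 19200 *ᶻ (B · (B · B)) n
  C-A : ∀ n → + 5 ∣ᶻ 0ℤ *ᶻ D n +ᶻ 1ℤ *ᶻ C n +ᶻ 0ℤ *ᶻ B n +ᶻ -ᶻ 1ℤ *ᶻ A n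
  C-A = ∣-divisor-sums 0ℤ 1ℤ 0ℤ (-ᶻ 1ℤ) 5∣d⁵-d
  U : Series
  U n = quotient (C-A n)
  C≡ : ∀ n → C n ≡ A n +ᶻ + 5 *ᶻ U n
  C≡ n = trans (solve 4 (λ a b c d → c := a :+ (con 0ℤ :* d :+ con 1ℤ :* c :+ con 0ℤ :* b :+ :- con 1ℤ :* a)) refl
                 (A n) (B n) (C n) (D n))
               (cong (A n +ᶻ_) (trans (_∣ᶻ_.equality (C-A n)) (ℤ.*-comm (U n) (+ 5))))
  C≗ : C ≗ A ⊕ const (+ 5) · U
  C≗ n = trans (C≡ n) (cong (A n +ᶻ_) (sym (·-const (+ 5) U n)))
  V = (const (+ 2) · (A · U) ⊕ const (+ 5) · (U · U)) n
  C·C : (C · C) n ≡ (A · A) n +ᶻ + 5 *ᶻ V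
  C·C = trans (·-cong C≗ C≗ n) (trans (solve⟦q⟧ 2 (λ a u → let c = a ⊞ con⟦q⟧ (+ 5) ⊠ u in
      c ⊠ c ⊜ a ⊠ a ⊞ con⟦q⟧ (+ 5) ⊠ (con⟦q⟧ (+ 2) ⊠ (a ⊠ u) ⊞ con⟦q⟧ (+ 5) ⊠ (u ⊠ u))) (λ {_} → ℤ⟦q⟧.refl) A U n)
    (cong ((A · A) n +ᶻ_) (·-const (+ 5) (const (+ 2) · (A · U) ⊕ const (+ 5) · (U · U)) n)))

B·B≗ : const (+ 120) · (B · B) ≗ D ⊕ ⊖ B
B·B≗ n = trans (·-const (+ 120) (B · B) n) (B·B n)

B·B·B : ∀ n → + 120 *ᶻ (B · (B · B)) n ≡ (B · D) n -ᶻ (B · B) n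
B·B·B n = begin
  _ ≡⟨ ·-const (+ 120) (B · (B · B)) n ⟨
  _ ≡⟨ solve⟦q⟧ 2 (λ b x → con⟦q⟧ (+ 120) ⊠ (b ⊠ x) ⊜ b ⊠ (con⟦q⟧ (+ 120) ⊠ x)) (λ {_} → ℤ⟦q⟧.refl) B (B · B) n ⟩
  _ ≡⟨ ·-congˡ B B·B≗ n ⟩
  _ ≡⟨ solve⟦q⟧ 2 (λ b d → b ⊠ (d ⊟ b) ⊜ b ⊠ d ⊟ b ⊠ b) (λ {_} → ℤ⟦q⟧.refl) B D n ⟩
  _ ∎
  where open ≡-Reasoning

-- The multipliers 3, 10, 10 cancel both products, by 3 · 800 = 10 · 240 and 3 · (1200 - 800) = 10 ·
-- 120; they also cancel `a`.
mod7-elimination : ∀ t nb a b c w ab bb u v →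
  + 12 *ᶻ t ≡ + 5 *ᶻ b +ᶻ + 1200 *ᶻ bb +ᶻ + 800 *ᶻ (ab +ᶻ + 7 *ᶻ v -ᶻ bb) +ᶻ + 7 *ᶻ w →
  + 240 *ᶻ ab ≡ + 21 *ᶻ c +ᶻ + 10 *ᶻ b -ᶻ a -ᶻ + 30 *ᶻ nb →
  + 120 *ᶻ bb ≡ a +ᶻ + 7 *ᶻ u -ᶻ b →
  + 7 ∣ᶻ t -ᶻ nb
mod7-elimination t nb a b c w ab bb u v eq₁ eq₂ eq₃ = divides K (begin
  t -ᶻ nb
    ≡⟨ solve 10 (λ t nb a b c w ab bb u v →
         t :- nb :=
         (con (+ 15) :* b :+ con (+ 30) :* c :+ con (+ 10) :* u :+ con (+ 2400) :* v :+ con (+ 3) :* w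
           :- con (+ 5) :* t :- con (+ 43) :* nb) :* con (+ 7)
         :+ con (+ 3) :* (con (+ 12) :* t :- (con (+ 5) :* b :+ con (+ 1200) :* bb
                                             :+ con (+ 800) :* (ab :+ con (+ 7) :* v :- bb) :+ con (+ 7) :* w))
         :+ con (+ 10) :* (con (+ 240) :* ab :- (con (+ 21) :* c :+ con (+ 10) :* b :- a :- con (+ 30) :* nb))
         :+ con (+ 10) :* (con (+ 120) :* bb :- (a :+ con (+ 7) :* u :- b)))
         refl t nb a b c w ab bb u v ⟩
  K *ᶻ + 7 +ᶻ + 3 *ᶻ _ +ᶻ + 10 *ᶻ _ +ᶻ + 10 *ᶻ _
    ≡⟨ cong₂ (λ e z → e +ᶻ + 10 *ᶻ z) (cong₂ (λ x y → K *ᶻ + 7 +ᶻ + 3 *ᶻ x +ᶻ + 10 *ᶻ y) (residual eq₁) (residual eq₂)) (residual eq₃) ⟩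
  K *ᶻ + 7 +ᶻ 0ℤ +ᶻ 0ℤ +ᶻ 0ℤ
    ≡⟨ solve 1 (λ k → k :+ con 0ℤ :+ con 0ℤ :+ con 0ℤ := k) refl (K *ᶻ + 7) ⟩
  K *ᶻ + 7 ∎)
  where
  open ≡-Reasoning
  K = + 15 *ᶻ b +ᶻ + 30 *ᶻ c +ᶻ + 10 *ᶻ u +ᶻ + 2400 *ᶻ v +ᶻ + 3 *ᶻ w -ᶻ + 5 *ᶻ t -ᶻ + 43 *ᶻ nb

-- The terms in C are multiples of 7. For the cube, 96000 = 800 · 120 and 120 B³ = B D - B², where
-- d⁷ ≡ d gives D ≡ A; the formulas for A B and B² finish the reduction.
τ-mod7 : ∀ n → + 7 ∣ᶻ Δ n -ᶻ + n *ᶻ B n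
τ-mod7 n = mod7-elimination (Δ n) (+ n *ᶻ B n) (A n) (B n) (C n) w ((A · B) n) ((B · B) n) (U n) ((B · U) n) (begin
  + 12 *ᶻ Δ n
    ≡⟨ 12Δ n ⟩
  _ ≡⟨ solve 5 (λ b bb bbb c cc → con (+ 5) :* b :+ con (+ 1200) :* bb :+ con (+ 96000) :* bbb :+ con (+ 7) :* c :- con (+ 1764) :* cc :=
         con (+ 5) :* b :+ con (+ 1200) :* bb :+ con (+ 800) :* (con (+ 120) :* bbb) :+ con (+ 7) :* (c :- con (+ 252) :* cc)) refl
         (B n) ((B · B) n) ((B · (B · B)) n) (C n) ((C · C) n) ⟩
  + 5 *ᶻ B n +ᶻ + 1200 *ᶻ (B · B) n +ᶻ + 800 *ᶻ (+ 120 *ᶻ (B · (B · B)) n) +ᶻ + 7 *ᶻ w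
    ≡⟨ cong (λ x → + 5 *ᶻ B n +ᶻ + 1200 *ᶻ (B · B) n +ᶻ + 800 *ᶻ x +ᶻ + 7 *ᶻ w)
         (trans (B·B·B n) (cong (_-ᶻ (B · B) n) B·D)) ⟩
  _ ∎) (A·B n) (trans (B·B n) (cong (_-ᶻ B n) (D≡ n)))
  where
  open ≡-Reasoning
  w = C n -ᶻ + 252 *ᶻ (C · C) n
  D-A : ∀ n → + 7 ∣ᶻ 1ℤ *ᶻ D n +ᶻ 0ℤ *ᶻ C n +ᶻ 0ℤ *ᶻ B n +ᶻ -ᶻ 1ℤ *ᶻ A n
  D-A = ∣-divisor-sums 1ℤ 0ℤ 0ℤ (-ᶻ 1ℤ) 7∣d⁷-d
  U : Series
  U n = quotient (D-A n)
  D≡ : ∀ n → D n ≡ A n +ᶻ + 7 *ᶻ U n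
  D≡ n = trans (solve 4 (λ a b c d → d := a :+ (con 1ℤ :* d :+ con 0ℤ :* c :+ con 0ℤ :* b :+ :- con 1ℤ :* a)) refl
                 (A n) (B n) (C n) (D n))
               (cong (A n +ᶻ_) (trans (_∣ᶻ_.equality (D-A n)) (ℤ.*-comm (U n) (+ 7))))
  D≗ : D ≗ A ⊕ const (+ 7) · U
  D≗ n = trans (D≡ n) (cong (A n +ᶻ_) (sym (·-const (+ 7) U n)))
  B·D : (B · D) n ≡ (A · B) n +ᶻ + 7 *ᶻ (B · U) n
  B·D = trans (·-congˡ B D≗ n) (trans (solve⟦q⟧ 3 (λ a b u → b ⊠ (a ⊞ con⟦q⟧ (+ 7) ⊠ u) ⊜ a ⊠ b ⊞ con⟦q⟧ (+ 7) ⊠ (b ⊠ u))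
      (λ {_} → ℤ⟦q⟧.refl) A B U n)
    (cong ((A · B) n +ᶻ_) (·-const (+ 7) (B · U) n)))

-- Ten times the equation for 12 Δ, minus 120 A. Splitting 12000 = 120 + 9 · 1320 leaves exactly one
-- 120 B² to trade for D - B, and 17640 = 9 · 1960; then one factor 3 can be cancelled.
mod9-elimination : ∀ t a b c d bb g cc v →
  + 12 *ᶻ t ≡ + 5 *ᶻ b +ᶻ + 1200 *ᶻ bb +ᶻ + 3 *ᶻ g +ᶻ + 7 *ᶻ c -ᶻ + 1764 *ᶻ cc →
  + 120 *ᶻ bb ≡ d -ᶻ b →
  1ℤ *ᶻ d +ᶻ + 70 *ᶻ c +ᶻ + 49 *ᶻ b +ᶻ -ᶻ + 120 *ᶻ a ≡ v *ᶻ + 9 →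
  + 40 *ᶻ (t -ᶻ a) ≡ + 10 *ᶻ g +ᶻ + 3 *ᶻ (v +ᶻ + 1320 *ᶻ bb -ᶻ + 1960 *ᶻ cc)
mod9-elimination t a b c d bb g cc v eq₁ eq₂ eq₃ = ℤ.*-cancelˡ-≡ (+ 3) _ _ (begin
  + 3 *ᶻ (+ 40 *ᶻ (t -ᶻ a))
    ≡⟨ solve 9 (λ t a b c d bb g cc v →
         con (+ 3) :* (con (+ 40) :* (t :- a)) :=
         con (+ 3) :* (con (+ 10) :* g :+ con (+ 3) :* (v :+ con (+ 1320) :* bb :- con (+ 1960) :* cc))
         :+ con (+ 10) :* (con (+ 12) :* t :- (con (+ 5) :* b :+ con (+ 1200) :* bb :+ con (+ 3) :* g
              :+ con (+ 7) :* c :- con (+ 1764) :* cc))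
         :+ (con (+ 120) :* bb :- (d :- b))
         :+ (con 1ℤ :* d :+ con (+ 70) :* c :+ con (+ 49) :* b :+ con (-ᶻ + 120) :* a :- v :* con (+ 9)))
         refl t a b c d bb g cc v ⟩
  K +ᶻ + 10 *ᶻ _ +ᶻ _ +ᶻ _
    ≡⟨ cong₂ _+ᶻ_ (cong₂ (λ x y → K +ᶻ + 10 *ᶻ x +ᶻ y) (residual eq₁) (residual eq₂)) (residual eq₃) ⟩
  K +ᶻ 0ℤ +ᶻ 0ℤ +ᶻ 0ℤ
    ≡⟨ solve 1 (λ k → k :+ con 0ℤ :+ con 0ℤ :+ con 0ℤ := k) refl K ⟩
  K ∎)
  where
  open ≡-Reasoning
  K = + 3 *ᶻ (+ 10 *ᶻ g +ᶻ + 3 *ᶻ (v +ᶻ + 1320 *ᶻ bb -ᶻ + 1960 *ᶻ cc))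

-- As 40 ≡ 1 modulo 3, the coefficient of `y` is harmless; multiplying by `n` makes the one
-- remaining term, in `b`, divisible by 3.
mod3-elimination : ∀ n y k b s u → + 40 *ᶻ y ≡ + 10 *ᶻ (k *ᶻ b) +ᶻ + 3 *ᶻ s → n *ᶻ b ≡ + 3 *ᶻ u → + 3 ∣ᶻ n *ᶻ y
mod3-elimination n y k b s u eq₁ eq₂ = divides (+ 10 *ᶻ k *ᶻ u +ᶻ n *ᶻ s -ᶻ + 13 *ᶻ (n *ᶻ y)) (begin
  n *ᶻ y
    ≡⟨ solve 2 (λ n y → n :* y := n :* (con (+ 40) :* y) :- con (+ 39) :* (n :* y)) refl n y ⟩
  n *ᶻ (+ 40 *ᶻ y) -ᶻ + 39 *ᶻ (n *ᶻ y)
    ≡⟨ cong (λ e → n *ᶻ e -ᶻ + 39 *ᶻ (n *ᶻ y)) eq₁ ⟩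
  n *ᶻ (+ 10 *ᶻ (k *ᶻ b) +ᶻ + 3 *ᶻ s) -ᶻ + 39 *ᶻ (n *ᶻ y)
    ≡⟨ solve 5 (λ n k b s y → n :* (con (+ 10) :* (k :* b) :+ con (+ 3) :* s) :- con (+ 39) :* (n :* y) :=
         con (+ 10) :* k :* (n :* b) :+ con (+ 3) :* (n :* s) :- con (+ 39) :* (n :* y)) refl n k b s y ⟩
  + 10 *ᶻ k *ᶻ (n *ᶻ b) +ᶻ + 3 *ᶻ (n *ᶻ s) -ᶻ + 39 *ᶻ (n *ᶻ y)
    ≡⟨ cong (λ e → + 10 *ᶻ k *ᶻ e +ᶻ + 3 *ᶻ (n *ᶻ s) -ᶻ + 39 *ᶻ (n *ᶻ y)) eq₂ ⟩
  + 10 *ᶻ k *ᶻ (+ 3 *ᶻ u) +ᶻ + 3 *ᶻ (n *ᶻ s) -ᶻ + 39 *ᶻ (n *ᶻ y)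
    ≡⟨ solve 5 (λ n k u s y → con (+ 10) :* k :* (con (+ 3) :* u) :+ con (+ 3) :* (n :* s) :- con (+ 39) :* (n :* y) :=
         (con (+ 10) :* k :* u :+ n :* s :- con (+ 13) :* (n :* y)) :* con (+ 3)) refl n k u s y ⟩
  (+ 10 *ᶻ k *ᶻ u +ᶻ n *ᶻ s -ᶻ + 13 *ᶻ (n *ᶻ y)) *ᶻ + 3 ∎)
  where open ≡-Reasoning

40⟨Δ-A⟩ : ∀ n v → 1ℤ *ᶻ D n +ᶻ + 70 *ᶻ C n +ᶻ + 49 *ᶻ B n +ᶻ -ᶻ + 120 *ᶻ A n ≡ v *ᶻ + 9 →
        + 40 *ᶻ (Δ n -ᶻ A n) ≡ + 10 *ᶻ (+ 32000 *ᶻ (B · (B · B)) n) +ᶻ + 3 *ᶻ (v +ᶻ + 1320 *ᶻ (B · B) n -ᶻ + 1960 *ᶻ (C · C) n)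
40⟨Δ-A⟩ n v = mod9-elimination (Δ n) (A n) (B n) (C n) (D n) ((B · B) n) (+ 32000 *ᶻ (B · (B · B)) n) ((C · C) n) v
  (trans (12Δ n) (cong (λ e → + 5 *ᶻ B n +ᶻ + 1200 *ᶻ (B · B) n +ᶻ e +ᶻ + 7 *ᶻ C n -ᶻ + 1764 *ᶻ (C · C) n)
    (ℤ.*-assoc (+ 3) (+ 32000) ((B · (B · B)) n)))) (B·B n)

-- The cube of B disappears because its image under θ is divisible by 3.
3∣n⟨Δ-A⟩ : ∀ n → + 3 ∣ᶻ + n *ᶻ (Δ n -ᶻ A n)
3∣n⟨Δ-A⟩ n = mod3-elimination (+ n) (Δ n -ᶻ A n) (+ 32000) ((B · (B · B)) n) _ ((B · B · θ B) n)
  (40⟨Δ-A⟩ n (quotient 9∣) (_∣ᶻ_.equality 9∣)) θ-cube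
  where
  open ≡-Reasoning
  9∣ : + 9 ∣ᶻ 1ℤ *ᶻ D n +ᶻ + 70 *ᶻ C n +ᶻ + 49 *ᶻ B n +ᶻ -ᶻ + 120 *ᶻ A n
  9∣ = ∣-divisor-sums 1ℤ (+ 70) (+ 49) (-ᶻ + 120) 9∣septic n
  θ-cube : + n *ᶻ (B · (B · B)) n ≡ + 3 *ᶻ (B · B · θ B) n
  θ-cube = begin
    _ ≡⟨ θ-· B (B · B) n ⟩
    _ ≡⟨ cong ((θ B · (B · B)) n +ᶻ_) (·-congˡ B (θ-· B B) n) ⟩
    _ ≡⟨ solve⟦q⟧ 2 (λ b b′ → b′ ⊠ (b ⊠ b) ⊞ b ⊠ (b′ ⊠ b ⊞ b ⊠ b′) ⊜ con⟦q⟧ (+ 3) ⊠ (b ⊠ b ⊠ b′))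
           (λ {_} → ℤ⟦q⟧.refl) B (θ B) n ⟩
    _ ≡⟨ ·-const (+ 3) (B · B · θ B) n ⟩
    _ ∎

-- The equation n ≡ suc m keeps Δ n from unfolding to its defining product.
Δ-recurrence : ∀ n m → n ≡ suc m → + m *ᶻ Δ n ≡ -ᶻ + 24 *ᶻ (A · partialProduct n) m
Δ-recurrence n m refl = trans (cong (+ m *ᶻ_) (Δ-partialProduct m)) (partialProduct-recurrence (suc m) m (ℕ.n≤1+n m))

-- With n = 1 + m: the factor 24 gives m t ≡ 0, that is n t ≡ t, so n (t - a) ≡ 0 becomes t ≡ n a.
mod3-shift : ∀ m t a s → m *ᶻ t ≡ -ᶻ + 24 *ᶻ s → + 3 ∣ᶻ (1ℤ +ᶻ m) *ᶻ (t -ᶻ a) → + 3 ∣ᶻ t -ᶻ (1ℤ +ᶻ m) *ᶻ a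
mod3-shift m t a s eq d = subst (+ 3 ∣ᶻ_)
  (solve 3 (λ m t a → (con 1ℤ :+ m) :* (t :- a) :+ con (-ᶻ 1ℤ) :* (m :* t) := t :- (con 1ℤ :+ m) :* a) refl m t a)
  (∣m∣n⇒∣m+n d (∣n⇒∣m*n (-ᶻ 1ℤ) (divides (-ᶻ + 8 *ᶻ s)
    (trans eq (solve 1 (λ s → con (-ᶻ + 24) :* s := con (-ᶻ + 8) :* s :* con (+ 3)) refl s)))))

τ-mod3 : ∀ n → 1 ≤ n → + 3 ∣ᶻ Δ n -ᶻ + n *ᶻ A n
τ-mod3 n 1≤n = subst (λ x → + 3 ∣ᶻ Δ n -ᶻ x *ᶻ A n) (cong +_ (sym n≡))
  (mod3-shift (+ m) (Δ n) (A n) ((A · partialProduct n) m) (Δ-recurrence n m n≡)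
    (subst (λ x → + 3 ∣ᶻ x *ᶻ (Δ n -ᶻ A n)) (cong +_ n≡) (3∣n⟨Δ-A⟩ n)))
  where
  m : ℕ
  m = n ∸ 1
  n≡ : n ≡ suc m
  n≡ = sym (ℕ.m+[n∸m]≡n 1≤n)

-- Sums over divisors modulo p

-- A record around x ≡ y [mod m ], so that x and y can be inferred.
record Congruent (m : ℕ) (x y : ℤ) : Set where
  constructor congruent
  field difference : + m ∣ᶻ x -ᶻ y
open Congruent

module _ {m : ℕ} where

  ≋-reflexive : ∀ {x y} → x ≡ y → Congruent m x y
  ≋-reflexive eq = congruent (mod-reflexive eq)

  ≋-sym : ∀ {x y} → Congruent m x y → Congruent m y x
  ≋-sym {x} {y} (congruent h) = congruent (mod-sym {m} {x} {y} h)

  ≋-trans : ∀ {x y z} → Congruent m x y → Congruent m y z → Congruent m x z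
  ≋-trans {x} {y} {z} (congruent h) (congruent k) = congruent (mod-trans {m} {x} {y} {z} h k)

  ≋-* : ∀ {x x′ y y′} → Congruent m x x′ → Congruent m y y′ → Congruent m (x *ᶻ y) (x′ *ᶻ y′)
  ≋-* {x} {x′} {y} {y′} (congruent h) (congruent k) = congruent (mod-* {m} {x} {x′} {y} {y′} h k)

  ≋-*ˡ : ∀ x {y y′} → Congruent m y y′ → Congruent m (x *ᶻ y) (x *ᶻ y′)
  ≋-*ˡ x h = ≋-* (≋-reflexive {x} refl) h

  ≋-*ʳ : ∀ y {x x′} → Congruent m x x′ → Congruent m (x *ᶻ y) (x′ *ᶻ y)
  ≋-*ʳ y h = ≋-* h (≋-reflexive {y} refl)

  ≋-^ : ∀ {x y} → Congruent m x y → ∀ j → Congruent m (x ^ᶻ j) (y ^ᶻ j)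
  ≋-^ {x} {y} (congruent h) j = congruent (mod-^ {m} {x} {y} h j)

  ≋-∑ : ∀ n {f g : ℕ → ℤ} → (∀ i → Congruent m (f i) (g i)) → Congruent m (∑< n f) (∑< n g)
  ≋-∑ zero    {f} {g} h = ≋-reflexive (trans (∑-nil f) (sym (∑-nil g)))
  ≋-∑ (suc n) {f} {g} h = subst₂ (Congruent m) (sym (∑-head n f)) (sym (∑-head n g))
    (congruent (mod-+ {m} {f 0} {g 0} {∑< n (f ∘ suc)} {∑< n (g ∘ suc)} (difference (h 0)) (difference (≋-∑ n (h ∘ suc)))))

  ∣⇒≋0 : ∀ {x} → + m ∣ᶻ x → Congruent m x 0ℤ
  ∣⇒≋0 {x} h = congruent (subst (+ m ∣ᶻ_) (sym (ℤ.+-identityʳ x)) h)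

module _ {m : ℕ} (q : ℕ) (fermat : ∀ d → Congruent m ((+ d) ^ᶻ suc q) ((+ d) ^ᶻ 1)) where

  -- Exponents stay positive and Fermat is used as d^(q+1) ≡ d, so multiples of the prime need no
  -- separate treatment.
  ^-period : ∀ d e j → Congruent m ((+ d) ^ᶻ (suc e + j * q)) ((+ d) ^ᶻ suc e)
  ^-period d e zero    = ≋-reflexive (cong ((+ d) ^ᶻ_) (ℕ.+-identityʳ (suc e)))
  ^-period d e (suc j) = ≋-trans (≋-reflexive split) (≋-trans (≋-*ˡ ((+ d) ^ᶻ (e + j * q)) (fermat d)) (≋-trans (≋-reflexive join) (^-period d e j)))
    where
    split : (+ d) ^ᶻ (suc e + suc j * q) ≡ (+ d) ^ᶻ (e + j * q) *ᶻ (+ d) ^ᶻ suc q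
    split = trans (cong ((+ d) ^ᶻ_) (begin
      suc e + (q + j * q)    ≡⟨ cong (λ s → suc (e + s)) (ℕ.+-comm q (j * q)) ⟩
      suc (e + (j * q + q))  ≡⟨ cong suc (ℕ.+-assoc e (j * q) q) ⟨
      suc (e + j * q + q)    ≡⟨ ℕ.+-suc (e + j * q) q ⟨
      e + j * q + suc q      ∎)) (ℤ.^-distribˡ-+-* (+ d) (e + j * q) (suc q))
      where open ≡-Reasoning
    join : (+ d) ^ᶻ (e + j * q) *ᶻ (+ d) ^ᶻ 1 ≡ (+ d) ^ᶻ (suc e + j * q)
    join = trans (sym (ℤ.^-distribˡ-+-* (+ d) (e + j * q) 1)) (cong ((+ d) ^ᶻ_) (ℕ.+-comm (e + j * q) 1))

  ^-exponent : ∀ d {e f} → + suc e ≡ + suc f [mod q ] → Congruent m ((+ d) ^ᶻ suc e) ((+ d) ^ᶻ suc f)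
  ^-exponent d {e} {f} (divides (+ j) eq) =
    ≋-trans (≋-reflexive (cong ((+ d) ^ᶻ_) (ℤ.+-injective exponent))) (^-period d f j)
    where
    exponent : + suc e ≡ + (suc f + j * q)
    exponent = begin
      + suc e                        ≡⟨ solve 2 (λ x y → x := y :+ (x :- y)) refl (+ suc e) (+ suc f) ⟩
      + suc f +ᶻ (+ suc e -ᶻ + suc f) ≡⟨ cong (+ suc f +ᶻ_) (trans eq (sym (ℤ.pos-* j q))) ⟩
      + suc f +ᶻ + (j * q)           ∎
      where open ≡-Reasoning
  -- A negative quotient means that `f` is the larger exponent, so the two exchange roles.
  ^-exponent d {e} {f} (divides -[1+ j ] eq) =
    ≋-sym (≋-trans (≋-reflexive (cong ((+ d) ^ᶻ_) (ℤ.+-injective exponent))) (^-period d e (suc j)))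
    where
    exponent : + suc f ≡ + (suc e + suc j * q)
    exponent = begin
      + suc f                              ≡⟨ solve 2 (λ x y → y := x :+ :- (x :- y)) refl (+ suc e) (+ suc f) ⟩
      + suc e +ᶻ -ᶻ (+ suc e -ᶻ + suc f)   ≡⟨ cong (λ z → + suc e +ᶻ -ᶻ z) eq ⟩
      + suc e +ᶻ -ᶻ (-[1+ j ] *ᶻ + q)      ≡⟨ cong (+ suc e +ᶻ_) (ℤ.neg-distribˡ-* -[1+ j ] (+ q)) ⟩
      + suc e +ᶻ + suc j *ᶻ + q            ≡⟨ cong (+ suc e +ᶻ_) (ℤ.pos-* (suc j) q) ⟨
      + suc e +ᶻ + (suc j * q)             ∎
      where open ≡-Reasoning

∑-single : ∀ n {f : ℕ → ℤ} j → j < n → (∀ i → i ≢ j → f i ≡ 0ℤ) → ∑< n f ≡ f j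
∑-single (suc n) {f} zero    _         other = trans (∑-head n f)
  (trans (cong (f 0 +ᶻ_) (∑-vanish n (λ i _ → other (suc i) (λ ())))) (ℤ.+-identityʳ (f 0)))
∑-single (suc n) {f} (suc j) (s≤s j<n) other = trans (∑-head n f)
  (trans (cong₂ _+ᶻ_ (other 0 (λ ())) (∑-single n j j<n (λ i i≢j → other (suc i) (i≢j ∘ ℕ.suc-injective)))) (ℤ.+-identityˡ (f (suc j))))

L-∣ : ∀ {n} → 1 ≤ n → ∀ a → a ∣ⁿ n → L a n ≡ 1ℤ
L-∣ {suc n} _ a d = cong 𝟙 (dec-true (a ∣? suc n) d)

L-∤ : ∀ {n} a → ¬ (a ∣ⁿ n) → L a n ≡ 0ℤ
L-∤ {zero}  a ¬d = refl
L-∤ {suc n} a ¬d = cong 𝟙 (dec-false (a ∣? suc n) ¬d)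

module _ {n : ℕ} (1≤n : 1 ≤ n) where

  private

    -- Indicator of the factorisation (i+1)(j+1) = n; its symmetry is the involution d ↦ n/d.
    δ : ℕ → ℕ → ℤ
    δ i j = 𝟙 (does (suc i * suc j ℕ.≟ n))

    δ-comm : ∀ i j → δ i j ≡ δ j i
    δ-comm i j = cong (λ m → 𝟙 (does (m ℕ.≟ n))) (ℕ.*-comm (suc i) (suc j))

    ∑-δ : ∀ (f : ℕ → ℤ) i → ∑< n (λ j → f (suc j) *ᶻ δ i j) ≡ f (n / suc i) *ᶻ L (suc i) n
    ∑-δ f i with suc i ∣? n
    ... | yes (dividesⁿ zero    eq) = contradiction eq (ℕ.m<n⇒n≢0 1≤n)
    ... | yes d@(dividesⁿ (suc q) eq) = trans (∑-single n q q<n off)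
          (cong₂ _*ᶻ_ (cong f (sym (trans (cong (_/ suc i) eq) (m*n/n≡m (suc q) (suc i)))))
                      (trans (cong 𝟙 (dec-true (suc i * suc q ℕ.≟ n) product)) (sym (L-∣ 1≤n (suc i) d))))
      where
      product : suc i * suc q ≡ n
      product = trans (ℕ.*-comm (suc i) (suc q)) (sym eq)
      q<n : q < n
      q<n = subst (suc q ≤_) (sym eq) (ℕ.m≤m*n (suc q) (suc i))
      off : ∀ j → j ≢ q → f (suc j) *ᶻ δ i j ≡ 0ℤ
      off j j≢q = trans (cong (λ b → f (suc j) *ᶻ 𝟙 b) (dec-false (suc i * suc j ℕ.≟ n)
        (λ e → j≢q (ℕ.suc-injective (ℕ.*-cancelˡ-≡ (suc j) (suc q) (suc i) (trans e (sym product)))))))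
        (ℤ.*-zeroʳ (f (suc j)))
    ... | no ¬d = trans (∑-vanish n (λ j _ → trans (cong (λ b → f (suc j) *ᶻ 𝟙 b)
            (dec-false (suc i * suc j ℕ.≟ n) (λ e → ¬d (dividesⁿ (suc j) (trans (sym e) (ℕ.*-comm (suc i) (suc j)))))))
            (ℤ.*-zeroʳ (f (suc j))))) (sym (trans (cong (f (n / suc i) *ᶻ_) (L-∤ (suc i) ¬d)) (ℤ.*-zeroʳ (f (n / suc i)))))

  divisor-reflection : ∀ (f : ℕ → ℤ) → ∑< n (λ i → f (n / suc i) *ᶻ L (suc i) n) ≡ ∑< n (λ i → f (suc i) *ᶻ L (suc i) n)
  divisor-reflection f = begin
    ∑< n (λ i → f (n / suc i) *ᶻ L (suc i) n)          ≡⟨ ∑-cong n (∑-δ f) ⟨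
    ∑< n (λ i → ∑< n (λ j → f (suc j) *ᶻ δ i j))       ≡⟨ ∑-swap n n _ ⟩
    ∑< n (λ j → ∑< n (λ i → f (suc j) *ᶻ δ i j))       ≡⟨ ∑-cong n (λ j → ∑-*ˡ n (f (suc j)) (λ i → δ i j)) ⟨
    ∑< n (λ j → f (suc j) *ᶻ ∑< n (λ i → δ i j))       ≡⟨ ∑-cong n (λ j → cong (f (suc j) *ᶻ_) (count j)) ⟩
    ∑< n (λ j → f (suc j) *ᶻ L (suc j) n)              ∎
    where
    open ≡-Reasoning
    count : ∀ j → ∑< n (λ i → δ i j) ≡ L (suc j) n
    count j = trans (∑-cong n (λ i → trans (δ-comm i j) (sym (ℤ.*-identityˡ (δ j i)))))
      (trans (∑-δ (λ _ → 1ℤ) j) (ℤ.*-identityˡ (L (suc j) n)))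

  cofactor : ∀ i → + (n / suc i) *ᶻ + suc i *ᶻ L (suc i) n ≡ + n *ᶻ L (suc i) n
  cofactor i with suc i ∣? n
  ... | yes d = cong (_*ᶻ L (suc i) n) (trans (sym (ℤ.pos-* (n / suc i) (suc i))) (cong +_ (m/n*n≡m d)))
  ... | no ¬d = trans (cong (+ (n / suc i) *ᶻ + suc i *ᶻ_) (L-∤ (suc i) ¬d))
                  (trans (ℤ.*-zeroʳ (+ (n / suc i) *ᶻ + suc i)) (sym (trans (cong (+ n *ᶻ_) (L-∤ (suc i) ¬d)) (ℤ.*-zeroʳ (+ n)))))

  sum-over-divisors : ∀ (f : ℕ → ℤ) →
    foldr _+ᶻ_ 0ℤ (map f (filter (λ i → suc i ∣? n) (upTo n))) ≡ ∑< n (λ i → f i *ᶻ L (suc i) n)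
  sum-over-divisors f = go n id
    where
    -- The enumeration `g` is general because the induction replaces it by `g ∘ suc`; it starts as
    -- `id`.
    go : ∀ m (g : ℕ → ℕ) → foldr _+ᶻ_ 0ℤ (map f (filter (λ i → suc i ∣? n) (applyUpTo g m)))
                          ≡ ∑< m (λ i → f (g i) *ᶻ L (suc (g i)) n)
    go zero    g = sym (∑-nil _)
    go (suc m) g with suc (g 0) ∣? n
    ... | yes d = begin
      _ ≡⟨ cong (λ l → foldr _+ᶻ_ 0ℤ (map f l)) (filter-accept (λ i → suc i ∣? n) d) ⟩
      f (g 0) +ᶻ foldr _+ᶻ_ 0ℤ (map f (filter (λ i → suc i ∣? n) (applyUpTo (g ∘ suc) m)))
        ≡⟨ cong₂ _+ᶻ_ (sym (trans (cong (f (g 0) *ᶻ_) (L-∣ 1≤n (suc (g 0)) d)) (ℤ.*-identityʳ (f (g 0))))) (go m (g ∘ suc)) ⟩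
      _ ≡⟨ ∑-head m _ ⟨
      _ ∎
      where open ≡-Reasoning
    ... | no ¬d = begin
      _ ≡⟨ cong (λ l → foldr _+ᶻ_ 0ℤ (map f l)) (filter-reject (λ i → suc i ∣? n) ¬d) ⟩
      foldr _+ᶻ_ 0ℤ (map f (filter (λ i → suc i ∣? n) (applyUpTo (g ∘ suc) m)))
        ≡⟨ ℤ.+-identityˡ _ ⟨
      0ℤ +ᶻ foldr _+ᶻ_ 0ℤ (map f (filter (λ i → suc i ∣? n) (applyUpTo (g ∘ suc) m)))
        ≡⟨ cong₂ _+ᶻ_ (sym (trans (cong (f (g 0) *ᶻ_) (L-∤ (suc (g 0)) ¬d)) (ℤ.*-zeroʳ (f (g 0))))) (go m (g ∘ suc)) ⟩
      _ ≡⟨ ∑-head m _ ⟨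
      _ ∎
      where open ≡-Reasoning

-- The p-adic side

module _ (p : ℕ) .{{_ : NonZero p}} where

  private
    +p*p^ : ∀ n → + (p ^ suc n) ≡ + (p ^ n) *ᶻ + p
    +p*p^ n = trans (cong +_ (ℕ.*-comm p (p ^ n))) (ℤ.pos-* (p ^ n) p)

    p∣p^ : ∀ n → + p ∣ᶻ + (p ^ suc n)
    p∣p^ n = divides (+ (p ^ n)) (+p*p^ n)

    -- For variable `p`, `p ^ 1` reduces only to `p * 1`.
    p^1 : ∀ {x} → + (p ^ 1) ∣ᶻ x → + p ∣ᶻ x
    p^1 = ∣ᶻ.∣-trans (p∣p^ 0)

  open PAdic p

  module _ (w : PAdicInteger) (p∣w₁ : + p ∣ᶻ approx w 1) where

    p∣approx : ∀ n → + p ∣ᶻ approx w (suc n)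
    p∣approx zero    = p∣w₁
    p∣approx (suc n) = subst (+ p ∣ᶻ_)
      (solve 2 (λ x y → x :- y :+ y := x) refl (approx w (suc (suc n))) (approx w (suc n)))
      (∣m∣n⇒∣m+n (∣ᶻ.∣-trans (p∣p^ n) (coherent w (suc n))) (p∣approx n))

    -- Precision drops by one on division: the class of w modulo p^(n+1) determines w/p modulo p^n,
    -- hence the shifted index.
    w/p : PAdicInteger
    w/p = record
      { approx   = λ n → quotient (p∣approx n)
      ; coherent = λ n → ∣ᶻ.*-cancelʳ-∣ (+ p) (subst₂ _∣ᶻ_ (+p*p^ n) (quotients n) (coherent w (suc n))) }
      where
      quotients : ∀ n → approx w (suc (suc n)) -ᶻ approx w (suc n) ≡ (quotient (p∣approx (suc n)) -ᶻ quotient (p∣approx n)) *ᶻ + p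
      quotients n = trans (cong₂ _-ᶻ_ (_∣ᶻ_.equality (p∣approx (suc n))) (_∣ᶻ_.equality (p∣approx n)))
        (solve 3 (λ x y z → x :* z :- y :* z := (x :- y) :* z) refl (quotient (p∣approx (suc n))) (quotient (p∣approx n)) (+ p))

    w/p*p≈w : w/p *ₚ ι (+ p) ≈ w
    w/p*p≈w n = subst (λ x → x ≡ approx w n [mod p ^ n ]) (_∣ᶻ_.equality (p∣approx n)) (coherent w n)

  -- Membership in p ℤₚ is visible at the first approximation, which reduces the theorem to
  -- congruences between integers.
  p∣ₚ : ∀ {w} → + p ∣ᶻ approx w 1 → ι (+ p) ∣ₚ w
  p∣ₚ {w} h = w/p w h , w/p*p≈w w h

  ≡ₚ⇒approx₁ : ∀ {x y} → x ≡ₚ y → Congruent p (approx x 1) (approx y 1)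
  ≡ₚ⇒approx₁ {x} {y} (z , z*p≈) = congruent (subst (+ p ∣ᶻ_)
    (solve 2 (λ u v → u :- (u :- v) := v) refl (approx z 1 *ᶻ + p) (approx x 1 -ᶻ approx y 1))
    (∣m∣n⇒∣m+n (divides (approx z 1) refl) (∣m⇒∣-m (p^1 (z*p≈ 1)))))

  ≈⇒approx₁ : ∀ {x y} → x ≈ y → Congruent p (approx x 1) (approx y 1)
  ≈⇒approx₁ h = congruent (p^1 (h 1))

  approx-^ : ∀ x a n → approx (x ^ₚ a) n ≡ approx x n ^ᶻ a
  approx-^ x zero    n = refl
  approx-^ x (suc a) n = cong (approx x n *ᶻ_) (approx-^ x a n)

  pos-^ : ∀ m j → + (m ^ j) ≡ (+ m) ^ᶻ j
  pos-^ m zero    = refl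
  pos-^ m (suc j) = trans (ℤ.pos-* m (m ^ j)) (cong (+ m *ᶻ_) (pos-^ m j))

  -- The summand f is kept general and found by unification in the theorem:
  -- comparing two forms of the Eisenstein coefficient would compare the
  -- coherence proofs of its p-adic summands.
  divisorSum : (ℕ → PAdicInteger) → ℕ → PAdicInteger
  divisorSum f n = foldr _+ₚ_ 0# (map f (filter (λ i → suc i ∣? n) (upTo n)))

  approx-sum : ∀ (f : ℕ → PAdicInteger) (xs : List ℕ) n →
               approx (foldr _+ₚ_ 0# (map f xs)) n ≡ foldr _+ᶻ_ 0ℤ (map (λ i → approx (f i) n) xs)
  approx-sum f []       n = refl
  approx-sum f (x ∷ xs) n = cong (approx (f x) n +ᶻ_) (approx-sum f xs n)

  module _ (ω : ℕ → PAdicInteger) (teichmüller : IsTeichmüller ω) where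

    open IsTeichmüller teichmüller

    -- Valid also at the multiples of p, where both sides are divisible by p.
    ω-approx₁ : ∀ m → Congruent p (approx (ω m) 1) (+ m)
    ω-approx₁ m with p ∣? m
    ... | no ¬d = ≡ₚ⇒approx₁ {ω m} {ι (+ m)} (reduction m ¬d)
    ... | yes d@(dividesⁿ q eq) = ≋-trans (≈⇒approx₁ {ω m} {0#} (zero-at-multiples m d))
          (≋-sym (∣⇒≋0 (divides (+ q) (trans (cong +_ eq) (ℤ.pos-* q p)))))

    power-approx₁ : ∀ a m → Congruent p (approx (power ω a m) 1) ((+ m) ^ᶻ a)
    power-approx₁ a m = ≋-trans (≋-reflexive (approx-^ (ω m) a 1)) (≋-^ (ω-approx₁ m) a)

  module _ {ψ : ℕ → PAdicInteger} {a : ℕ} (ψ-approx₁ : ∀ m → Congruent p (approx (ψ m) 1) ((+ m) ^ᶻ a)) where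

    -- At 0 a positive power gives ψ(0) ≡ 0, whereas triviality would give 1.
    nontrivial : 2 ≤ p → 1 ≤ a → Nontrivial ψ
    nontrivial 2≤p 1≤a trivial = ℕ.<⇒≱ 2≤p (ℕ∣.∣⇒≤ (∣ᶻ.∣⇒∣ᵤ (difference 1≋0)))
      where
      0^ : ∀ {a} → 1 ≤ a → 0ℤ ^ᶻ a ≡ 0ℤ
      0^ {suc a} _ = ℤ.*-zeroˡ (0ℤ ^ᶻ a)
      1≋0 : Congruent p 1ℤ 0ℤ
      1≋0 = ≋-trans (≋-sym (≈⇒approx₁ {ψ 0} {1#} (trivial 0))) (≋-trans (ψ-approx₁ 0) (≋-reflexive (0^ 1≤a)))

  module _ (q : ℕ) (fermat : ∀ d → Congruent p ((+ d) ^ᶻ suc q) ((+ d) ^ᶻ 1)) (a b k : ℕ) {n : ℕ} (1≤n : 1 ≤ n)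
    {f : ℕ → PAdicInteger}
    (f-approx₁ : ∀ i → Congruent p (approx (f i) 1) ((+ (n / suc i)) ^ᶻ a *ᶻ (+ suc i) ^ᶻ b *ᶻ + (suc i ^ suc k))) where

    -- The weight is k + 2 here, so d^(weight - 1) is `suc i ^ suc k`; the b-th power of the
    -- character adds b to this exponent modulo p.
    divisorSum-approx₁ : Congruent p (approx (divisorSum f n) 1)
      (∑< n (λ i → (+ (n / suc i)) ^ᶻ a *ᶻ (+ suc i) ^ᶻ (b + suc k) *ᶻ L (suc i) n))
    divisorSum-approx₁ = ≋-trans
      (≋-reflexive (trans (approx-sum f (filter (λ i → suc i ∣? n) (upTo n)) 1)
        (sum-over-divisors 1≤n (λ i → approx (f i) 1))))
      (≋-∑ n (λ i → ≋-*ʳ (L (suc i) n) (≋-trans (f-approx₁ i) (≋-reflexive (collect i)))))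
      where
      collect : ∀ i → (+ (n / suc i)) ^ᶻ a *ᶻ (+ suc i) ^ᶻ b *ᶻ + (suc i ^ suc k) ≡ (+ (n / suc i)) ^ᶻ a *ᶻ (+ suc i) ^ᶻ (b + suc k)
      collect i = begin
        m^a *ᶻ d^b *ᶻ + (suc i ^ suc k)     ≡⟨ cong (m^a *ᶻ d^b *ᶻ_) (pos-^ (suc i) (suc k)) ⟩
        m^a *ᶻ d^b *ᶻ (+ suc i) ^ᶻ suc k    ≡⟨ ℤ.*-assoc m^a d^b ((+ suc i) ^ᶻ suc k) ⟩
        m^a *ᶻ (d^b *ᶻ (+ suc i) ^ᶻ suc k)  ≡⟨ cong (m^a *ᶻ_) (ℤ.^-distribˡ-+-* (+ suc i) b (suc k)) ⟨
        m^a *ᶻ (+ suc i) ^ᶻ (b + suc k)     ∎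
        where
        open ≡-Reasoning
        m^a d^b : ℤ
        m^a = (+ (n / suc i)) ^ᶻ a
        d^b = (+ suc i) ^ᶻ b

    private
      reduce-exponent : ∀ f → + (b + suc k) ≡ + suc f [mod q ] → ∀ d → Congruent p ((+ d) ^ᶻ (b + suc k)) ((+ d) ^ᶻ suc f)
      reduce-exponent f h d = subst (λ e → Congruent p ((+ d) ^ᶻ e) ((+ d) ^ᶻ suc f)) (sym (ℕ.+-suc b k))
        (^-exponent q fermat d {b + k} {f} (subst (λ e → + e ≡ + suc f [mod q ]) (ℕ.+-suc b k) h))

    module _ (r : ℕ) where

      -- (n/d) d^(r+1) = n d^r for every divisor d.
      coefficient-a≡1 : a ≡ 1 → + (b + suc k) ≡ + suc r [mod q ] → Congruent p (approx (divisorSum f n) 1) (+ n *ᶻ σ-series r n)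
      coefficient-a≡1 refl h = ≋-trans divisorSum-approx₁ (≋-trans
        (≋-∑ n (λ i → ≋-*ʳ (L (suc i) n) (≋-*ˡ ((+ (n / suc i)) ^ᶻ 1) (reduce-exponent r h (suc i)))))
        (≋-reflexive (trans (∑-cong n swap) (sym (∑-*ˡ n (+ n) _)))))
        where
        swap : ∀ i → (+ (n / suc i)) ^ᶻ 1 *ᶻ (+ suc i) ^ᶻ suc r *ᶻ L (suc i) n ≡ + n *ᶻ ((+ suc i) ^ᶻ r *ᶻ L (suc i) n)
        swap i = begin
          _ ≡⟨ solve 4 (λ m d dr l → m :^ 1 :* (d :* dr) :* l := dr :* (m :* d :* l)) refl
                 (+ (n / suc i)) (+ suc i) ((+ suc i) ^ᶻ r) (L (suc i) n) ⟩
          _ ≡⟨ cong ((+ suc i) ^ᶻ r *ᶻ_) (cofactor 1≤n i) ⟩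
          _ ≡⟨ solve 3 (λ dr n l → dr :* (n :* l) := n :* (dr :* l)) refl ((+ suc i) ^ᶻ r) (+ n) (L (suc i) n) ⟩
          _ ∎
          where open ≡-Reasoning

      -- (n/d)^(r+1) d = n (n/d)^r, and summing over n/d is summing over d.
      coefficient-a≡suc-r : a ≡ suc r → + (b + suc k) ≡ + 1 [mod q ] → Congruent p (approx (divisorSum f n) 1) (+ n *ᶻ σ-series r n)
      coefficient-a≡suc-r refl h = ≋-trans divisorSum-approx₁ (≋-trans
        (≋-∑ n (λ i → ≋-*ʳ (L (suc i) n) (≋-*ˡ ((+ (n / suc i)) ^ᶻ suc r) (reduce-exponent 0 h (suc i)))))
        (≋-reflexive (trans (∑-cong n swap) (trans (sym (∑-*ˡ n (+ n) _))
          (cong (+ n *ᶻ_) (divisor-reflection 1≤n (λ d → (+ d) ^ᶻ r)))))))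
        where
        swap : ∀ i → (+ (n / suc i)) ^ᶻ suc r *ᶻ (+ suc i) ^ᶻ 1 *ᶻ L (suc i) n ≡ + n *ᶻ ((+ (n / suc i)) ^ᶻ r *ᶻ L (suc i) n)
        swap i = begin
          _ ≡⟨ solve 4 (λ m mr d l → m :* mr :* d :^ 1 :* l := mr :* (m :* d :* l)) refl
                 (+ (n / suc i)) ((+ (n / suc i)) ^ᶻ r) (+ suc i) (L (suc i) n) ⟩
          _ ≡⟨ cong ((+ (n / suc i)) ^ᶻ r *ᶻ_) (cofactor 1≤n i) ⟩
          _ ≡⟨ solve 3 (λ mr n l → mr :* (n :* l) := n :* (mr :* l)) refl ((+ (n / suc i)) ^ᶻ r) (+ n) (L (suc i) n) ⟩
          _ ∎
          where open ≡-Reasoning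

-- The primes 3, 5 and 7 together

fermat₃ : ∀ d → Congruent 3 ((+ d) ^ᶻ 3) ((+ d) ^ᶻ 1)
fermat₃ d = congruent (subst (+ 3 ∣ᶻ_)
  (solve 4 (λ s f c l → con 0ℤ :* s :+ con 0ℤ :* f :+ con 1ℤ :* c :+ :- con 1ℤ :* l := c :- l) refl
    ((+ d) ^ᶻ 7) ((+ d) ^ᶻ 5) ((+ d) ^ᶻ 3) ((+ d) ^ᶻ 1)) (3∣d³-d d))

fermat₅ : ∀ d → Congruent 5 ((+ d) ^ᶻ 5) ((+ d) ^ᶻ 1)
fermat₅ d = congruent (subst (+ 5 ∣ᶻ_)
  (solve 4 (λ s f c l → con 0ℤ :* s :+ con 1ℤ :* f :+ con 0ℤ :* c :+ :- con 1ℤ :* l := f :- l) refl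
    ((+ d) ^ᶻ 7) ((+ d) ^ᶻ 5) ((+ d) ^ᶻ 3) ((+ d) ^ᶻ 1)) (5∣d⁵-d d))

fermat₇ : ∀ d → Congruent 7 ((+ d) ^ᶻ 7) ((+ d) ^ᶻ 1)
fermat₇ d = congruent (subst (+ 7 ∣ᶻ_)
  (solve 4 (λ s f c l → con 1ℤ :* s :+ con 0ℤ :* f :+ con 0ℤ :* c :+ :- con 1ℤ :* l := s :- l) refl
    ((+ d) ^ᶻ 7) ((+ d) ^ᶻ 5) ((+ d) ^ᶻ 3) ((+ d) ^ᶻ 1)) (7∣d⁷-d d))

mod-pred : ∀ {m e f} → + suc e ≡ + suc f [mod m ] → + e ≡ + f [mod m ]
mod-pred {m} {e} {f} = subst (+ m ∣ᶻ_)
  (solve 2 (λ x y → (con 1ℤ :+ x) :- (con 1ℤ :+ y) := x :- y) refl (+ e) (+ f))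

τ≡Δ : ∀ {n} → 1 ≤ n → τ n ≡ Δ n
τ≡Δ {suc n} _ = refl

module _ (p : ℕ) .{{_ : NonZero p}} where

  open PAdic p

  -- Uniform in the primes: q = p - 1, and r = 1, 1, 3 for p = 3, 5, 7. In these terms the cases
  -- read a = 1, b + k ≡ r + 2 and a = r + 1, b + k ≡ 2.
  Δ≋ : ∀ q r → (∀ d → Congruent p ((+ d) ^ᶻ suc q) ((+ d) ^ᶻ 1)) → (∀ n → 1 ≤ n → + p ∣ᶻ Δ n -ᶻ + n *ᶻ σ-series r n) →
    ∀ a b k → 2 ≤ k →
    (((a ≡ 1) × ((+ (b + k)) ≡ (+ suc (suc r)) [mod q ])) ⊎ ((a ≡ suc r) × ((+ (b + k)) ≡ (+ 2) [mod q ]))) →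
    ∀ {n} → 1 ≤ n → ∀ {f} →
    (∀ i → Congruent p (approx (f i) 1) ((+ (n / suc i)) ^ᶻ a *ᶻ (+ suc i) ^ᶻ b *ᶻ + (suc i ^ (k ∸ 1)))) →
    Congruent p (Δ n) (approx (divisorSum p f n) 1)
  Δ≋ q r fermat τ-mod a b (suc (suc k)) (s≤s (s≤s _)) cases {n} 1≤n {f} f₁ =
    ≋-trans (congruent {x = Δ n} {y = + n *ᶻ σ-series r n} (τ-mod n 1≤n)) (≋-sym (coefficient cases))
    where
    e-pred : ∀ f → (+ (b + suc (suc k))) ≡ (+ suc f) [mod q ] → (+ (b + suc k)) ≡ (+ f) [mod q ]
    e-pred f h = mod-pred {q} {b + suc k} {f} (subst (λ s → (+ s) ≡ (+ suc f) [mod q ]) (ℕ.+-suc b (suc k)) h)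
    coefficient : ((a ≡ 1) × ((+ (b + suc (suc k))) ≡ (+ suc (suc r)) [mod q ])) ⊎
                  ((a ≡ suc r) × ((+ (b + suc (suc k))) ≡ (+ 2) [mod q ])) →
                  Congruent p (approx (divisorSum p f n) 1) (+ n *ᶻ σ-series r n)
    coefficient (inj₁ (a≡ , h)) = coefficient-a≡1 p q fermat a b k 1≤n {f} f₁ r a≡ (e-pred (suc r) h)
    coefficient (inj₂ (a≡ , h)) = coefficient-a≡suc-r p q fermat a b k 1≤n {f} f₁ r a≡ (e-pred 1 h)

  Case-i Case-ii : (k a b : ℕ) → Set
  Case-i k a b = (p ≡ 3 ⊎ p ≡ 5) ×
    (((a ≡ 1) × ((+ (b + k)) ≡ (+ 3) [mod p ∸ 1 ])) ⊎
    ((a ≡ 2) × ((+ (b + k)) ≡ (+ 2) [mod p ∸ 1 ])))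
  Case-ii k a b = (p ≡ 7) ×
    (((a ≡ 1) × ((+ (b + k)) ≡ (+ 5) [mod 6 ])) ⊎
    ((a ≡ 4) × ((+ (b + k)) ≡ (+ 2) [mod 6 ])))

  Δ≋divisorSum : ∀ a b k → 2 ≤ k → Case-i k a b ⊎ Case-ii k a b → ∀ {n} → 1 ≤ n → ∀ {f} →
    (∀ i → Congruent p (approx (f i) 1) ((+ (n / suc i)) ^ᶻ a *ᶻ (+ suc i) ^ᶻ b *ᶻ + (suc i ^ (k ∸ 1)))) →
    Congruent p (Δ n) (approx (divisorSum p f n) 1)
  Δ≋divisorSum a b k 2≤k (inj₁ (inj₁ refl , cases)) {n} 1≤n {f} f₁ = Δ≋ 2 1 fermat₃ τ-mod3 a b k 2≤k cases {n} 1≤n {f} f₁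
  Δ≋divisorSum a b k 2≤k (inj₁ (inj₂ refl , cases)) {n} 1≤n {f} f₁ = Δ≋ 4 1 fermat₅ (λ n _ → τ-mod5 n) a b k 2≤k cases {n} 1≤n {f} f₁
  Δ≋divisorSum a b k 2≤k (inj₂ (refl , cases)) {n} 1≤n {f} f₁ = Δ≋ 6 3 fermat₇ (λ n _ → τ-mod7 n) a b k 2≤k cases {n} 1≤n {f} f₁

theorem3p1 :
  ∀ (p : ℕ) → (p ≡ 3 ⊎ p ≡ 5 ⊎ p ≡ 7) →
  let open PAdic p in
  ∀ (ω : ℕ → PAdicInteger) → IsTeichmüller ω →
  ∀ (k a b : ℕ) → 2 ≤ k → 1 ≤ a → a ≤ p ∸ 1 → b ≤ p ∸ 1 →
  let c = eisensteinCoeff k (power ω a) (power ω b)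
      case-i = (p ≡ 3 ⊎ p ≡ 5) ×
               (((a ≡ 1) × ((+ (b + k)) ≡ (+ 3) [mod p ∸ 1 ])) ⊎
                ((a ≡ 2) × ((+ (b + k)) ≡ (+ 2) [mod p ∸ 1 ])))
      case-ii = (p ≡ 7) ×
                (((a ≡ 1) × ((+ (b + k)) ≡ (+ 5) [mod 6 ])) ⊎
                 ((a ≡ 4) × ((+ (b + k)) ≡ (+ 2) [mod 6 ])))
  in
  (case-i → ∀ (n : ℕ) → 1 ≤ n → ι (τ n) ≡ₚ c n) ×
  (case-ii → ∀ (n : ℕ) → 1 ≤ n → ι (τ n) ≡ₚ c n) ×
  (∀ (E : PowerSeries PAdicInteger) → IsEisensteinSeries k (power ω a) (power ω b) E →
    (Δ 0 ≡ 0ℤ) × (E 0 ≈ 0#) ×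
    ((case-i ⊎ case-ii) → ∀ (n : ℕ) → ι (Δ n) ≡ₚ E n))
theorem3p1 p p∈ ω teich k a b 2≤k 1≤a _ _ =
    (λ case-i  n 1≤n → p∣ₚ p (difference (τ≋ (inj₁ case-i) 1≤n (terms n))))
  , (λ case-ii n 1≤n → p∣ₚ p (difference (τ≋ (inj₂ case-ii) 1≤n (terms n))))
  , λ E eisenstein →
      let E0 = PAdic.IsEisensteinSeries.constantTerm eisenstein (nontrivial p {power p ω a} {a} (power-approx₁ p ω teich a) (2≤p p∈) 1≤a)
      in refl , E0 , λ cases n → p∣ₚ p (difference (at-every-n E E0
           (λ m 1≤m → ≋-trans (Δ≋divisorSum p a b k 2≤k cases 1≤m (terms m))
             (≋-sym (modulo-p (PAdic.IsEisensteinSeries.coefficient eisenstein m 1≤m 1)))) n))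
  where
  instance
    p≢0 : NonZero p
    p≢0 = nonZero p∈
      where
      nonZero : p ≡ 3 ⊎ p ≡ 5 ⊎ p ≡ 7 → NonZero p
      nonZero (inj₁ refl)        = _
      nonZero (inj₂ (inj₁ refl)) = _
      nonZero (inj₂ (inj₂ refl)) = _

  2≤p : ∀ {p} → p ≡ 3 ⊎ p ≡ 5 ⊎ p ≡ 7 → 2 ≤ p
  2≤p (inj₁ refl)        = s≤s (s≤s z≤n)
  2≤p (inj₂ (inj₁ refl)) = s≤s (s≤s z≤n)
  2≤p (inj₂ (inj₂ refl)) = s≤s (s≤s z≤n)

  open PAdic using (PAdicInteger; power)
  open PAdicInteger

  terms : ∀ n i → Congruent p (approx (power p ω a (n / suc i)) 1 *ᶻ approx (power p ω b (suc i)) 1 *ᶻ + (suc i ^ (k ∸ 1)))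
                              ((+ (n / suc i)) ^ᶻ a *ᶻ (+ suc i) ^ᶻ b *ᶻ + (suc i ^ (k ∸ 1)))
  terms n i = ≋-*ʳ (+ (suc i ^ (k ∸ 1))) (≋-* (power-approx₁ p ω teich a (n / suc i)) (power-approx₁ p ω teich b (suc i)))

  τ≋ : Case-i p k a b ⊎ Case-ii p k a b → ∀ {n} → 1 ≤ n → ∀ {f} →
    (∀ i → Congruent p (approx (f i) 1) ((+ (n / suc i)) ^ᶻ a *ᶻ (+ suc i) ^ᶻ b *ᶻ + (suc i ^ (k ∸ 1)))) →
    Congruent p (τ n) (approx (divisorSum p f n) 1)
  τ≋ cases {n} 1≤n {f} f₁ = subst (λ t → Congruent p t (approx (divisorSum p f n) 1)) (sym (τ≡Δ 1≤n))
    (Δ≋divisorSum p a b k 2≤k cases 1≤n {f} f₁)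

  modulo-p : ∀ {x y} → x ≡ y [mod p ^ 1 ] → Congruent p x y
  modulo-p {x} {y} h = congruent (subst (λ m → x ≡ y [mod m ]) (ℕ.*-identityʳ p) h)

  at-every-n : ∀ (E : ℕ → PAdicInteger p) → PAdic._≈_ p (E 0) (PAdic.0# p) →
    (∀ n → 1 ≤ n → Congruent p (Δ n) (approx (E n) 1)) → ∀ n → Congruent p (Δ n) (approx (E n) 1)
  at-every-n E E0 h n with n ℕ.≟ 0
  -- At n = 0 both constant terms vanish.
  ... | yes refl = ≋-sym (modulo-p {approx (E 0) 1} {0ℤ} (E0 1))
  ... | no n≢0   = h n (ℕ.n≢0⇒n>0 n≢0)
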